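{- Let $G$ be a chordless plane near-triangulation with outer cycle $C(G)$ on vertices $v_1,\dots,v_i$, $i\in\{3,4,5\}$, and interior vertices $u_1,\dots,u_j$. Suppose that when $i=5$ no interior vertex is adjacent to all vertices of $C(G)$. Then for every monomial $\eta v_1^{\alpha_1}\cdots v_i^{\alpha_i}$ with $\eta\neq0$ in $P(C(G))$, there is a monomial $$\eta'\, v_1^{\alpha_1}\cdots v_i^{\alpha_i}u_1^{\beta_1}\cdots u_j^{\beta_j}$$ in $P(G)$ with $\eta'\neq 0$ and $\beta_k\le 4$ for all $1\le k\le j$.
   Context: For a graph $G$, its vertices are also used as variables, and $P(G)=\prod_{uv\in E(G),\,u<v}(u-v)$ for an arbitrarily fixed orientation $<$ (which only affects the overall sign). "$P(G)$ contains the monomial $\eta M$" means the coefficient of $M$ in the expansion of $P(G)$ is $\eta$. A plane near-triangulation is a plane graph whose outer face is bounded by a cycle $C(G)$ and all of whose other faces are triangles; it is chordless if no edge joins two non-consecutive vertices of $C(G)$. $P(C(G))$ is the polynomial of the cycle $C(G)$ as a graph. -}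

module Defs where

open import Data.Nat using (ℕ; zero; suc; _+_; _*_; _≤_; _<_; _≤ᵇ_; _≡ᵇ_; pred)
open import Data.Integer as ℤ using (ℤ; +_) renaming (_-_ to _⊖_)
open import Data.Fin using (Fin; toℕ)
open import Data.Fin.Properties using (_≟_)
open import Data.List using (List; []; _∷_; map; filter; length; allFin; upTo)
open import Data.Bool using (Bool; true; false; if_then_else_)
open import Data.Product using (Σ; ∃; _×_; _,_)
open import Data.Sum using (_⊎_)
open import Relation.Nullary using (¬_; does)
open import Relation.Binary.PropositionalEquality using (_≡_; _≢_)

iter : ∀ {A : Set} → (A → A) → ℕ → A → A
iter f zero    x = x
iter f (suc k) x = f (iter f k x)

-- Polynomials  P = ∏_{(u,v) ∈ es} (x_u - x_v)  over ℤ, in variables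
-- indexed by Fin n.  A monomial x^e is given by its exponent vector
-- e : Fin n → ℕ.  coeff es e is the coefficient of x^e in the
-- expansion of the product, computed by the expansion rule
--   [x^e] ((x_u - x_v) Q) = [e_u ≥ 1] [x^(e - 1_u)] Q
--                          - [e_v ≥ 1] [x^(e - 1_v)] Q ,
--   [x^e] 1 = [e = 0].

allB : ∀ {A : Set} → (A → Bool) → List A → Bool
allB p [] = true
allB p (a ∷ as) = if p a then allB p as else false

isZeroExp : ∀ {n} → (Fin n → ℕ) → Bool
isZeroExp {n} e = allB (λ k → e k ≡ᵇ 0) (allFin n)

lower : ∀ {n} → (Fin n → ℕ) → Fin n → (Fin n → ℕ)
lower e w k = if does (k ≟ w) then pred (e k) else e k

coeff : ∀ {n} → List (Fin n × Fin n) → (Fin n → ℕ) → ℤ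
coeff [] e = if isZeroExp e then + 1 else + 0
coeff ((u , v) ∷ es) e = step u ⊖ step v
  where
  step : _ → ℤ
  step w with e w
  ... | zero  = + 0
  ... | suc _ = coeff es (lower e w)

-- Plane graphs as combinatorial maps (rotation systems).
-- Darts Fin d; each dart x goes from tail x to tail (rev x);
-- rev is the fixed-point-free involution pairing the two darts of an
-- edge; rot is the rotation (cyclic order of darts around a vertex).
-- Faces are the orbits of φ = rot ∘ rev.

data Reach {n d : ℕ} (tail : Fin d → Fin n) (rev : Fin d → Fin d)
           : Fin n → Fin n → Set where
  here : ∀ {u} → Reach tail rev u u
  step : ∀ {u v} (x : Fin d) → tail x ≡ u →
         Reach tail rev (tail (rev x)) v → Reach tail rev u v

isOrbitMin : ∀ {d} → (Fin d → Fin d) → Fin d → Bool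
isOrbitMin {d} f x = allB (λ k → toℕ x ≤ᵇ toℕ (iter f k x)) (upTo d)

countTrue : ∀ {A : Set} → (A → Bool) → List A → ℕ
countTrue p [] = 0
countTrue p (a ∷ as) = if p a then suc (countTrue p as) else countTrue p as

numOrbits : ∀ {d} → (Fin d → Fin d) → ℕ
numOrbits {d} f = countTrue (isOrbitMin f) (allFin d)

-- A connected simple graph on vertex set Fin n with an embedding in the
-- plane (sphere), given as a rotation system of genus 0.
record PlaneGraph (n : ℕ) : Set where
  field
    d      : ℕ
    tail   : Fin d → Fin n
    rev    : Fin d → Fin d
    rot    : Fin d → Fin d
    rev-invol  : ∀ x → rev (rev x) ≡ x
    rev-nofix  : ∀ x → rev x ≢ x
    rot-inj    : ∀ x y → rot x ≡ rot y → x ≡ y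
    rot-tail   : ∀ x → tail (rot x) ≡ tail x
    rot-trans  : ∀ x y → tail x ≡ tail y → ∃ λ k → iter rot k x ≡ y
    no-loop    : ∀ x → tail (rev x) ≢ tail x
    no-multi   : ∀ x y → tail x ≡ tail y → tail (rev x) ≡ tail (rev y) → x ≡ y
    connected  : ∀ u v → Reach tail rev u v
    -- Euler's formula V - E + F = 2 (genus 0), with E = d/2
    euler      : 2 * n + 2 * numOrbits (λ x → rot (rev x)) ≡ d + 4

  φ : Fin d → Fin d
  φ x = rot (rev x)

  Adj : Fin n → Fin n → Set
  Adj u v = Σ (Fin d) λ x → tail x ≡ u × tail (rev x) ≡ v

  -- edge list of G, each edge {x, rev x} listed once (orientation fixed
  -- by toℕ x < toℕ (rev x)); the orientation only affects the sign of P(G)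
  edges : List (Fin n × Fin n)
  edges = map (λ x → tail x , tail (rev x))
              (filter (λ x → suc (toℕ x) Data.Nat.≤? toℕ (rev x)) (allFin d))

-- Plane near-triangulation: the face (φ-orbit) of the dart o is the outer
-- face, of length len ≥ 3, bounded by a cycle; every other face is a triangle.
record IsNearTriangulation {n : ℕ} (G : PlaneGraph n) (len : ℕ) (o : Fin (PlaneGraph.d G)) : Set where
  open PlaneGraph G
  field
    len≥3       : 3 ≤ len
    outer-close : iter φ len o ≡ o
    outer-len   : ∀ k → 0 < k → k < len → iter φ k o ≢ o
    outer-cycle : ∀ k l → k < len → l < len →
                  tail (iter φ k o) ≡ tail (iter φ l o) → k ≡ l
    inner-tri   : ∀ x → (∀ k → iter φ k o ≢ x) → (φ x ≢ x × iter φ 3 x ≡ x)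

module _ {n : ℕ} (G : PlaneGraph n) (len : ℕ) (o : Fin (PlaneGraph.d G)) where
  open PlaneGraph G

  cyc : Fin len → Fin n
  cyc k = tail (iter φ (toℕ k) o)

  cycNext : Fin len → Fin n
  cycNext k = tail (iter φ (suc (toℕ k)) o)

  cycleEdges : List (Fin n × Fin n)
  cycleEdges = map (λ k → cyc k , cycNext k) (allFin len)

  Chordless : Set
  Chordless = ∀ k l → Adj (cyc k) (cyc l) → cycNext k ≡ cyc l ⊎ cycNext l ≡ cyc k

  Interior : Fin n → Set
  Interior w = ∀ k → cyc k ≢ w

{-# OPTIONS --safe #-}
module Submission where

-- A monomial of P(G) that agrees with α on the outer cycle C has degree |C| in the variables of C,
-- and P(C) alone already accounts for it. Hence the remaining factors contribute interior variables
-- only, and it suffices to find such a monomial, with exponents at most 4, in the product over the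
-- edges that meet the interior.
--
-- If no interior vertex has three neighbours on C, take the interior with exponents at most 2 next to
-- C and at most 4 elsewhere (Zhu's Alon–Tarsi form of Thomassen's theorem), and let the edges to C
-- add at most 2. Otherwise move a vertex with at least three neighbours on C to the boundary, with
-- priority for four neighbours when |C| = 5. As K₃,₃ is not planar, each component of the remaining
-- interior attaches only to a cycle of length at most 4, or to one of length 5 without a centre.
--
-- Planarity enters through potentials. By Euler's formula a linear system over ℤ has more unknowns
-- than equations, and a solution writes a nonzero multiple of a given circulation as the difference
-- of a function on the faces. This function separates the two sides of a closed curve.

open import Defs
open import Data.Bool as Bool using (Bool; true; false; if_then_else_; T)
open import Data.Empty using (⊥; ⊥-elim)
open import Data.Fin as Fin using (Fin; zero; suc; toℕ)
import Data.Fin.Permutation as Perm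
import Data.Fin.Properties as Finₚ
open import Data.Fin.Subset using (Subset; ∣_∣) renaming (_∈_ to _∈ˢ_)
import Data.Fin.Subset.Properties as Subsetₚ
open import Data.Integer as Int using (ℤ; +_; -[1+_])
import Data.Integer.Properties as ℤₚ
open import Data.Integer.Tactic.RingSolver using (solve-∀)
open import Data.List as List using (List; []; _∷_; _++_; length)
open import Data.List.Membership.Propositional using (_∈_; _∉_; find)
import Data.List.Membership.Propositional.Properties as ∈ₚ
import Data.List.Properties as Listₚ
open import Data.List.Relation.Binary.Sublist.Propositional as Sublist using (_⊆_; _∷ʳ_; _∷_; [])
import Data.List.Relation.Binary.Sublist.Propositional.Properties as Sublistₚ
open import Data.List.Relation.Unary.All as All using (All; []; _∷_)
import Data.List.Relation.Unary.All.Properties as Allₚ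
open import Data.List.Relation.Unary.AllPairs using (AllPairs; []; _∷_)
import Data.List.Relation.Unary.AllPairs.Properties as AllPairsₚ
open import Data.List.Relation.Unary.Any as Any using (Any; here; there)
open import Data.List.Relation.Unary.Linked as Chain using ([]; [-]; _∷_)
open import Data.List.Relation.Unary.Unique.Propositional using (Unique)
import Data.List.Relation.Unary.Unique.Propositional.Properties as Uniqueₚ
open import Data.Nat as Nat using (ℕ; zero; suc; _≤_; _<_; z≤n; s≤s)
import Data.Nat.Properties as ℕₚ
import Data.Nat.Tactic.RingSolver as ℕSolver
open import Data.Product using (Σ; ∃; ∃₂; _×_; _,_; proj₁; proj₂)
open import Data.Sum using (_⊎_; inj₁; inj₂; [_,_]′)
open import Data.Unit using (tt)
open import Data.Vec as Vec using ()
import Data.Vec.Properties as Vecₚ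
open import Function using (_∘_; case_of_; id)
open import Relation.Binary.Definitions using (tri<; tri≈; tri>)
open import Relation.Binary.PropositionalEquality
open import Relation.Nullary using (¬_; Dec; yes; no; does; contradiction)
open import Relation.Nullary.Decidable using (dec-true; dec-false; decidable-stable; _×-dec_; _⊎-dec_; _→-dec_; ¬?)

-- All steps stay inside the one map `G`. Removing a vertex, cutting along a chord or passing to a
-- component would otherwise call for new rotation systems with new Euler counts. Instead they
-- shrink a vertex set `U`, and in the Thomassen-type induction the outer face is replaced by a
-- connected set `R`: the boundary of `U` is what is adjacent to `R`. Planarity is then asked only
-- two questions about `G`: whether a chord separates, and whether K₃,₃ can occur with two of its
-- vertices blown up to connected sets. Coefficients, unlike colourings, can cancel. This is avoided
-- by giving one end of an edge exponent 0, which forces the other end to supply the variable ("to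
-- pay"). The choices compete in one place, a removed boundary vertex with a further boundary
-- neighbour. The bounds are tight. A vertex next to C pays 2 inside and at most 2 for C. A vertex
-- moved to the boundary pays for its neighbours on C alone, so four are allowed and the centre of a
-- pentagon, paying 5, is not. Vertices with four neighbours go first so that no pentagon created
-- later has a centre.

-- Fraction-free linear algebra over ℤ.

module IntegerKernel where
  open Int using (_+_; _*_; -_; _-_)

  -- Quantifying over every `z` that agrees pointwise with the combination builds in that `f`
  -- respects pointwise equality, which function arguments do not give for free.
  Linear : ∀ {k} → ((Fin k → ℤ) → ℤ) → Set
  Linear {k} f = ∀ a b (x y z : Fin k → ℤ) →
    (∀ i → z i ≡ a * x i + b * y i) → f z ≡ a * f x + b * f y

  cons : ∀ {k} → ℤ → (Fin k → ℤ) → (Fin (suc k) → ℤ)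
  cons a y zero    = a
  cons a y (suc i) = y i

  unit₀ : ∀ {k} → Fin (suc k) → ℤ
  unit₀ = cons (+ 1) (λ _ → + 0)

  -- Solving `f x = 0` for the first coordinate would divide by `f unit₀`; multiplying the other
  -- coordinates by `f unit₀` keeps the solution integral.
  eliminate : ∀ {k} → ((Fin (suc k) → ℤ) → ℤ) → (Fin k → ℤ) → (Fin (suc k) → ℤ)
  eliminate f y = cons (- f (cons (+ 0) y)) (λ i → f unit₀ * y i)

  eliminate-zero : ∀ {k} {f : (Fin (suc k) → ℤ) → ℤ} → Linear f → ∀ y → f (eliminate f y) ≡ + 0
  eliminate-zero {f = f} lin y = trans
    (lin (f unit₀) (- f (cons (+ 0) y)) (cons (+ 0) y) unit₀ _
      λ { zero → l₁ (f unit₀) (f (cons (+ 0) y)) ; (suc i) → l₂ (f unit₀) (f (cons (+ 0) y)) (y i) })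
    (l₃ (f unit₀) (f (cons (+ 0) y)))
    where
    l₁ : ∀ a b → - b ≡ a * + 0 + - b * + 1
    l₁ = solve-∀
    l₂ : ∀ a b c → a * c ≡ a * c + - b * + 0
    l₂ = solve-∀
    l₃ : ∀ a b → a * b + - b * a ≡ + 0
    l₃ = solve-∀

  eliminate-linear : ∀ {k} {f g : (Fin (suc k) → ℤ) → ℤ} → Linear f → Linear g →
    Linear (g ∘ eliminate f)
  eliminate-linear {k} {f} {g} linf ling a b x y z eq =
    ling a b (eliminate f x) (eliminate f y) (eliminate f z)
      λ { zero → trans (cong -_ (linf a b (cons (+ 0) x) (cons (+ 0) y) (cons (+ 0) z) pt))
                       (l₁ a b (f (cons (+ 0) x)) (f (cons (+ 0) y)))
        ; (suc i) → trans (cong (f unit₀ *_) (eq i)) (l₂ a b (f unit₀) (x i) (y i)) }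
    where
    l₁ : ∀ a b c d → - (a * c + b * d) ≡ a * (- c) + b * (- d)
    l₁ = solve-∀
    l₂ : ∀ a b e c d → e * (a * c + b * d) ≡ a * (e * c) + b * (e * d)
    l₂ = solve-∀
    l₃ : ∀ a b → + 0 ≡ a * + 0 + b * + 0
    l₃ = solve-∀
    pt : ∀ i → cons (+ 0) z i ≡ a * cons (+ 0) x i + b * cons (+ 0) y i
    pt zero = l₃ a b
    pt (suc i) = eq i

  Functional : ℕ → Set
  Functional k = Σ ((Fin k → ℤ) → ℤ) Linear

  _⊕_ _⊝_ : ∀ {k} → Functional k → Functional k → Functional k
  (f , linf) ⊕ (g , ling) = (λ x → f x + g x) , λ a b x y z eq →
    trans (cong₂ _+_ (linf a b x y z eq) (ling a b x y z eq)) (l a b (f x) (f y) (g x) (g y))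
    where
    l : ∀ a b p q r s → (a * p + b * q) + (a * r + b * s) ≡ a * (p + r) + b * (q + s)
    l = solve-∀
  (f , linf) ⊝ (g , ling) = (λ x → f x - g x) , λ a b x y z eq →
    trans (cong₂ _-_ (linf a b x y z eq) (ling a b x y z eq)) (l a b (f x) (f y) (g x) (g y))
    where
    l : ∀ a b p q r s → (a * p + b * q) - (a * r + b * s) ≡ a * (p - r) + b * (q - s)
    l = solve-∀

  _⊛_ : ∀ {k} → Functional k → ℤ → Functional k
  (f , linf) ⊛ c = (λ x → f x * c) , λ a b x y z eq →
    trans (cong (_* c) (linf a b x y z eq)) (l a b (f x) (f y) c)
    where
    l : ∀ a b p q c → (a * p + b * q) * c ≡ a * (p * c) + b * (q * c)
    l = solve-∀

  Kills : ∀ {k} → (Fin k → ℤ) → Functional k → Set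
  Kills x f = proj₁ f x ≡ + 0

  pivot : ∀ {k} (fs : List (Functional (suc k))) →
    All (Kills unit₀) fs ⊎
    (∃₂ λ f rest → (proj₁ f unit₀ ≢ + 0) × (suc (length rest) ≡ length fs) ×
      (∀ {x} → Kills x f → All (Kills x) rest → All (Kills x) fs))
  pivot [] = inj₁ []
  pivot (f ∷ fs) with proj₁ f unit₀ ℤₚ.≟ + 0
  ... | no ≢0 = inj₂ (f , fs , ≢0 , refl , _∷_)
  ... | yes ≡0 with pivot fs
  ...   | inj₁ all = inj₁ (≡0 ∷ all)
  ...   | inj₂ (g , rest , ≢0 , len , back) =
          inj₂ (g , f ∷ rest , ≢0 , cong suc len , λ { p (q ∷ qs) → q ∷ back p qs })

  restrict : ∀ {k} → Functional (suc k) → List (Functional (suc k)) → List (Functional k)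
  restrict f = List.map (λ g → proj₁ g ∘ eliminate (proj₁ f) , eliminate-linear (proj₂ f) (proj₂ g))

  restrict-kills : ∀ {k} (f : Functional (suc k)) gs {y} → All (Kills y) (restrict f gs) →
    All (Kills (eliminate (proj₁ f) y)) gs
  restrict-kills f [] [] = []
  restrict-kills f (g ∷ gs) (p ∷ ps) = p ∷ restrict-kills f gs ps

  -- Gaussian elimination: if no functional sees the first unknown, `unit₀` is a solution; otherwise
  -- a pivot removes one unknown together with one functional. The solution stays nonzero because an
  -- entry is multiplied by the nonzero pivot.
  nontrivial-solution : ∀ {k} (fs : List (Functional k)) → length fs < k →
    ∃ λ x → (∃ λ i → x i ≢ + 0) × All (Kills x) fs
  nontrivial-solution {suc k} fs (s≤s len) with pivot fs
  ... | inj₁ all = unit₀ , (zero , λ ()) , all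
  ... | inj₂ (f , rest , ≢0 , eq , back) with
        nontrivial-solution (restrict f rest)
          (ℕₚ.≤-trans (ℕₚ.≤-reflexive (trans (cong suc (Listₚ.length-map _ rest)) eq)) len)
  ...   | y , (i , yi≢0) , all =
          eliminate (proj₁ f) y ,
          (suc i , λ eq0 → case ℤₚ.i*j≡0⇒i≡0∨j≡0 (proj₁ f unit₀) eq0 of
            λ { (inj₁ e) → ≢0 e ; (inj₂ e) → yi≢0 e }) ,
          back (eliminate-zero (proj₂ f) y) (restrict-kills f rest all)

-- Finite sums of integers.

module IntegerSums where
  open Int using (_+_; _*_)
  open import Algebra.Properties.Semiring.Sum ℤₚ.+-*-semiring as Sum using ()

  square : ∀ a → ∃ λ k → a * a ≡ + k
  square (+ n)    = n Nat.* n , sym (ℤₚ.pos-* n n)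
  square -[1+ n ] = _ , refl

  abstract
    sum : ∀ {n} → (Fin n → ℤ) → ℤ
    sum = Sum.sum

    sum-cong : ∀ {n} {f g : Fin n → ℤ} → (∀ i → f i ≡ g i) → sum f ≡ sum g
    sum-cong = Sum.sum-cong-≗

    sum-permute : ∀ {n} (f : Fin n → ℤ) (π : Perm.Permutation n n) →
      sum f ≡ sum (λ i → f (π Perm.⟨$⟩ʳ i))
    sum-permute = Sum.sum-permute

    sum-zero : ∀ {n} (f : Fin n → ℤ) → (∀ i → f i ≡ + 0) → sum f ≡ + 0
    sum-zero {zero}  f eq = refl
    sum-zero {suc n} f eq rewrite eq zero | sum-zero (f ∘ suc) (eq ∘ suc) = refl

    sum-single : ∀ {n} (f : Fin n → ℤ) j → (∀ i → i ≢ j → f i ≡ + 0) → sum f ≡ f j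
    sum-single {suc n} f zero    eq
      rewrite sum-zero (f ∘ suc) (λ i → eq (suc i) λ ()) = ℤₚ.+-identityʳ _
    sum-single {suc n} f (suc j) eq
      rewrite eq zero (λ ()) | sum-single (f ∘ suc) j (λ i i≢j → eq (suc i) (i≢j ∘ Finₚ.suc-injective))
      = ℤₚ.+-identityˡ _

    sum-linear : ∀ {n} a b (f g : Fin n → ℤ) → sum (λ i → a * f i + b * g i) ≡ a * sum f + b * sum g
    sum-linear a b f g = trans (Sum.∑-distrib-+ (λ i → a * f i) (λ i → b * g i))
      (sym (cong₂ _+_ (Sum.*-distribˡ-sum a f) (Sum.*-distribˡ-sum b g)))

    sum-squares : ∀ {n} (f : Fin n → ℤ) → ∃ λ k → sum (λ i → f i * f i) ≡ + k
    sum-squares {zero}  f = 0 , refl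
    sum-squares {suc n} f with square (f zero) | sum-squares (f ∘ suc)
    ... | k , p | l , q = k Nat.+ l , cong₂ _+_ p q

    -- Each square is the image of a natural number, and a sum of naturals vanishes only termwise.
    -- This definiteness replaces a topological argument in the construction of potentials.
    sum-squares≡0 : ∀ {n} (f : Fin n → ℤ) → sum (λ i → f i * f i) ≡ + 0 → ∀ i → f i ≡ + 0
    sum-squares≡0 {suc n} f eq i with square (f zero) | sum-squares (f ∘ suc)
    ... | k , p | l , q with ℤₚ.+-injective (trans (sym (cong₂ _+_ p q)) eq)
    sum-squares≡0 {suc n} f eq zero    | k , p | l , q | k+l≡0
      with ℤₚ.i*j≡0⇒i≡0∨j≡0 (f zero) (trans p (cong +_ (ℕₚ.m+n≡0⇒m≡0 k k+l≡0)))
    ... | inj₁ e = e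
    ... | inj₂ e = e
    sum-squares≡0 {suc n} f eq (suc i) | k , p | l , q | k+l≡0 =
      sum-squares≡0 (f ∘ suc) (trans q (cong +_ (ℕₚ.m+n≡0⇒n≡0 k k+l≡0))) i

-- Orbits of a permutation of a finite set.

module Iteration where
  open Nat using (_+_; _∸_)

  iter-+ : ∀ {A : Set} (f : A → A) a b x → iter f (a + b) x ≡ iter f a (iter f b x)
  iter-+ f zero    b x = refl
  iter-+ f (suc a) b x = cong f (iter-+ f a b x)

  iter-injective : ∀ {A : Set} (f : A → A) → (∀ x y → f x ≡ f y → x ≡ y) →
    ∀ k x y → iter f k x ≡ iter f k y → x ≡ y
  iter-injective f inj zero    x y eq = eq
  iter-injective f inj (suc k) x y eq = iter-injective f inj k x y (inj _ _ eq)

  module Permuting {d} (f : Fin d → Fin d) (inj : ∀ x y → f x ≡ f y → x ≡ y) where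

    period : ∀ x → ∃ λ p → suc p ≤ d × iter f (suc p) x ≡ x
    period x with Finₚ.pigeonhole (ℕₚ.n<1+n d) (λ i → iter f (toℕ i) x)
    ... | i , j , i<j , eq = p , bound , sym (iter-injective f inj (toℕ i) _ _ eq′)
      where
      p = toℕ j ∸ suc (toℕ i)
      split : toℕ j ≡ toℕ i + suc p
      split = sym (trans (ℕₚ.+-suc (toℕ i) p) (ℕₚ.m+[n∸m]≡n i<j))
      bound : suc p ≤ d
      bound = ℕₚ.≤-trans (ℕₚ.m≤n+m (suc p) (toℕ i))
        (ℕₚ.≤-trans (ℕₚ.≤-reflexive (sym split)) (Finₚ.toℕ≤pred[n] j))
      eq′ : iter f (toℕ i) x ≡ iter f (toℕ i) (iter f (suc p) x)
      eq′ = trans eq (trans (cong (λ k → iter f k x) split) (iter-+ f (toℕ i) (suc p) x))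

    inverse : Fin d → Fin d
    inverse x = iter f (proj₁ (period x)) x

    f∘inverse : ∀ x → f (inverse x) ≡ x
    f∘inverse x = proj₂ (proj₂ (period x))

    perm : Perm.Permutation d d
    perm = Perm.permutation f inverse f∘inverse (λ x → inj _ _ (f∘inverse (f x)))

    allB⇒All : ∀ {A : Set} (p : A → Bool) as → allB p as ≡ true → All (T ∘ p) as
    allB⇒All p []       eq = []
    allB⇒All p (a ∷ as) eq with p a in pa
    ... | true = subst T (sym pa) tt ∷ allB⇒All p as eq

    orbitMin-≤ : ∀ {x k} → isOrbitMin f x ≡ true → k < d → toℕ x ≤ toℕ (iter f k x)
    orbitMin-≤ {x} {k} eq k<d =
      ℕₚ.≤ᵇ⇒≤ _ _ (All.lookup (allB⇒All _ (List.upTo d) eq) (∈ₚ.∈-upTo⁺ k<d))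

    module _ {A : Set} (s : Fin d → A) (step : ∀ y → isOrbitMin f y ≡ false → s y ≡ s (f y)) where

      -- Around the orbit of an orbit minimum m, starting from f m, every dart met before m is not minimal.
      private
        walk-to-min : ∀ {m p} → isOrbitMin f m ≡ true → suc p ≤ d → iter f (suc p) m ≡ m →
          ∀ j → j ≤ p → (s (f m) ≡ s (iter f (suc j) m)) ⊎ (s m ≡ s (f m))
        walk-to-min min p<d per zero j≤p = inj₁ refl
        walk-to-min {m} {p} min p<d per (suc j) j<p
          with walk-to-min min p<d per j (ℕₚ.<⇒≤ j<p)
        ... | inj₂ done = inj₂ done
        ... | inj₁ eq with isOrbitMin f (iter f (suc j) m) in isMin
        ...   | false = inj₁ (trans eq (step _ isMin))
        ...   | true  = inj₂ (sym (trans eq (cong s m′≡m)))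
          where
          m′ = iter f (suc j) m
          back : iter f (p ∸ j) m′ ≡ m
          back = trans (sym (iter-+ f (p ∸ j) (suc j) m))
            (trans (cong (λ k → iter f k m) (trans (ℕₚ.+-suc (p ∸ j) j)
              (cong suc (ℕₚ.m∸n+n≡m (ℕₚ.<⇒≤ j<p))))) per)
          m′≡m : m′ ≡ m
          m′≡m = Finₚ.toℕ-injective (ℕₚ.≤-antisym
            (subst (λ y → toℕ m′ ≤ toℕ y) back
              (orbitMin-≤ {m′} {p ∸ j} isMin (ℕₚ.≤-<-trans (ℕₚ.m∸n≤m p j) p<d)))
            (orbitMin-≤ min (ℕₚ.≤-trans (s≤s j<p) p<d)))

      -- Around a cyclic orbit one of the equations follows from the others, so those at the
      -- non-minimal elements suffice. This saves one equation per orbit, and for faces that saving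
      -- is the term F in Euler's formula.
      constant-on-orbits : ∀ x → s x ≡ s (f x)
      constant-on-orbits x with isOrbitMin f x in isMin
      ... | false = step x isMin
      ... | true with period x
      ...   | p , p<d , per with walk-to-min isMin p<d per p ℕₚ.≤-refl
      ...     | inj₁ eq = sym (trans eq (cong s per))
      ...     | inj₂ eq = eq

  nonMinimal : ∀ {d} → (Fin d → Fin d) → List (Fin d)
  nonMinimal {d} f = List.filter (λ y → isOrbitMin f y Bool.≟ false) (List.allFin d)

  nonMinimal-length : ∀ {d} (f : Fin d → Fin d) → length (nonMinimal f) + numOrbits f ≡ d
  nonMinimal-length {d} f = trans (go (List.allFin d)) (Listₚ.length-tabulate {n = d} id)
    where
    go : ∀ as → length (List.filter (λ y → isOrbitMin f y Bool.≟ false) as) +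
                countTrue (isOrbitMin f) as ≡ length as
    go [] = refl
    go (a ∷ as) with isOrbitMin f a
    ... | false = cong suc (go as)
    ... | true  = trans (ℕₚ.+-suc _ _) (cong suc (go as))

  unique-length : ∀ {d} {xs : List (Fin d)} → Unique xs → length xs ≤ d
  unique-length {d} {xs} u = Finₚ.injective⇒≤ {f = List.lookup xs} (go u _ _)
    where
    go : ∀ {ys : List (Fin d)} → Unique ys → ∀ i j → List.lookup ys i ≡ List.lookup ys j → i ≡ j
    go (_ ∷ _)  zero    zero    eq = refl
    go (px ∷ _) zero    (suc j) eq = ⊥-elim (All.lookup px (∈ₚ.∈-lookup j) eq)
    go (px ∷ _) (suc i) zero    eq = ⊥-elim (All.lookup px (∈ₚ.∈-lookup i) (sym eq))
    go (_ ∷ u)  (suc i) (suc j) eq = cong suc (go u i j eq)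

-- Circulations and their potentials on the faces.

module Potential {n} (G : PlaneGraph n) (o : Fin (PlaneGraph.d G)) where
  open PlaneGraph G
  open Int using (_+_; _*_; -_; _-_)
  open IntegerKernel
  open IntegerSums
  open Iteration

  head : Fin d → Fin n
  head x = tail (rev x)

  φ-injective : ∀ x y → φ x ≡ φ y → x ≡ y
  φ-injective x y eq = trans (sym (rev-invol x)) (trans (cong rev (rot-inj _ _ eq)) (rev-invol y))

  rev-injective : ∀ x y → rev x ≡ rev y → x ≡ y
  rev-injective x y eq = trans (sym (rev-invol x)) (trans (cong rev eq) (rev-invol y))

  tail-φ : ∀ x → tail (φ x) ≡ head x
  tail-φ x = rot-tail (rev x)

  δ : (Fin n → ℤ) → Fin d → ℤ
  δ t x = t (head x) - t (tail x)

  δ-rev : ∀ t x → δ t (rev x) ≡ - δ t x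
  δ-rev t x rewrite rev-invol x = l (t (tail x)) (t (head x))
    where
    l : ∀ a b → a - b ≡ - (b - a)
    l = solve-∀

  -- Vanishing boundary in weak form: taking for `t` the indicator of a vertex gives conservation of
  -- flow there. Orthogonality to all gradients is the form that the energy argument consumes.
  Antisymmetric Circulation : (Fin d → ℤ) → Set
  Antisymmetric z = ∀ x → z (rev x) ≡ - z x
  Circulation z = ∀ t → sum (λ x → z x * δ t x) ≡ + 0

  φ-perm rev-perm : Perm.Permutation d d
  φ-perm = Permuting.perm φ φ-injective
  rev-perm = Perm.permutation rev rev rev-invol rev-invol

  -- The dart after `x` on its face starts at the head of `x`, so differences telescope along each
  -- face; reindexing the sum by `φ` performs the telescoping.
  sum-δ-face : ∀ (s : Fin d → ℤ) t → (∀ x → s x ≡ s (φ x)) → sum (λ x → s x * δ t x) ≡ + 0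
  sum-δ-face s t face = trans (sum-cong pt)
    (trans (sum-linear (+ 1) (- + 1) (λ x → s (φ x) * t (tail (φ x))) (λ x → s x * t (tail x))) (trans (cong (λ a → + 1 * a + - + 1 * base) (sym shift)) (l base)))
    where
    base = sum (λ x → s x * t (tail x))
    shift : base ≡ sum (λ x → s (φ x) * t (tail (φ x)))
    shift = sum-permute (λ x → s x * t (tail x)) φ-perm
    l₁ : ∀ a b c → a * (b - c) ≡ + 1 * (a * b) + - + 1 * (a * c)
    l₁ = solve-∀
    pt : ∀ x → s x * δ t x ≡ + 1 * (s (φ x) * t (tail (φ x))) + - + 1 * (s x * t (tail x))
    pt x rewrite sym (face x) | tail-φ x = l₁ (s x) (t (head x)) (t (tail x))
    l : ∀ a → + 1 * a + - + 1 * a ≡ + 0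
    l = solve-∀

  face-δ-orthogonal : ∀ (s : Fin d → ℤ) t → (∀ x → s x ≡ s (φ x)) →
    sum (λ x → δ t x * (s x - s (rev x))) ≡ + 0
  face-δ-orthogonal s t face = trans (sum-cong pt) (trans (sum-linear (+ 1) (+ 1) (λ x → s x * δ t x) (λ x → s (rev x) * δ t (rev x)))
    (cong₂ (λ a b → + 1 * a + + 1 * b) (sum-δ-face s t face)
      (trans (sym (sum-permute (λ x → s x * δ t x) rev-perm)) (sum-δ-face s t face))))
    where
    l : ∀ a b c → a * (b - c) ≡ + 1 * (b * a) + + 1 * (c * - a)
    l = solve-∀
    pt : ∀ x → δ t x * (s x - s (rev x)) ≡ + 1 * (s x * δ t x) + + 1 * (s (rev x) * δ t (rev x))
    pt x rewrite δ-rev t x = l (δ t x) (s x) (s (rev x))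

  δ≡0⇒constant : ∀ t → (∀ x → δ t x ≡ + 0) → ∀ u v → t u ≡ t v
  δ≡0⇒constant t eq u v = go (connected u v)
    where
    go : ∀ {u v} → Reach tail rev u v → t u ≡ t v
    go here = refl
    go (step x refl r) = trans (sym (ℤₚ.i-j≡0⇒i≡j _ _ (eq x))) (go r)

  module _ (s : Fin d → ℤ) (face : ∀ x → s x ≡ s (φ x)) where

    s-rot : ∀ x → s (rot x) ≡ s (rev x)
    s-rot x = sym (trans (face (rev x)) (cong (s ∘ rot) (rev-invol x)))

    -- The darts `rot x` and `rev x` share a face, so a face function that does not change across
    -- edges does not change around a vertex either; connectedness spreads this over the graph.
    s-constant : (∀ x → s x ≡ s (rev x)) → ∀ x y → s x ≡ s y
    s-constant eq x y = go (connected (tail x) (tail y)) x y refl refl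
      where
      around : ∀ k x → s x ≡ s (iter rot k x)
      around zero    x = refl
      around (suc k) x = trans (around k x) (trans (eq _) (sym (s-rot _)))
      at-vertex : ∀ x y → tail x ≡ tail y → s x ≡ s y
      at-vertex x y p with rot-trans x y p
      ... | k , q = trans (around k x) (cong s q)
      go : ∀ {u v} → Reach tail rev u v → ∀ x y → tail x ≡ u → tail y ≡ v → s x ≡ s y
      go here x y refl q = at-vertex x y (sym q)
      go (step w p r) x y q q′ =
        trans (at-vertex x w (trans q (sym p))) (trans (eq w) (go r (rev w) y refl q′))

  forward : List (Fin d)
  forward = List.filter (λ x → suc (toℕ x) Nat.≤? toℕ (rev x)) (List.allFin d)

  forward-ordered : ∀ {x} → x ∈ forward → toℕ x < toℕ (rev x)
  forward-ordered x∈ = proj₂ (∈ₚ.∈-filter⁻ (λ x → suc (toℕ x) Nat.≤? toℕ (rev x)) {xs = List.allFin d} x∈)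

  -- Forward darts and their reverses are disjoint. Only this direction is required, as it bounds
  -- the number of edge equations from above.
  forward-length : length forward Nat.+ length forward ≤ d
  forward-length = subst (_≤ d)
    (trans (Listₚ.length-++ forward) (cong (length forward Nat.+_) (Listₚ.length-map rev forward)))
    (unique-length (Uniqueₚ.++⁺ u (Uniqueₚ.map⁺ (rev-injective _ _) u) disjoint))
    where
    u : Unique forward
    u = Uniqueₚ.filter⁺ _ (Uniqueₚ.allFin⁺ d)
    disjoint : ∀ {x} → ¬ (x ∈ forward × x ∈ List.map rev forward)
    disjoint (x∈ , rx∈) with ∈ₚ.∈-map⁻ rev rx∈
    ... | y , y∈ , refl =
      ℕₚ.<-asym (forward-ordered y∈) (subst (λ w → toℕ (rev y) < toℕ w) (rev-invol y) (forward-ordered x∈))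

  forward-or-rev : ∀ x → x ∈ forward ⊎ rev x ∈ forward
  forward-or-rev x with ℕₚ.<-cmp (toℕ x) (toℕ (rev x))
  ... | tri< lt _ _ = inj₁ (∈ₚ.∈-filter⁺ _ (∈ₚ.∈-allFin x) lt)
  ... | tri≈ _ eq _ = ⊥-elim (rev-nofix x (sym (Finₚ.toℕ-injective eq)))
  ... | tri> _ _ gt = inj₂ (∈ₚ.∈-filter⁺ _ (∈ₚ.∈-allFin (rev x))
                        (subst (λ w → toℕ (rev x) < toℕ w) (sym (rev-invol x)) gt))

  private
    -- There are 1 + n + d unknowns and 2 + (d - F) + E equations, a surplus of n - E + F - 1, which
    -- is at least 1 by Euler's formula. Both sides are doubled since that formula is stated with d
    -- in place of 2E.
    equation-count : ∀ n d N E F → N Nat.+ F ≡ d → E Nat.+ E ≤ d →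
      2 Nat.* n Nat.+ 2 Nat.* F ≡ d Nat.+ 4 → 2 Nat.+ (N Nat.+ E) < suc (n Nat.+ d)
    equation-count n d N E F orbits edges euler = ℕₚ.*-cancelˡ-< 2 _ _ (begin-strict
      2 Nat.* (2 Nat.+ (N Nat.+ E))                ≡⟨ l₁ N E ⟩
      2 Nat.* N Nat.+ ((E Nat.+ E) Nat.+ 4)        ≤⟨ ℕₚ.+-monoʳ-≤ (2 Nat.* N) (ℕₚ.+-monoˡ-≤ 4 edges) ⟩
      2 Nat.* N Nat.+ (d Nat.+ 4)                  ≡⟨ cong (2 Nat.* N Nat.+_) (sym euler) ⟩
      2 Nat.* N Nat.+ (2 Nat.* n Nat.+ 2 Nat.* F)  ≡⟨ l₂ N n F ⟩
      2 Nat.* (n Nat.+ (N Nat.+ F))                ≡⟨ cong (λ w → 2 Nat.* (n Nat.+ w)) orbits ⟩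
      2 Nat.* (n Nat.+ d)                          <⟨ ℕₚ.*-monoʳ-< 2 (ℕₚ.n<1+n (n Nat.+ d)) ⟩
      2 Nat.* suc (n Nat.+ d)                      ∎)
      where
      open ℕₚ.≤-Reasoning
      l₁ : ∀ a b → 2 Nat.* (2 Nat.+ (a Nat.+ b)) ≡ 2 Nat.* a Nat.+ ((b Nat.+ b) Nat.+ 4)
      l₁ = ℕSolver.solve-∀
      l₂ : ∀ a b c → 2 Nat.* a Nat.+ (2 Nat.* b Nat.+ 2 Nat.* c) ≡ 2 Nat.* (b Nat.+ (a Nat.+ c))
      l₂ = ℕSolver.solve-∀

  module _ (z : Fin d → ℤ) (anti : Antisymmetric z) (circ : Circulation z) where
    private
      k : ℕ
      k = suc (n Nat.+ d)

      scale : (Fin k → ℤ) → ℤ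
      scale x = x zero
      vtx : (Fin k → ℤ) → Fin n → ℤ
      vtx x v = x (suc (v Fin.↑ˡ d))
      face : (Fin k → ℤ) → Fin d → ℤ
      face x y = x (suc (n Fin.↑ʳ y))

      coordinate : Fin k → Functional k
      coordinate i = (λ x → x i) , λ a b x y w eq → eq i

      normal-vtx normal-face : Functional k
      normal-vtx  = coordinate (suc (tail o Fin.↑ˡ d))
      normal-face = coordinate (suc (n Fin.↑ʳ o))

      face-eq edge-eq : Fin d → Functional k
      face-eq y = coordinate (suc (n Fin.↑ʳ y)) ⊝ coordinate (suc (n Fin.↑ʳ φ y))
      edge-eq y =
        ((coordinate (suc (n Fin.↑ʳ y)) ⊝ coordinate (suc (n Fin.↑ʳ rev y))) ⊕
         (coordinate (suc (head y Fin.↑ˡ d)) ⊝ coordinate (suc (tail y Fin.↑ˡ d))))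
        ⊝ (coordinate zero ⊛ z y)

      -- The unknowns are a multiple `scale` of `z`, a vertex function and a face function given on
      -- darts. The vertex function supplies the unknowns that make the count work and turns out to
      -- be zero. The first two equations exclude the constant solutions.
      system : List (Functional k)
      system = normal-vtx ∷ normal-face ∷
        List.map face-eq (nonMinimal φ) ++ List.map edge-eq forward

      -- The only place where Euler's formula is used.
      few-equations : length system < k
      few-equations = subst (_< k)
        (sym (cong (2 Nat.+_) (trans (Listₚ.length-++ (List.map face-eq (nonMinimal φ)))
          (cong₂ Nat._+_ (Listₚ.length-map face-eq (nonMinimal φ)) (Listₚ.length-map edge-eq forward)))))
        (equation-count n d (length (nonMinimal φ)) (length forward) (numOrbits φ)
          (nonMinimal-length φ) forward-length euler)

      module Solved (x : Fin k → ℤ) (kills : All (Kills x) system) where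
        s = face x
        t = vtx x

        inner-kills : All (Kills x) (List.map face-eq (nonMinimal φ) ++ List.map edge-eq forward)
        inner-kills = All.tail (All.tail kills)

        face-kills : All (Kills x ∘ face-eq) (nonMinimal φ)
        face-kills = Allₚ.map⁻ (Allₚ.++⁻ˡ (List.map face-eq (nonMinimal φ)) inner-kills)

        edge-kills : All (Kills x ∘ edge-eq) forward
        edge-kills = Allₚ.map⁻ (Allₚ.++⁻ʳ (List.map face-eq (nonMinimal φ)) inner-kills)

        s-face : ∀ y → s y ≡ s (φ y)
        s-face = Permuting.constant-on-orbits φ φ-injective s λ y min →
          ℤₚ.i-j≡0⇒i≡j (s y) (s (φ y)) (All.lookup face-kills (∈ₚ.∈-filter⁺ _ (∈ₚ.∈-allFin y) min))

        edge-forward : ∀ {y} → y ∈ forward → (s y - s (rev y)) + δ t y ≡ scale x * z y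
        edge-forward {y} y∈ = ℤₚ.i-j≡0⇒i≡j ((s y - s (rev y)) + δ t y) (scale x * z y)
          (All.lookup edge-kills y∈)

        edge-backward : ∀ {y} → rev y ∈ forward → (s y - s (rev y)) + δ t y ≡ scale x * z y
        edge-backward {y} ry∈ = begin
          (s y - s (rev y)) + δ t y
            ≡⟨ l₁ (s y) (s (rev y)) (δ t y) ⟩
          - ((s (rev y) - s y) + - δ t y)
            ≡⟨ cong₂ (λ w v → - ((s (rev y) - s w) + v)) (sym (rev-invol y)) (sym (δ-rev t y)) ⟩
          - ((s (rev y) - s (rev (rev y))) + δ t (rev y))
            ≡⟨ cong -_ (edge-forward ry∈) ⟩
          - (scale x * z (rev y))
            ≡⟨ cong (λ w → - (scale x * w)) (anti y) ⟩
          - (scale x * - z y)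
            ≡⟨ l₂ (scale x) (z y) ⟩
          scale x * z y ∎
          where
          open ≡-Reasoning
          l₁ : ∀ a b c → (a - b) + c ≡ - ((b - a) + - c)
          l₁ = solve-∀
          l₂ : ∀ a b → - (a * - b) ≡ a * b
          l₂ = solve-∀

        edge : ∀ y → (s y - s (rev y)) + δ t y ≡ scale x * z y
        edge y = [ edge-forward , edge-backward ]′ (forward-or-rev y)

        -- Gradients are orthogonal both to face differences and to circulations.
        δ≡0 : ∀ y → δ t y ≡ + 0
        δ≡0 = sum-squares≡0 (δ t) (begin
          sum (λ y → δ t y * δ t y)
            ≡⟨ sum-cong pt ⟩
          sum (λ y → scale x * (z y * δ t y) + - + 1 * (δ t y * (s y - s (rev y))))
            ≡⟨ sum-linear (scale x) (- + 1) (λ y → z y * δ t y) (λ y → δ t y * (s y - s (rev y))) ⟩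
          scale x * sum (λ y → z y * δ t y) + - + 1 * sum (λ y → δ t y * (s y - s (rev y)))
            ≡⟨ cong₂ (λ a b → scale x * a + - + 1 * b) (circ t) (face-δ-orthogonal s t s-face) ⟩
          scale x * + 0 + - + 1 * + 0
            ≡⟨ l₂ (scale x) ⟩
          + 0 ∎)
          where
          open ≡-Reasoning
          l₁ : ∀ a b → a * a ≡ (b + a) * a + - + 1 * (a * b)
          l₁ = solve-∀
          l₂ : ∀ a → a * + 0 + - + 1 * + 0 ≡ + 0
          l₂ = solve-∀
          l₃ : ∀ a b c → a * b * c ≡ a * (b * c)
          l₃ = solve-∀
          pt : ∀ y → δ t y * δ t y ≡
            scale x * (z y * δ t y) + - + 1 * (δ t y * (s y - s (rev y)))
          pt y = begin
            δ t y * δ t y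
              ≡⟨ l₁ (δ t y) (s y - s (rev y)) ⟩
            ((s y - s (rev y)) + δ t y) * δ t y + - + 1 * (δ t y * (s y - s (rev y)))
              ≡⟨ cong (λ w → w * δ t y + - + 1 * (δ t y * (s y - s (rev y)))) (edge y) ⟩
            scale x * z y * δ t y + - + 1 * (δ t y * (s y - s (rev y)))
              ≡⟨ cong (λ w → w + - + 1 * (δ t y * (s y - s (rev y)))) (l₃ (scale x) (z y) (δ t y)) ⟩
            scale x * (z y * δ t y) + - + 1 * (δ t y * (s y - s (rev y))) ∎

        t≡0 : ∀ v → t v ≡ + 0
        t≡0 v = trans (δ≡0⇒constant t δ≡0 v (tail o)) (All.head kills)

        jump : ∀ y → s y - s (rev y) ≡ scale x * z y
        jump y = begin
          s y - s (rev y)            ≡⟨ ℤₚ.+-identityʳ (s y - s (rev y)) ⟨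
          (s y - s (rev y)) + + 0    ≡⟨ cong (λ w → (s y - s (rev y)) + w) (δ≡0 y) ⟨
          (s y - s (rev y)) + δ t y  ≡⟨ edge y ⟩
          scale x * z y              ∎
          where open ≡-Reasoning

        s≡0 : scale x ≡ + 0 → ∀ y → s y ≡ + 0
        s≡0 sc y = trans (s-constant s s-face (λ w → ℤₚ.i-j≡0⇒i≡j (s w) (s (rev w))
          (trans (jump w) (trans (cong (_* z w) sc) (ℤₚ.*-zeroˡ (z w))))) y o) (All.head (All.tail kills))

        -- A solution that ignores `z` is trivial, so the nontrivial one describes a nonzero
        -- multiple of `z`.
        all≡0 : scale x ≡ + 0 → ∀ i → x i ≡ + 0
        all≡0 sc zero = sc
        all≡0 sc (suc i) = subst (λ i → x (suc i) ≡ + 0) (Finₚ.join-splitAt n d i) (on-join (Fin.splitAt n i))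
          where
          on-join : ∀ i → x (suc (Fin.join n d i)) ≡ + 0
          on-join (inj₁ v) = t≡0 v
          on-join (inj₂ y) = s≡0 sc y

    -- A discrete Jordan curve theorem.
    potential : ∃₂ λ (λ′ : ℤ) (s : Fin d → ℤ) → λ′ ≢ + 0 × (∀ x → s x ≡ s (φ x)) ×
      (∀ x → s x - s (rev x) ≡ λ′ * z x)
    potential =
      let x , (i , xi≢0) , kills = nontrivial-solution system few-equations
          open Solved x kills
      in scale x , s , (λ sc → xi≢0 (all≡0 sc i)) , s-face , jump

-- Flows along walks and the closed curves formed by two of them.

module Separation {n} (G : PlaneGraph n) (o : Fin (PlaneGraph.d G)) where
  open PlaneGraph G
  open Int using (_+_; _*_; -_; _-_)
  open IntegerSums
  open Iteration
  open Potential G o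

  Adj-sym : ∀ {u v} → Adj u v → Adj v u
  Adj-sym (x , p , q) = rev x , q , trans (cong tail (rev-invol x)) p

  Adj-irrefl : ∀ {u} → ¬ Adj u u
  Adj-irrefl (x , p , q) = no-loop x (trans q (sym p))

  data Walk (R : Fin n → Set) : Fin n → Fin n → Set where
    stop : ∀ {u} → R u → Walk R u u
    go   : ∀ {u v} → R u → (x : Fin d) → tail x ≡ u → Walk R (head x) v → Walk R u v

  Walkable : (Fin n → Set) → Set
  Walkable R = ∀ {u v} → R u → R v → Walk R u v

  Walk-map : ∀ {R Q : Fin n → Set} → (∀ {u} → R u → Q u) → ∀ {u v} → Walk R u v → Walk Q u v
  Walk-map f (stop r)     = stop (f r)
  Walk-map f (go r x p w) = go (f r) x p (Walk-map f w)

  Walk-source : ∀ {R u v} → Walk R u v → R u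
  Walk-source (stop r)     = r
  Walk-source (go r _ _ _) = r

  Walk-step : ∀ {R u v w} → R u → Adj u v → Walk R v w → Walk R u w
  Walk-step r (x , p , refl) w = go r x p w

  Walk-trans : ∀ {R u v w} → Walk R u v → Walk R v w → Walk R u w
  Walk-trans (stop _)     w′ = w′
  Walk-trans (go r x p w) w′ = go r x p (Walk-trans w w′)

  Walk-sym : ∀ {R u v} → Walk R u v → Walk R v u
  Walk-sym (stop r)        = stop r
  Walk-sym (go r x refl w) =
    Walk-trans (Walk-sym w) (Walk-step (Walk-source w) (Adj-sym (x , refl , refl)) (stop r))

  indicator : Fin d → Fin d → ℤ
  indicator l x = if does (x Finₚ.≟ l) then + 1 else + 0

  indicator-same : ∀ l → indicator l l ≡ + 1
  indicator-same l with l Finₚ.≟ l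
  ... | yes _  = refl
  ... | no l≢l = ⊥-elim (l≢l refl)

  indicator-other : ∀ {l x} → x ≢ l → indicator l x ≡ + 0
  indicator-other {l} {x} x≢l with x Finₚ.≟ l
  ... | yes x≡l = ⊥-elim (x≢l x≡l)
  ... | no _    = refl

  indicator-rev : ∀ l x → indicator l (rev x) ≡ indicator (rev l) x
  indicator-rev l x with rev x Finₚ.≟ l | x Finₚ.≟ rev l
  ... | yes _ | yes _ = refl
  ... | no _  | no _  = refl
  ... | yes p | no q  = ⊥-elim (q (trans (sym (rev-invol x)) (cong rev p)))
  ... | no p  | yes q = ⊥-elim (p (trans (cong rev q) (rev-invol l)))

  dartFlow : Fin d → Fin d → ℤ
  dartFlow l x = indicator l x - indicator (rev l) x

  walkFlow : ∀ {R u v} → Walk R u v → Fin d → ℤ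
  walkFlow (stop _)     x = + 0
  walkFlow (go _ l _ w) x = dartFlow l x + walkFlow w x

  dartFlow-antisym : ∀ l → Antisymmetric (dartFlow l)
  dartFlow-antisym l x rewrite indicator-rev l x | indicator-rev (rev l) x | rev-invol l =
    e (indicator (rev l) x) (indicator l x)
    where
    e : ∀ a b → a - b ≡ - (b - a)
    e = solve-∀

  walkFlow-antisym : ∀ {R u v} (w : Walk R u v) → Antisymmetric (walkFlow w)
  walkFlow-antisym (stop _)     x = refl
  walkFlow-antisym (go _ l _ w) x =
    trans (cong₂ _+_ (dartFlow-antisym l x) (walkFlow-antisym w x))
      (sym (ℤₚ.neg-distrib-+ (dartFlow l x) (walkFlow w x)))

  sum-indicator : ∀ l (f : Fin d → ℤ) → sum (λ x → indicator l x * f x) ≡ f l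
  sum-indicator l f = trans
    (sum-single _ l (λ x x≢l → trans (cong (_* f x) (indicator-other x≢l)) (ℤₚ.*-zeroˡ (f x))))
    (trans (cong (_* f l) (indicator-same l)) (ℤₚ.*-identityˡ (f l)))

  -- The sum runs over both darts of each edge, and the signs of flow and gradient change together,
  -- hence the factor 2.
  dartFlow-boundary : ∀ l t → sum (λ x → dartFlow l x * δ t x) ≡ + 2 * (t (head l) - t (tail l))
  dartFlow-boundary l t = begin
    sum (λ x → dartFlow l x * δ t x)
      ≡⟨ sum-cong (λ x → e₁ (indicator l x) (indicator (rev l) x) (δ t x)) ⟩
    sum (λ x → + 1 * (indicator l x * δ t x) + - + 1 * (indicator (rev l) x * δ t x))
      ≡⟨ sum-linear (+ 1) (- + 1) (λ x → indicator l x * δ t x) (λ x → indicator (rev l) x * δ t x) ⟩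
    + 1 * sum (λ x → indicator l x * δ t x) + - + 1 * sum (λ x → indicator (rev l) x * δ t x)
      ≡⟨ cong₂ (λ a b → + 1 * a + - + 1 * b) (sum-indicator l (δ t)) (sum-indicator (rev l) (δ t)) ⟩
    + 1 * δ t l + - + 1 * δ t (rev l)
      ≡⟨ cong (λ a → + 1 * δ t l + - + 1 * a) (δ-rev t l) ⟩
    + 1 * δ t l + - + 1 * - δ t l
      ≡⟨ e₂ (δ t l) ⟩
    + 2 * δ t l ∎
    where
    open ≡-Reasoning
    e₁ : ∀ a b c → (a - b) * c ≡ + 1 * (a * c) + - + 1 * (b * c)
    e₁ = solve-∀
    e₂ : ∀ a → + 1 * a + - + 1 * - a ≡ + 2 * a
    e₂ = solve-∀

  mutual
    walkFlow-boundary : ∀ {R u v} (w : Walk R u v) t →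
      sum (λ x → walkFlow w x * δ t x) ≡ + 2 * (t v - t u)
    walkFlow-boundary {u = u} (stop _) t =
      trans (sum-zero _ (λ x → ℤₚ.*-zeroˡ (δ t x))) (e (t u))
      where
      e : ∀ a → + 0 ≡ + 2 * (a - a)
      e = solve-∀
    walkFlow-boundary (go _ l refl w) t = prepend-boundary l w t

    prepend-boundary : ∀ {R v} l (w : Walk R (head l) v) t →
      sum (λ x → (dartFlow l x + walkFlow w x) * δ t x) ≡ + 2 * (t v - t (tail l))
    prepend-boundary {v = v} l w t = begin
      sum (λ x → (dartFlow l x + walkFlow w x) * δ t x)
        ≡⟨ sum-cong (λ x → e₁ (dartFlow l x) (walkFlow w x) (δ t x)) ⟩
      sum (λ x → + 1 * (dartFlow l x * δ t x) + + 1 * (walkFlow w x * δ t x))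
        ≡⟨ sum-linear (+ 1) (+ 1) (λ x → dartFlow l x * δ t x) (λ x → walkFlow w x * δ t x) ⟩
      + 1 * sum (λ x → dartFlow l x * δ t x) + + 1 * sum (λ x → walkFlow w x * δ t x)
        ≡⟨ cong₂ (λ a b → + 1 * a + + 1 * b) (dartFlow-boundary l t) (walkFlow-boundary w t) ⟩
      + 1 * (+ 2 * (t (head l) - t (tail l))) + + 1 * (+ 2 * (t v - t (head l)))
        ≡⟨ e₂ (t (head l)) (t (tail l)) (t v) ⟩
      + 2 * (t v - t (tail l)) ∎
      where
      open ≡-Reasoning
      e₁ : ∀ a b c → (a + b) * c ≡ + 1 * (a * c) + + 1 * (b * c)
      e₁ = solve-∀
      e₂ : ∀ h t v → + 1 * (+ 2 * (h - t)) + + 1 * (+ 2 * (v - h)) ≡ + 2 * (v - t)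
      e₂ = solve-∀

  dartFlow-outside : ∀ l x → x ≢ l → tail x ≢ head l → dartFlow l x ≡ + 0
  dartFlow-outside l x x≢l t≢h
    rewrite indicator-other x≢l | indicator-other {rev l} {x} (t≢h ∘ cong tail) = refl

  walkFlow-outside : ∀ {R u v} (w : Walk R u v) x → ¬ R (tail x) → walkFlow w x ≡ + 0
  walkFlow-outside (stop _)            x ∉R = refl
  walkFlow-outside {R} (go r l refl w) x ∉R =
    trans (cong₂ _+_ (dartFlow-outside l x (λ { refl → ∉R r }) (λ eq → ∉R (subst R (sym eq) (Walk-source w))))
      (walkFlow-outside w x ∉R)) refl

  -- A walk from the hub `v` that never returns to it. Its flow on the darts leaving `v` is
  -- therefore just the indicator of `first`, whatever repetitions the walk has further out.
  record Spoke (v r : Fin n) : Set₁ where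
    field
      Q     : Fin n → Set
      first : Fin d
      tail≡ : tail first ≡ v
      walk  : Walk Q (head first) r
      v∉Q   : ¬ Q v

    flow : Fin d → ℤ
    flow x = dartFlow first x + walkFlow walk x

    flow-antisym : Antisymmetric flow
    flow-antisym x = trans (cong₂ _+_ (dartFlow-antisym first x) (walkFlow-antisym walk x))
      (sym (ℤₚ.neg-distrib-+ (dartFlow first x) (walkFlow walk x)))

    flow-boundary : ∀ t → sum (λ x → flow x * δ t x) ≡ + 2 * (t r - t v)
    flow-boundary t = trans (prepend-boundary first walk t) (cong (λ u → + 2 * (t r - t u)) tail≡)

    flow-at-hub : ∀ x → tail x ≡ v → flow x ≡ indicator first x
    flow-at-hub x p = trans
      (cong₂ (λ a b → indicator first x - a + b)
        (indicator-other {rev first} {x} λ { refl → v∉Q (subst Q p (Walk-source walk)) })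
        (walkFlow-outside walk x (λ q → v∉Q (subst Q p q))))
      (e (indicator first x))
      where
      e : ∀ a → a - + 0 + + 0 ≡ a
      e = solve-∀

    flow-outside : ∀ x → tail x ≢ v → ¬ Q (tail x) → flow x ≡ + 0
    flow-outside x ≢v ∉Q = cong₂ _+_
      (dartFlow-outside first x (λ { refl → ≢v tail≡ }) (λ eq → ∉Q (subst Q (sym eq) (Walk-source walk))))
      (walkFlow-outside walk x ∉Q)

  open Spoke using (first; flow)

  FaceFunction : (Fin d → ℤ) → Set
  FaceFunction s = ∀ x → s x ≡ s (φ x)

  record Jordan {v r} (A B : Spoke v r) : Set where
    field
      scale   : ℤ
      value   : Fin d → ℤ
      scale≢0 : scale ≢ + 0
      face    : FaceFunction value
      jump    : ∀ x → value x - value (rev x) ≡ scale * (flow A x - flow B x)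

  abstract
    -- Two spokes with the same ends have the same boundary, so the difference of their flows is a
    -- circulation.
    jordan : ∀ {v r} (A B : Spoke v r) → Jordan A B
    jordan {v} {r} A B =
      let λ′ , s , ≢0 , f , j = potential (λ x → flow A x - flow B x) anti circ
      in record { scale = λ′ ; value = s ; scale≢0 = ≢0 ; face = f ; jump = j }
      where
      open ≡-Reasoning
      anti : Antisymmetric (λ x → flow A x - flow B x)
      anti x = trans (cong₂ _-_ (Spoke.flow-antisym A x) (Spoke.flow-antisym B x))
        (e (flow A x) (flow B x))
        where
        e : ∀ a b → - a - - b ≡ - (a - b)
        e = solve-∀
      circ : Circulation (λ x → flow A x - flow B x)
      circ t = begin
        sum (λ x → (flow A x - flow B x) * δ t x)
          ≡⟨ sum-cong (λ x → e₁ (flow A x) (flow B x) (δ t x)) ⟩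
        sum (λ x → + 1 * (flow A x * δ t x) + - + 1 * (flow B x * δ t x))
          ≡⟨ sum-linear (+ 1) (- + 1) (λ x → flow A x * δ t x) (λ x → flow B x * δ t x) ⟩
        + 1 * sum (λ x → flow A x * δ t x) + - + 1 * sum (λ x → flow B x * δ t x)
          ≡⟨ cong₂ (λ a b → + 1 * a + - + 1 * b) (Spoke.flow-boundary A t) (Spoke.flow-boundary B t) ⟩
        + 1 * (+ 2 * (t r - t v)) + - + 1 * (+ 2 * (t r - t v))
          ≡⟨ e₂ (+ 2 * (t r - t v)) ⟩
        + 0 ∎
        where
        e₁ : ∀ a b c → (a - b) * c ≡ + 1 * (a * c) + - + 1 * (b * c)
        e₁ = solve-∀
        e₂ : ∀ a → + 1 * a + - + 1 * a ≡ + 0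
        e₂ = solve-∀

-- Separating chords and the exclusion of K₃,₃.

module Planarity {n} (G : PlaneGraph n) (o : Fin (PlaneGraph.d G)) where
  open PlaneGraph G
  open Int using (_+_; _*_; -_; _-_)
  open Iteration
  open Potential G o
  open Separation G o
  open Separation.Spoke using (first; flow)

  Hits : Fin d → Fin d → ℕ → Set
  Hits q x k = iter rot k q ≡ x × (∀ j → j < k → iter rot j q ≢ x)

  firstHit : ∀ q x → tail q ≡ tail x → ∃ (Hits q x)
  firstHit q x p with rot-trans q x p
  ... | k , hit = [ (λ h → h) , (λ none → k , hit , none) ]′ (search k)
    where
    search : ∀ k → ∃ (Hits q x) ⊎ (∀ j → j < k → iter rot j q ≢ x)
    search zero = inj₂ λ _ ()
    search (suc k) with search k | iter rot k q Finₚ.≟ x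
    ... | inj₁ found | _       = inj₁ found
    ... | inj₂ none  | yes hit = inj₁ (k , hit , none)
    ... | inj₂ none  | no miss = inj₂ λ j j<1+k →
      [ none j , (λ { refl → miss }) ]′ (ℕₚ.m≤n⇒m<n∨m≡n (ℕₚ.≤-pred j<1+k))

  -- A repetition before step `k` could be cut out, and `x` would be hit earlier.
  hits-distinct : ∀ {q x k} → Hits q x k → ∀ {i j} → i < j → j ≤ k → iter rot i q ≢ iter rot j q
  hits-distinct {q} {x} {k} (hit , none) {i} {j} i<j j≤k eq =
    none (k Nat.∸ j Nat.+ i)
      (ℕₚ.<-≤-trans (ℕₚ.+-monoʳ-< (k Nat.∸ j) i<j) (ℕₚ.≤-reflexive (ℕₚ.m∸n+n≡m j≤k)))
      (trans (iter-+ rot (k Nat.∸ j) i q) (trans (cong (iter rot (k Nat.∸ j)) eq)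
        (trans (sym (iter-+ rot (k Nat.∸ j) j q))
          (trans (cong (λ m → iter rot m q) (ℕₚ.m∸n+n≡m j≤k)) hit))))

  iter-rot-tail : ∀ k q → tail (iter rot k q) ≡ tail q
  iter-rot-tail zero    q = refl
  iter-rot-tail (suc k) q = trans (rot-tail _) (iter-rot-tail k q)

  -- The vertex is not on the curve: nothing jumps across its edges, so the corners around it share
  -- one value.
  Off : (Fin d → ℤ) → Fin n → Set
  Off s w = ∀ x → tail x ≡ w → s x ≡ s (rev x)

  off-constant : ∀ {s w} → FaceFunction s → Off s w → ∀ {x y} → tail x ≡ w → tail y ≡ w → s x ≡ s y
  off-constant {s} face off {x} {y} p q with rot-trans x y (trans p (sym q))
  ... | k , eq = trans (around k) (cong s eq)
    where
    around : ∀ k → s x ≡ s (iter rot k x)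
    around zero    = refl
    around (suc k) = trans (around k)
      (trans (off _ (trans (iter-rot-tail k x) p)) (sym (s-rot s face _)))

  off-into : ∀ {s} x → Off s (head x) → s x ≡ s (rev x)
  off-into {s} x off = sym (trans (off (rev x) refl) (cong s (rev-invol x)))

  off-adjacent : ∀ {s w w′} → FaceFunction s → Off s w → Off s w′ → Adj w w′ →
    ∀ {x y} → tail x ≡ w → tail y ≡ w′ → s x ≡ s y
  off-adjacent face off off′ (l , refl , refl) p q =
    trans (off-constant face off p refl) (trans (off l refl) (off-constant face off′ refl q))

  -- The side of the curve on which a vertex lies, read off at an arbitrary dart; the value is
  -- meaningful when the vertex is `Off`. The 0 is a dummy for a vertex without darts.
  side : (Fin d → ℤ) → Fin n → ℤ
  side s w with Finₚ.any? (λ x → tail x Finₚ.≟ w)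
  ... | yes (x , _) = s x
  ... | no _        = + 0

  side-off : ∀ {s w} → FaceFunction s → Off s w → ∀ {x} → tail x ≡ w → side s w ≡ s x
  side-off {s} {w} face off {x} p with Finₚ.any? (λ x → tail x Finₚ.≟ w)
  ... | yes (y , q) = off-constant face off q p
  ... | no none     = ⊥-elim (none (x , p))

  module _ {v r} {A B : Spoke v r} (curve : Jordan A B) where
    open Jordan curve

    outside-off : ∀ {w} → w ≢ v → ¬ Spoke.Q A w → ¬ Spoke.Q B w → Off value w
    outside-off {w} w≢v ∉A ∉B x refl = ℤₚ.i-j≡0⇒i≡j (value x) (value (rev x)) (trans (jump x)
      (trans (cong₂ (λ a b → scale * (a - b)) (Spoke.flow-outside A x w≢v ∉A) (Spoke.flow-outside B x w≢v ∉B))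
        (ℤₚ.*-zeroʳ scale)))

    rot-jump : ∀ x → value (rot x) ≡ value x - scale * (flow A x - flow B x)
    rot-jump x = trans (s-rot value face x)
      (trans (e (value x) (value (rev x))) (cong (λ w → value x - w) (jump x)))
      where
      e : ∀ a b → b ≡ a - (a - b)
      e = solve-∀

    rot-jump-hub : ∀ {x} → tail x ≡ v →
      value (rot x) ≡ value x - scale * (indicator (first A) x - indicator (first B) x)
    rot-jump-hub {x} p = trans (rot-jump x)
      (cong₂ (λ a b → value x - scale * (a - b)) (Spoke.flow-at-hub A x p) (Spoke.flow-at-hub B x p))

    -- Turning around the hub past the first dart of `A` crosses the closed curve; past that of `B`
    -- it crosses back, whence the opposite sign there.
    rot-first : first A ≢ first B → value (rot (first A)) ≡ value (first A) - scale
    rot-first A≢B = trans (rot-jump-hub (Spoke.tail≡ A))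
      (trans (cong₂ (λ a b → value (first A) - scale * (a - b))
        (indicator-same (first A)) (indicator-other A≢B)) (e (value (first A)) scale))
      where
      e : ∀ a b → a - b * (+ 1 - + 0) ≡ a - b
      e = solve-∀

    rot-second : first A ≢ first B → value (rot (first B)) ≡ value (first B) + scale
    rot-second A≢B = trans (rot-jump-hub (Spoke.tail≡ B))
      (trans (cong₂ (λ a b → value (first B) - scale * (a - b))
        (indicator-other (A≢B ∘ sym)) (indicator-same (first B))) (e (value (first B)) scale))
      where
      e : ∀ a b → a - b * (+ 0 - + 1) ≡ a + b
      e = solve-∀

    run : ∀ {q i k} → tail q ≡ v → i ≤ k →
      (∀ j → i ≤ j → j < k → iter rot j q ≢ first A × iter rot j q ≢ first B) →
      value (iter rot k q) ≡ value (iter rot i q)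
    run {q} {i} {k} p i≤k avoid = go-up (ℕₚ.≤⇒≤′ i≤k) avoid
      where
      go-up : ∀ {k} → i Nat.≤′ k →
        (∀ j → i ≤ j → j < k → iter rot j q ≢ first A × iter rot j q ≢ first B) →
        value (iter rot k q) ≡ value (iter rot i q)
      go-up (Nat.≤′-reflexive refl) avoid = refl
      go-up (Nat.≤′-step {n = k} i≤k) avoid = trans
        (trans (rot-jump-hub (trans (iter-rot-tail k q) p))
          (trans (cong₂ (λ a b → value (iter rot k q) - scale * (a - b))
            (indicator-other (proj₁ (avoid k (ℕₚ.≤′⇒≤ i≤k) ℕₚ.≤-refl)))
            (indicator-other (proj₂ (avoid k (ℕₚ.≤′⇒≤ i≤k) ℕₚ.≤-refl))))
            (e (value (iter rot k q)) scale)))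
        (go-up i≤k λ j i≤j j<k → avoid j i≤j (ℕₚ.m<n⇒m<1+n j<k))
        where
        e : ∀ a b → a - b * (+ 0 - + 0) ≡ a
        e = solve-∀

  module _ {v} {R : Fin n → Set} (walkable : Walkable R) (v∉R : ¬ R v) where

    direct : ∀ q → tail q ≡ v → R (head q) → Spoke v (head q)
    direct q p r = record { Q = R ; first = q ; tail≡ = p ; walk = stop r ; v∉Q = v∉R }

    through : ∀ {r} → R r → ∀ x → tail x ≡ v → ∀ {r′} → R r′ → Adj (head x) r′ → Spoke v r
    through r∈R x p r′∈R a = record
      { Q = λ w → R w ⊎ w ≡ head x ; first = x ; tail≡ = p
      ; walk = Walk-step (inj₂ refl) a (Walk-map inj₁ (walkable r′∈R r∈R))
      ; v∉Q = [ v∉R , (λ eq → no-loop x (trans (sym eq) (sym p))) ]′ }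

  AdjTo : (Fin n → Set) → Fin n → Set
  AdjTo R w = ∃ λ r → R r × Adj w r

  head-injective : ∀ {x y} → tail x ≡ tail y → x ≢ y → head x ≢ head y
  head-injective p x≢y q = x≢y (no-multi _ _ p q)

  -- The curve through v, the middle neighbour and R leaves the other two neighbours on different sides.
  chord-separation : ∀ {v R} → Walkable R → ¬ R v →
    ∀ q → tail q ≡ v → R (head q) →
    ∀ {xa xb xc ka kb kc} → tail xa ≡ v → tail xb ≡ v → tail xc ≡ v →
    ¬ R (head xa) → ¬ R (head xc) → AdjTo R (head xb) →
    Hits q xa ka → Hits q xb kb → Hits q xc kc → ka < kb → kb < kc →
    ∃ λ (f : Fin n → ℤ) → f (head xa) ≢ f (head xc) ×
      (∀ {w w′} → Adj w w′ → ¬ R w → ¬ R w′ → w ≢ v → w′ ≢ v → w ≢ head xb → w′ ≢ head xb → f w ≡ f w′)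
  chord-separation {v} {R} walkable v∉R q pq rq {xa} {xb} {xc} {ka} {kb} {kc} pa pb pc
    a∉R c∉R (r , r∈R , br) ha hb hc a<b b<c = side value , apart , joined
    where
    curve : Jordan (through walkable v∉R rq xb pb r∈R br) (direct walkable v∉R q pq rq)
    curve = jordan _ _
    open Jordan curve

    off : ∀ {w} → ¬ R w → w ≢ v → w ≢ head xb → Off value w
    off w∉R w≢v w≢b = outside-off curve w≢v [ w∉R , w≢b ]′ w∉R

    joined : ∀ {w w′} → Adj w w′ → ¬ R w → ¬ R w′ → w ≢ v → w′ ≢ v → w ≢ head xb → w′ ≢ head xb →
      side value w ≡ side value w′
    joined (l , refl , refl) w∉R w′∉R w≢v w′≢v w≢b w′≢b =
      trans (side-off face (off w∉R w≢v w≢b) refl)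
        (trans (off w∉R w≢v w≢b l refl) (sym (side-off face (off w′∉R w′≢v w′≢b) refl)))

    0<ka : 0 < ka
    0<ka = ℕₚ.n≢0⇒n>0 λ { refl → a∉R (subst (R ∘ head) (proj₁ ha) rq) }

    at : ∀ {i j} → i ≢ j → i ≤ kc → j ≤ kc → iter rot i q ≢ iter rot j q
    at {i} {j} i≢j i≤ j≤ eq with ℕₚ.<-cmp i j
    ... | tri< lt _ _ = hits-distinct hc lt j≤ eq
    ... | tri≈ _ e _  = i≢j e
    ... | tri> _ _ gt = hits-distinct hc gt i≤ (sym eq)

    avoid : ∀ j → j ≢ 0 → j ≢ kb → j < kc → iter rot j q ≢ xb × iter rot j q ≢ q
    avoid j j≢0 j≢b j<c =
      (λ eq → at j≢b (ℕₚ.<⇒≤ j<c) (ℕₚ.<⇒≤ b<c) (trans eq (sym (proj₁ hb)))) ,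
      at {j} {0} j≢0 (ℕₚ.<⇒≤ j<c) z≤n

    b≢q : xb ≢ q
    b≢q eq = at {kb} {0} (λ { refl → ℕₚ.n≮0 a<b }) (ℕₚ.<⇒≤ b<c) z≤n (trans (proj₁ hb) eq)

    start : value (rot q) ≡ value q + scale
    start = rot-second curve b≢q

    value-a : value xa ≡ value q + scale
    value-a = trans (cong value (sym (proj₁ ha))) (trans (run curve pq 0<ka
      (λ j 1≤j j<a → avoid j (ℕₚ.>⇒≢ 1≤j) (ℕₚ.<⇒≢ (ℕₚ.<-trans j<a a<b))
        (ℕₚ.<-trans j<a (ℕₚ.<-trans a<b b<c)))) start)

    value-b : value xb ≡ value q + scale
    value-b = trans (cong value (sym (proj₁ hb))) (trans (run curve pq (ℕₚ.≤-trans 0<ka (ℕₚ.<⇒≤ a<b))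
      (λ j 1≤j j<b → avoid j (ℕₚ.>⇒≢ 1≤j) (ℕₚ.<⇒≢ j<b) (ℕₚ.<-trans j<b b<c))) start)

    value-c : value xc ≡ value xb - scale
    value-c = trans (cong value (sym (proj₁ hc))) (trans (run curve pq b<c
      (λ j b<j j<c → avoid j (ℕₚ.>⇒≢ (ℕₚ.≤-trans (s≤s z≤n) b<j)) (ℕₚ.>⇒≢ b<j) j<c))
      (trans (cong (value ∘ rot) (proj₁ hb)) (rot-first curve b≢q)))

    other : ∀ {x k} → Hits q x k → k ≢ kb → k ≤ kc → tail x ≡ v → head x ≢ head xb
    other hx k≢b k≤c px = head-injective (trans px (sym pb))
      λ eq → at k≢b k≤c (ℕₚ.<⇒≤ b<c) (trans (proj₁ hx) (trans eq (sym (proj₁ hb))))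

    side-at : ∀ {x k} → Hits q x k → k ≢ kb → k ≤ kc → tail x ≡ v → ¬ R (head x) →
      side value (head x) ≡ value x
    side-at {x} hx k≢b k≤c px ∉R = trans (side-off face o′ refl) (sym (off-into x o′))
      where
      o′ = off ∉R (λ eq → no-loop x (trans eq (sym px))) (other hx k≢b k≤c px)

    -- The corner of `xa` carries `value q + scale` and that of `xc` carries `value q`: the rotation
    -- from one to the other passes `xb` but not `q`.
    apart : side value (head xa) ≢ side value (head xc)
    apart eq = scale≢0 (trans (e (value q) scale)
      (trans (cong₂ _-_ (trans (sym value-a) (trans (sym sa) (trans eq (trans sc value-c)))) refl)
        (trans (cong (λ w → w - scale - value q) value-b) (e′ (value q) scale))))
      where
      sa = side-at ha (ℕₚ.<⇒≢ a<b) (ℕₚ.<⇒≤ (ℕₚ.<-trans a<b b<c)) pa a∉R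
      sc = side-at hc (ℕₚ.>⇒≢ b<c) ℕₚ.≤-refl pc c∉R
      e : ∀ a b → b ≡ (a + b) - a
      e = solve-∀
      e′ : ∀ a b → (a + b) - b - a ≡ + 0
      e′ = solve-∀

  module _ {v R} (walkable : Walkable R) (v∉R : ¬ R v) (v~R : AdjTo R v) (P : Fin n → Set) where

    -- Which of three given neighbours of `v` is the middle one depends on the rotation. The record
    -- therefore forgets their names and remembers only that each satisfies `P`.
    record ChordSplit : Set where
      field
        {left mid right} : Fin n
        P-left  : P left
        P-mid   : P mid
        P-right : P right
        mid≢left  : mid ≢ left
        mid≢right : mid ≢ right
        colour  : Fin n → ℤ
        apart   : colour left ≢ colour right
        joined  : ∀ {w w′} → Adj w w′ → ¬ R w → ¬ R w′ → w ≢ v → w′ ≢ v → w ≢ mid → w′ ≢ mid →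
                  colour w ≡ colour w′

    private
      q = proj₁ (proj₂ (proj₂ v~R))
      q-tail = proj₁ (proj₂ (proj₂ (proj₂ v~R)))
      q-head = proj₂ (proj₂ (proj₂ (proj₂ v~R)))

      record Spot (a : Fin n) : Set where
        field
          dart : Fin d
          pos  : ℕ
          tail≡ : tail dart ≡ v
          head≡ : head dart ≡ a
          hits : Hits q dart pos
          a∉R  : ¬ R a
          a~R  : AdjTo R a
          Pa   : P a
      open Spot

      spot : ∀ {a} → Adj v a → ¬ R a → AdjTo R a → P a → Spot a
      spot (x , p , h) ∉R a~R Pa = record
        { dart = x ; pos = proj₁ hit ; tail≡ = p ; head≡ = h ; hits = proj₂ hit
        ; a∉R = ∉R ; a~R = a~R ; Pa = Pa }
        where hit = firstHit q x (trans q-tail (sym p))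

      pos-injective : ∀ {a b} (α : Spot a) (β : Spot b) → pos α ≡ pos β → a ≡ b
      pos-injective α β eq = trans (sym (head≡ α)) (trans (cong head
        (trans (sym (proj₁ (hits α))) (trans (cong (λ k → iter rot k q) eq) (proj₁ (hits β))))) (head≡ β))

      split : ∀ {a b c} (α : Spot a) (β : Spot b) (γ : Spot c) → pos α < pos β → pos β < pos γ → ChordSplit
      split record { dart = xa ; tail≡ = pa ; head≡ = refl ; hits = ha ; a∉R = a∉ ; Pa = Pa }
            record { dart = xb ; tail≡ = pb ; head≡ = refl ; hits = hb ; a~R = b~ ; Pa = Pb }
            record { dart = xc ; tail≡ = pc ; head≡ = refl ; hits = hc ; a∉R = c∉ ; Pa = Pc } a<b b<c =
        let f , apart , joined = chord-separation walkable v∉R q q-tail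
              (subst R (sym q-head) (proj₁ (proj₂ v~R))) pa pb pc a∉ c∉ b~ ha hb hc a<b b<c
        in record
          { P-left = Pa ; P-mid = Pb ; P-right = Pc
          ; mid≢left = λ eq → ℕₚ.<⇒≢ a<b (same ha hb pa pb (sym eq))
          ; mid≢right = λ eq → ℕₚ.<⇒≢ b<c (same hb hc pb pc eq)
          ; colour = f ; apart = apart ; joined = joined }
        where
        same : ∀ {x y k l} → Hits q x k → Hits q y l → tail x ≡ v → tail y ≡ v → head x ≡ head y → k ≡ l
        same {x} {y} {k} {l} hx hy px py eq with no-multi x y (trans px (sym py)) eq
        ... | refl with ℕₚ.<-cmp k l
        ...   | tri< lt _ _ = ⊥-elim (proj₂ hy k lt (proj₁ hx))
        ...   | tri≈ _ e _  = e
        ...   | tri> _ _ gt = ⊥-elim (proj₂ hx l gt (proj₁ hy))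

    chord-split : ∀ {a b c} → Adj v a → Adj v b → Adj v c → ¬ R a → ¬ R b → ¬ R c →
      AdjTo R a → AdjTo R b → AdjTo R c → P a → P b → P c → a ≢ b → b ≢ c → a ≢ c → ChordSplit
    chord-split va vb vc a∉ b∉ c∉ a~ b~ c~ Pa Pb Pc a≢b b≢c a≢c =
      sort (spot va a∉ a~ Pa) (spot vb b∉ b~ Pb) (spot vc c∉ c~ Pc)
      where
      sort : Spot _ → Spot _ → Spot _ → ChordSplit
      sort α β γ with ℕₚ.<-cmp (pos α) (pos β) | ℕₚ.<-cmp (pos β) (pos γ) | ℕₚ.<-cmp (pos α) (pos γ)
      ... | tri≈ _ e _ | _ | _ = ⊥-elim (a≢b (pos-injective α β e))
      ... | _ | tri≈ _ e _ | _ = ⊥-elim (b≢c (pos-injective β γ e))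
      ... | _ | _ | tri≈ _ e _ = ⊥-elim (a≢c (pos-injective α γ e))
      ... | tri< a<b _ _ | tri< b<c _ _ | _            = split α β γ a<b b<c
      ... | tri< a<b _ _ | tri> _ _ c<b | tri< a<c _ _ = split α γ β a<c c<b
      ... | tri< a<b _ _ | tri> _ _ c<b | tri> _ _ c<a = split γ α β c<a a<b
      ... | tri> _ _ b<a | tri< b<c _ _ | tri< a<c _ _ = split β α γ b<a a<c
      ... | tri> _ _ b<a | tri< b<c _ _ | tri> _ _ c<a = split β γ α b<c c<a
      ... | tri> _ _ b<a | tri> _ _ c<b | _            = split γ β α c<b b<a

  -- Connectedness tested by integer functions instead of walks. It is applied to `side`, and it is
  -- also what a set that cannot be split yields directly.
  Linked : (Fin n → Set) → Set
  Linked S = ∀ (f : Fin n → ℤ) → (∀ {w w′} → S w → S w′ → Adj w w′ → f w ≡ f w′) →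
    ∀ {w w′} → S w → S w′ → f w ≡ f w′

  module _ {v} {R S : Fin n → Set} (walkable : Walkable R) (linked : Linked S) (v∉R : ¬ R v)
    (S-free : ∀ {w} → S w → w ≢ v × ¬ R w) where

    -- Three curves run from v to R, through a, b and c; writing s_xy for the potential of the curve
    -- formed by two of them, s_ab + s_bc + s_ca = 0. Evaluating this sum at a point of S and at the
    -- corner of v at b gives values that differ by the jump.
    private
      ordered-no-K₃₃ : ∀ {xa xb xc kb kc} → tail xa ≡ v → tail xb ≡ v → tail xc ≡ v →
        ¬ R (head xa) → ¬ R (head xb) → ¬ R (head xc) →
        AdjTo R (head xa) → AdjTo R (head xb) → AdjTo R (head xc) →
        AdjTo S (head xa) → AdjTo S (head xb) → AdjTo S (head xc) →
        ¬ S (head xa) → ¬ S (head xb) → ¬ S (head xc) → xa ≢ xb → xa ≢ xc →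
        Hits xa xb kb → Hits xa xc kc → kb < kc → ⊥
      ordered-no-K₃₃ {xa} {xb} {xc} {kb} {kc} pa pb pc a∉R b∉R c∉R (ra , raR , a~ra) (rb , rbR , b~rb)
        (rc , rcR , c~rc) (sa , saS , a~sa) (sb , sbS , b~sb) (sc , scS , c~sc) a∉S b∉S c∉S a≢b a≢c hb hc b<c =
        [ J₁.scale≢0 , J₂.scale≢0 ]′ (ℤₚ.i*j≡0⇒i≡0∨j≡0 J₁.scale contra)
        where
        spokeA = through walkable v∉R raR xa pa raR a~ra
        spokeB = through walkable v∉R raR xb pb rbR b~rb
        spokeC = through walkable v∉R raR xc pc rcR c~rc
        curve₁ = jordan spokeA spokeB
        curve₂ = jordan spokeB spokeC
        module J₁ = Jordan curve₁
        module J₂ = Jordan curve₂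

        at : ∀ {i j} → i ≢ j → i ≤ kc → j ≤ kc → iter rot i xa ≢ iter rot j xa
        at {i} {j} i≢j i≤ j≤ eq with ℕₚ.<-cmp i j
        ... | tri< lt _ _ = hits-distinct hc lt j≤ eq
        ... | tri≈ _ e _  = i≢j e
        ... | tri> _ _ gt = hits-distinct hc gt i≤ (sym eq)

        b≢c : xb ≢ xc
        b≢c eq = proj₂ hc kb b<c (trans (proj₁ hb) eq)

        avoid-a : ∀ j → 0 < j → j < kc → iter rot j xa ≢ xa
        avoid-a j 0<j j<c = at {j} {0} (ℕₚ.>⇒≢ 0<j) (ℕₚ.<⇒≤ j<c) z≤n

        avoid-b : ∀ j → j ≢ kb → j < kc → iter rot j xa ≢ xb
        avoid-b j j≢b j<c eq = at j≢b (ℕₚ.<⇒≤ j<c) (ℕₚ.<⇒≤ b<c) (trans eq (sym (proj₁ hb)))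

        s₁ s₂ s₃ : Fin d → ℤ
        s₁ = J₁.value
        s₂ = J₂.value
        -- The two potentials come with unrelated scales. Each is multiplied by the scale of the
        -- other so that the flow through the middle neighbour cancels.
        s₃ x = J₂.scale * s₁ x + J₁.scale * s₂ x

        s₁-c : s₁ xc ≡ s₁ xb + J₁.scale
        s₁-c = trans (cong s₁ (sym (proj₁ hc))) (trans (run curve₁ pa b<c
          (λ j b<j j<c → avoid-a j (ℕₚ.≤-trans (s≤s z≤n) b<j) j<c , avoid-b j (ℕₚ.>⇒≢ b<j) j<c))
          (trans (cong (s₁ ∘ rot) (proj₁ hb)) (rot-second curve₁ a≢b)))

        s₂-b : s₂ xb ≡ s₂ xa
        s₂-b = trans (cong s₂ (sym (proj₁ hb))) (run curve₂ pa z≤n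
          (λ j _ j<b → avoid-b j (ℕₚ.<⇒≢ j<b) (ℕₚ.<-trans j<b b<c) , proj₂ hc j (ℕₚ.<-trans j<b b<c)))

        s₃-face : FaceFunction s₃
        s₃-face x = cong₂ (λ p q → J₂.scale * p + J₁.scale * q) (J₁.face x) (J₂.face x)

        not-v : ∀ {x} → tail x ≡ v → head x ≢ v
        not-v px eq = no-loop _ (trans eq (sym px))

        off₁ : ∀ {w} → w ≢ v → ¬ R w → w ≢ head xa → w ≢ head xb → Off s₁ w
        off₁ w≢v w∉R w≢a w≢b = outside-off curve₁ w≢v [ w∉R , w≢a ]′ [ w∉R , w≢b ]′

        off₂ : ∀ {w} → w ≢ v → ¬ R w → w ≢ head xb → w ≢ head xc → Off s₂ w
        off₂ w≢v w∉R w≢b w≢c = outside-off curve₂ w≢v [ w∉R , w≢b ]′ [ w∉R , w≢c ]′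

        avoids : ∀ {w u} → S w → ¬ S u → w ≢ u
        avoids w∈S u∉S refl = u∉S w∈S

        S-off₁ : ∀ {w} → S w → Off s₁ w
        S-off₁ w∈S = off₁ (proj₁ (S-free w∈S)) (proj₂ (S-free w∈S)) (avoids w∈S a∉S) (avoids w∈S b∉S)

        S-off₂ : ∀ {w} → S w → Off s₂ w
        S-off₂ w∈S = off₂ (proj₁ (S-free w∈S)) (proj₂ (S-free w∈S)) (avoids w∈S b∉S) (avoids w∈S c∉S)

        S-off₃ : ∀ {w} → S w → Off s₃ w
        S-off₃ w∈S x p = cong₂ (λ p q → J₂.scale * p + J₁.scale * q) (S-off₁ w∈S x p) (S-off₂ w∈S x p)

        off₃-b : Off s₃ (head xb)
        off₃-b x p = ℤₚ.i-j≡0⇒i≡j (s₃ x) (s₃ (rev x)) (begin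
          s₃ x - s₃ (rev x)
            ≡⟨ e₁ J₁.scale J₂.scale (s₁ x) (s₁ (rev x)) (s₂ x) (s₂ (rev x)) ⟩
          J₂.scale * (s₁ x - s₁ (rev x)) + J₁.scale * (s₂ x - s₂ (rev x))
            ≡⟨ cong₂ (λ p q → J₂.scale * p + J₁.scale * q) (J₁.jump x) (J₂.jump x) ⟩
          J₂.scale * (J₁.scale * (flow spokeA x - flow spokeB x)) +
            J₁.scale * (J₂.scale * (flow spokeB x - flow spokeC x))
            ≡⟨ cong₂ (λ p q → J₂.scale * (J₁.scale * (p - flow spokeB x)) +
                 J₁.scale * (J₂.scale * (flow spokeB x - q)))
                 (Spoke.flow-outside spokeA x (λ eq → not-v pb (trans (sym p) eq))
                   (subst (λ w → ¬ (R w ⊎ w ≡ head xa)) (sym p)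
                     [ b∉R , (λ eq → head-injective (trans pb (sym pa)) (a≢b ∘ sym) eq) ]′))
                 (Spoke.flow-outside spokeC x (λ eq → not-v pb (trans (sym p) eq))
                   (subst (λ w → ¬ (R w ⊎ w ≡ head xc)) (sym p)
                     [ b∉R , (λ eq → head-injective (trans pb (sym pc)) b≢c eq) ]′)) ⟩
          J₂.scale * (J₁.scale * (+ 0 - flow spokeB x)) + J₁.scale * (J₂.scale * (flow spokeB x - + 0))
            ≡⟨ e₂ J₁.scale J₂.scale (flow spokeB x) ⟩
          + 0 ∎)
          where
          open ≡-Reasoning
          e₁ : ∀ l m a b c d → (m * a + l * c) - (m * b + l * d) ≡ m * (a - b) + l * (c - d)
          e₁ = solve-∀
          e₂ : ∀ l m a → m * (l * (+ 0 - a)) + l * (m * (a - + 0)) ≡ + 0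
          e₂ = solve-∀

        link₁ : ∀ {w w′} → S w → S w′ → side s₁ w ≡ side s₁ w′
        link₁ = linked (side s₁) λ { p q (l , refl , refl) →
          trans (side-off J₁.face (S-off₁ p) refl)
            (trans (S-off₁ p l refl) (sym (side-off J₁.face (S-off₁ q) refl))) }

        link₂ : ∀ {w w′} → S w → S w′ → side s₂ w ≡ side s₂ w′
        link₂ = linked (side s₂) λ { p q (l , refl , refl) →
          trans (side-off J₂.face (S-off₂ p) refl)
            (trans (S-off₂ p l refl) (sym (side-off J₂.face (S-off₂ q) refl))) }

        reach : ∀ {s x w y} → FaceFunction s → Off s (head x) → Off s w → Adj (head x) w → tail y ≡ w → s x ≡ s y
        reach {x = x} face off off′ adj q = trans (off-into x off) (off-adjacent face off off′ adj refl q)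

        y = proj₁ (Adj-sym b~sb)
        y-tail = proj₁ (proj₂ (Adj-sym b~sb))

        at-c : s₁ xc ≡ s₁ y
        at-c = trans (reach J₁.face
            (off₁ (not-v pc) c∉R (head-injective (trans pc (sym pa)) (a≢c ∘ sym))
              (head-injective (trans pc (sym pb)) (b≢c ∘ sym)))
            (S-off₁ scS) c~sc (proj₁ (proj₂ (Adj-sym c~sc))))
          (trans (sym (side-off J₁.face (S-off₁ scS) (proj₁ (proj₂ (Adj-sym c~sc)))))
            (trans (link₁ scS sbS) (side-off J₁.face (S-off₁ sbS) y-tail)))

        at-a : s₂ xa ≡ s₂ y
        at-a = trans (reach J₂.face
            (off₂ (not-v pa) a∉R (head-injective (trans pa (sym pb)) a≢b)
              (head-injective (trans pa (sym pc)) a≢c))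
            (S-off₂ saS) a~sa (proj₁ (proj₂ (Adj-sym a~sa))))
          (trans (sym (side-off J₂.face (S-off₂ saS) (proj₁ (proj₂ (Adj-sym a~sa)))))
            (trans (link₂ saS sbS) (side-off J₂.face (S-off₂ sbS) y-tail)))

        at-b : s₃ xb ≡ s₃ y
        at-b = reach s₃-face off₃-b (S-off₃ sbS) b~sb y-tail

        contra : J₁.scale * J₂.scale ≡ + 0
        contra = begin
          J₁.scale * J₂.scale
            ≡⟨ e J₁.scale J₂.scale (s₁ xb) (s₂ xb) ⟩
          (J₂.scale * (s₁ xb + J₁.scale) + J₁.scale * s₂ xb) - s₃ xb
            ≡⟨ cong₂ (λ p q → (J₂.scale * p + J₁.scale * q) - s₃ xb) (trans (sym s₁-c) at-c) (trans s₂-b at-a) ⟩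
          s₃ y - s₃ xb
            ≡⟨ cong (λ p → s₃ y - p) at-b ⟩
          s₃ y - s₃ y
            ≡⟨ ℤₚ.+-inverseʳ (s₃ y) ⟩
          + 0 ∎
          where
          open ≡-Reasoning
          e : ∀ l m a b → l * m ≡ (m * (a + l) + l * b) - (m * a + l * b)
          e = solve-∀

    -- The two classes are `a`, `b`, `c` and `v`, `R`, `S`, where `R` and `S` act as single
    -- vertices. The two cyclic orders at `v` differ by exchanging `b` and `c`.
    no-K₃₃ : ∀ {a b c} → Adj v a → Adj v b → Adj v c → a ≢ b → b ≢ c → a ≢ c →
      ¬ R a → ¬ R b → ¬ R c → AdjTo R a → AdjTo R b → AdjTo R c →
      ¬ S a → ¬ S b → ¬ S c → AdjTo S a → AdjTo S b → AdjTo S c → ⊥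
    no-K₃₃ (xa , pa , refl) (xb , pb , refl) (xc , pc , refl) a≢b b≢c a≢c
      a∉R b∉R c∉R aR bR cR a∉S b∉S c∉S aS bS cS
      with firstHit xa xb (trans pa (sym pb)) | firstHit xa xc (trans pa (sym pc))
    ... | kb , hb | kc , hc with ℕₚ.<-cmp kb kc
    ...   | tri< lt _ _ = ordered-no-K₃₃ pa pb pc a∉R b∉R c∉R aR bR cR aS bS cS a∉S b∉S c∉S
                            (a≢b ∘ cong head) (a≢c ∘ cong head) hb hc lt
    ...   | tri≈ _ e _  = b≢c (cong head (trans (sym (proj₁ hb))
                            (trans (cong (λ k → iter rot k xa) e) (proj₁ hc))))
    ...   | tri> _ _ gt = ordered-no-K₃₃ pa pc pb a∉R c∉R b∉R aR cR bR aS cS bS a∉S c∉S b∉S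
                            (a≢c ∘ cong head) (a≢b ∘ cong head) hc hb gt

-- Coefficients of products of differences.

module Coefficients {n : ℕ} where
  open Int using (_+_; _*_; -_; _-_)

  Exponent : Set
  Exponent = Fin n → ℕ

  Edge : Set
  Edge = Fin n × Fin n

  infix 4 _≐_
  _≐_ : Exponent → Exponent → Set
  e ≐ f = ∀ k → e k ≡ f k

  lowered : ℕ → ℤ → ℤ
  lowered zero    _ = + 0
  lowered (suc _) z = z

  -- The contribution of the terms in which the leading factor supplies `w`; it makes the recursion
  -- of `coeff` an equation that can be rewritten with.
  drop : List Edge → Exponent → Fin n → ℤ
  drop es e w = lowered (e w) (coeff es (lower e w))

  coeff-∷ : ∀ u v es e → coeff ((u , v) ∷ es) e ≡ drop es e u - drop es e v
  coeff-∷ u v es e with e u | e v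
  ... | zero  | zero  = refl
  ... | zero  | suc _ = refl
  ... | suc _ | zero  = refl
  ... | suc _ | suc _ = refl

  lower-same : ∀ (e : Exponent) w → lower e w w ≡ Nat.pred (e w)
  lower-same e w with w Finₚ.≟ w
  ... | yes _ = refl
  ... | no ≢  = ⊥-elim (≢ refl)

  lower-other : ∀ (e : Exponent) {w k} → k ≢ w → lower e w k ≡ e k
  lower-other e {w} {k} k≢w with k Finₚ.≟ w
  ... | yes eq = ⊥-elim (k≢w eq)
  ... | no _   = refl

  lower-cong : ∀ {e f} → e ≐ f → ∀ w → lower e w ≐ lower f w
  lower-cong eq w k rewrite eq k = refl

  raise : Exponent → Fin n → Exponent
  raise e w k = if does (k Finₚ.≟ w) then suc (e k) else e k

  raise-same : ∀ e w → raise e w w ≡ suc (e w)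
  raise-same e w with w Finₚ.≟ w
  ... | yes _ = refl
  ... | no ≢  = ⊥-elim (≢ refl)

  raise-other : ∀ e {w k} → k ≢ w → raise e w k ≡ e k
  raise-other e {w} {k} k≢w with k Finₚ.≟ w
  ... | yes eq = ⊥-elim (k≢w eq)
  ... | no _   = refl

  raise-cong : ∀ {e f} → e ≐ f → ∀ w → raise e w ≐ raise f w
  raise-cong eq w k rewrite eq k = refl

  raise-comm : ∀ e u v → raise (raise e u) v ≐ raise (raise e v) u
  raise-comm e u v k with does (k Finₚ.≟ u) | does (k Finₚ.≟ v)
  ... | true  | true  = refl
  ... | true  | false = refl
  ... | false | true  = refl
  ... | false | false = refl

  lower-raise : ∀ e w → lower (raise e w) w ≐ e
  lower-raise e w k with does (k Finₚ.≟ w)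
  ... | true  = refl
  ... | false = refl

  lower-comm : ∀ (e : Exponent) u v → lower (lower e u) v ≐ lower (lower e v) u
  lower-comm e u v k with does (k Finₚ.≟ u) | does (k Finₚ.≟ v)
  ... | true  | true  = refl
  ... | true  | false = refl
  ... | false | true  = refl
  ... | false | false = refl

  raise-lower : ∀ e w → e w ≢ 0 → e ≐ raise (lower e w) w
  raise-lower e w ≢0 k with k Finₚ.≟ w
  ... | no _     = refl
  ... | yes refl with e k
  ...   | zero  = ⊥-elim (≢0 refl)
  ...   | suc _ = refl

  coeff-cong : ∀ es {e f} → e ≐ f → coeff es e ≡ coeff es f
  drop-cong : ∀ es {e f} → e ≐ f → ∀ w → drop es e w ≡ drop es f w
  coeff-cong [] {e} {f} eq = cong (λ b → if b then + 1 else + 0) (go (List.allFin n))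
    where
    go : ∀ ks → allB (λ k → e k Nat.≡ᵇ 0) ks ≡ allB (λ k → f k Nat.≡ᵇ 0) ks
    go [] = refl
    go (k ∷ ks) rewrite eq k | go ks = refl
  coeff-cong ((u , v) ∷ es) {e} {f} eq = trans (coeff-∷ u v es e)
    (trans (cong₂ _-_ (drop-cong es eq u) (drop-cong es eq v)) (sym (coeff-∷ u v es f)))
  drop-cong es eq w = cong₂ lowered (eq w) (coeff-cong es (lower-cong eq w))

  drop-raise : ∀ es e w → drop es (raise e w) w ≡ coeff es e
  drop-raise es e w rewrite raise-same e w = coeff-cong es (lower-raise e w)

  drop-zero : ∀ es {e w} → e w ≡ 0 → drop es e w ≡ + 0
  drop-zero es eq rewrite eq = refl

  infix 4 _∼_
  -- Order and orientation of the edges affect the product at most by a sign. Any nonzero factor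
  -- will do, because only nonvanishing of coefficients matters.
  record _∼_ (es fs : List Edge) : Set where
    constructor proportional
    field
      factor   : ℤ
      factor≢0 : factor ≢ + 0
      scales   : ∀ e → coeff es e ≡ factor * coeff fs e

  ∼-refl : ∀ {es} → es ∼ es
  ∼-refl {es} = proportional (+ 1) (λ ()) λ e → sym (ℤₚ.*-identityˡ (coeff es e))

  ∼-trans : ∀ {es fs gs} → es ∼ fs → fs ∼ gs → es ∼ gs
  ∼-trans (proportional σ σ≢0 p) (proportional τ τ≢0 q) = proportional (σ * τ)
    (λ eq → [ σ≢0 , τ≢0 ]′ (ℤₚ.i*j≡0⇒i≡0∨j≡0 σ eq))
    λ e → trans (p e) (trans (cong (σ *_) (q e)) (sym (ℤₚ.*-assoc σ τ _)))

  ∼-nonzero : ∀ {es fs} → es ∼ fs → ∀ {e} → coeff fs e ≢ + 0 → coeff es e ≢ + 0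
  ∼-nonzero (proportional σ σ≢0 p) {e} ≢0 eq = [ σ≢0 , ≢0 ]′ (ℤₚ.i*j≡0⇒i≡0∨j≡0 σ (trans (sym (p e)) eq))

  ∼-prep : ∀ x {es fs} → es ∼ fs → x ∷ es ∼ x ∷ fs
  ∼-prep (u , v) {es} {fs} (proportional σ σ≢0 p) = proportional σ σ≢0 λ e →
    trans (coeff-∷ u v es e) (trans (cong₂ _-_ (scaled e u) (scaled e v))
      (trans (l σ (drop fs e u) (drop fs e v)) (cong (σ *_) (sym (coeff-∷ u v fs e)))))
    where
    l : ∀ a b c → a * b - a * c ≡ a * (b - c)
    l = solve-∀
    scaled : ∀ e w → drop es e w ≡ σ * drop fs e w
    scaled e w with e w
    ... | zero  = sym (ℤₚ.*-zeroʳ σ)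
    ... | suc _ = p (lower e w)

  ∼-flip : ∀ u v es → (u , v) ∷ es ∼ (v , u) ∷ es
  ∼-flip u v es = proportional (- + 1) (λ ()) λ e → trans (coeff-∷ u v es e)
    (trans (l (drop es e u) (drop es e v)) (cong (- + 1 *_) (sym (coeff-∷ v u es e))))
    where
    l : ∀ a b → a - b ≡ - + 1 * (b - a)
    l = solve-∀

  drop₂ : List Edge → Exponent → Fin n → Fin n → ℤ
  drop₂ es e u w = lowered (e u) (drop es (lower e u) w)

  drop₂-comm : ∀ es e u w → drop₂ es e u w ≡ drop₂ es e w u
  drop₂-comm es e u w = go (u Finₚ.≟ w)
    where
    independent : ∀ a b c → lowered a (lowered b c) ≡ lowered b (lowered a c)
    independent zero    zero    c = refl
    independent zero    (suc _) c = refl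
    independent (suc _) zero    c = refl
    independent (suc _) (suc _) c = refl
    go : Dec (u ≡ w) → drop₂ es e u w ≡ drop₂ es e w u
    go (yes refl) = refl
    go (no u≢w) = trans
      (cong₂ (λ m z → lowered (e u) (lowered m z)) (lower-other e {u} {w} (u≢w ∘ sym)) (coeff-cong es (lower-comm e u w)))
      (trans (independent (e u) (e w) _)
        (cong (λ m → lowered (e w) (lowered m (coeff es (lower (lower e w) u)))) (sym (lower-other e {w} {u} u≢w))))

  drop-∷ : ∀ u v es e w → drop ((u , v) ∷ es) e w ≡ drop₂ es e w u - drop₂ es e w v
  drop-∷ u v es e w with e w
  ... | zero  = refl
  ... | suc _ = coeff-∷ u v es (lower e w)

  ∼-swap : ∀ x y es → x ∷ y ∷ es ∼ y ∷ x ∷ es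
  ∼-swap (u , v) (a , b) es = proportional (+ 1) (λ ()) λ e → begin
    coeff ((u , v) ∷ (a , b) ∷ es) e
      ≡⟨ coeff-∷ u v ((a , b) ∷ es) e ⟩
    drop ((a , b) ∷ es) e u - drop ((a , b) ∷ es) e v
      ≡⟨ cong₂ _-_ (drop-∷ a b es e u) (drop-∷ a b es e v) ⟩
    (D e u a - D e u b) - (D e v a - D e v b)
      ≡⟨ l (D e u a) (D e u b) (D e v a) (D e v b) ⟩
    + 1 * ((D e u a - D e v a) - (D e u b - D e v b))
      ≡⟨ cong₂ (λ p q → + 1 * (p - q)) (cong₂ _-_ (drop₂-comm es e u a) (drop₂-comm es e v a))
           (cong₂ _-_ (drop₂-comm es e u b) (drop₂-comm es e v b)) ⟩
    + 1 * ((D e a u - D e a v) - (D e b u - D e b v))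
      ≡⟨ cong₂ (λ p q → + 1 * (p - q)) (drop-∷ u v es e a) (drop-∷ u v es e b) ⟨
    + 1 * (drop ((u , v) ∷ es) e a - drop ((u , v) ∷ es) e b)
      ≡⟨ cong (+ 1 *_) (coeff-∷ a b ((u , v) ∷ es) e) ⟨
    + 1 * coeff ((a , b) ∷ (u , v) ∷ es) e ∎
    where
    open ≡-Reasoning
    D = drop₂ es
    l : ∀ a b c d → (a - b) - (c - d) ≡ + 1 * ((a - c) - (b - d))
    l = solve-∀

  raiseAll : Exponent → List (Fin n) → Exponent
  raiseAll e []       = e
  raiseAll e (w ∷ ws) = raise (raiseAll e ws) w

  raiseAll-other : ∀ e {ws k} → k ∉ ws → raiseAll e ws k ≡ e k
  raiseAll-other e {[]}     k∉ = refl
  raiseAll-other e {w ∷ ws} k∉ =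
    trans (raise-other (raiseAll e ws) (k∉ ∘ here)) (raiseAll-other e (k∉ ∘ there))

  raiseAll-raise : ∀ e w ws → raiseAll (raise e w) ws ≐ raise (raiseAll e ws) w
  raiseAll-raise e w []       k = refl
  raiseAll-raise e w (x ∷ ws) k =
    trans (raise-cong (raiseAll-raise e w ws) x k) (raise-comm (raiseAll e ws) w x k)

  -- If the second end of every edge of L has exponent 0, each factor must contribute its first end.
  forced : ∀ L {es e} → All (λ { (w , k) → e k ≡ 0 × k ∉ List.map proj₁ L }) L →
    coeff (L ++ es) (raiseAll e (List.map proj₁ L)) ≡ coeff es e
  forced L {es} {e} all = go L all (λ k∈ → k∈)
    where
    go : ∀ M → All (λ { (w , k) → e k ≡ 0 × k ∉ List.map proj₁ L }) M →
      (∀ {k} → k ∈ List.map proj₁ M → k ∈ List.map proj₁ L) →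
      coeff (M ++ es) (raiseAll e (List.map proj₁ M)) ≡ coeff es e
    go [] [] sub = refl
    go ((w , k) ∷ M) ((ek≡0 , k∉) ∷ rest) sub = trans (coeff-∷ w k (M ++ es) (raiseAll e (w ∷ List.map proj₁ M)))
      (trans (cong₂ _-_
        (trans (drop-raise (M ++ es) (raiseAll e (List.map proj₁ M)) w) (go M rest (sub ∘ there)))
        (drop-zero (M ++ es) {raiseAll e (w ∷ List.map proj₁ M)}
          (trans (raiseAll-other e {w ∷ List.map proj₁ M} (k∉ ∘ sub)) ek≡0)))
        (ℤₚ.+-identityʳ (coeff es e)))

  total : ∀ {m} → (Fin m → ℕ) → ℕ
  total {zero}  f = 0
  total {suc m} f = f zero Nat.+ total (f ∘ suc)

  total-cong : ∀ {m} {f g : Fin m → ℕ} → (∀ k → f k ≡ g k) → total f ≡ total g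
  total-cong {zero}  eq = refl
  total-cong {suc m} eq = cong₂ Nat._+_ (eq zero) (total-cong (eq ∘ suc))

  total-suc : ∀ {m} {f g : Fin m → ℕ} w → f w ≡ suc (g w) → (∀ k → k ≢ w → f k ≡ g k) →
    total f ≡ suc (total g)
  total-suc {suc m} zero fw other =
    cong₂ Nat._+_ fw (total-cong λ k → other (suc k) λ ())
  total-suc {suc m} {f} {g} (suc w) fw other =
    trans (cong₂ Nat._+_ (other zero λ ())
      (total-suc w fw λ k k≢w → other (suc k) (k≢w ∘ Finₚ.suc-injective)))
      (ℕₚ.+-suc (g zero) (total (g ∘ suc)))

  total≡0 : ∀ {m} (f : Fin m → ℕ) → total f ≡ 0 → ∀ k → f k ≡ 0
  total≡0 f eq zero    = ℕₚ.m+n≡0⇒m≡0 (f zero) eq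
  total≡0 f eq (suc k) = total≡0 (f ∘ suc) (ℕₚ.m+n≡0⇒n≡0 (f zero) eq) k

  total-zero : ∀ {m} (f : Fin m → ℕ) → (∀ k → f k ≡ 0) → total f ≡ 0
  total-zero {zero}  f eq = refl
  total-zero {suc m} f eq rewrite eq zero = total-zero (f ∘ suc) (eq ∘ suc)

  total-lower : ∀ (e : Exponent) w {m} → e w ≡ suc m → total e ≡ suc (total (lower e w))
  total-lower e w eq = total-suc w
    (trans eq (cong suc (sym (trans (lower-same e w) (cong Nat.pred eq)))))
    λ k k≢w → sym (lower-other e k≢w)

  coeff-[]-zero : ∀ e → (∀ k → e k ≡ 0) → coeff [] e ≡ + 1
  coeff-[]-zero e eq = cong (λ b → if b then + 1 else + 0) (go (List.allFin n))
    where
    go : ∀ ks → allB (λ k → e k Nat.≡ᵇ 0) ks ≡ true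
    go [] = refl
    go (k ∷ ks) rewrite eq k = go ks

  coeff-[]-nonzero : ∀ e → total e ≢ 0 → coeff [] e ≡ + 0
  coeff-[]-nonzero e ≢0 with isZeroExp e in eq
  ... | false = refl
  ... | true  = ⊥-elim (≢0 (total-zero e λ (k : Fin n) → ℕₚ.≡ᵇ⇒≡ (e k) 0 (All.lookup (go (List.allFin n) eq) (∈ₚ.∈-allFin k))))
    where
    go : ∀ ks → allB (λ k → e k Nat.≡ᵇ 0) ks ≡ true → All (λ k → T (e k Nat.≡ᵇ 0)) ks
    go [] _ = []
    go (k ∷ ks) eq with e k Nat.≡ᵇ 0 in ek
    ... | true = subst T (sym ek) tt ∷ go ks eq

  difference-zero : ∀ {a b} → a ≡ + 0 → b ≡ + 0 → a - b ≡ + 0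
  difference-zero refl refl = refl

  inhomogeneous : ∀ es e → total e ≢ length es → coeff es e ≡ + 0
  inhomogeneous [] e ≢ = coeff-[]-nonzero e ≢
  inhomogeneous ((u , v) ∷ es) e ≢ =
    trans (coeff-∷ u v es e) (difference-zero (go u) (go v))
    where
    go : ∀ w → drop es e w ≡ + 0
    go w with e w in eq
    ... | zero  = refl
    ... | suc m = inhomogeneous es (lower e w) λ p → ≢ (trans (total-lower e w eq) (cong suc p))

  homogeneous : ∀ es e → coeff es e ≢ + 0 → total e ≡ length es
  homogeneous es e ≢0 with total e Nat.≟ length es
  ... | yes eq = eq
  ... | no ≢   = ⊥-elim (≢0 (inhomogeneous es e ≢))

  module Masked (X : Fin n → Bool) where

    mask unmask : Exponent → Exponent
    mask   e k = if X k then e k else 0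
    unmask e k = if X k then 0 else e k

    Avoids : Edge → Set
    Avoids (u , v) = X u ≡ false × X v ≡ false

    mask-lower-in : ∀ e w → X w ≡ true → mask (lower e w) ≐ lower (mask e) w
    mask-lower-in e w w∈ k with k Finₚ.≟ w
    ... | no _ = refl
    ... | yes refl rewrite w∈ = refl

    unmask-lower-in : ∀ e w → X w ≡ true → unmask (lower e w) ≐ unmask e
    unmask-lower-in e w w∈ k with k Finₚ.≟ w
    ... | no _ = refl
    ... | yes refl rewrite w∈ = refl

    mask-lower-out : ∀ e w → X w ≡ false → mask (lower e w) ≐ mask e
    mask-lower-out e w w∉ k with k Finₚ.≟ w
    ... | no _ = refl
    ... | yes refl rewrite w∉ = refl

    mask-in : ∀ e w → X w ≡ true → mask e w ≡ e w
    mask-in e w w∈ rewrite w∈ = refl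

    total-mask-lower : ∀ {e w m} → X w ≡ true → e w ≡ suc m →
      total (mask e) ≡ suc (total (mask (lower e w)))
    total-mask-lower {e} {w} w∈ eq = trans (total-lower (mask e) w (trans (mask-in e w w∈) eq))
      (cong suc (sym (total-cong (mask-lower-in e w w∈))))

    -- Each factor of `fs` supplies at most one variable from `X` and `es` supplies none, so the
    -- degree demanded in `X` cannot be reached.
    vanish : ∀ fs {es} e → All Avoids es → length fs < total (mask e) → coeff (fs ++ es) e ≡ + 0
    vanish [] {[]} e [] lt = coeff-[]-nonzero e λ eq → ℕₚ.<⇒≢ lt (sym (total-zero (mask e)
      λ k → masked-zero k (total≡0 e eq k)))
      where
      masked-zero : ∀ k → e k ≡ 0 → mask e k ≡ 0
      masked-zero k eq with X k
      ... | true  = eq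
      ... | false = refl
    vanish [] {(u , v) ∷ es} e ((u∉ , v∉) ∷ av) lt =
      trans (coeff-∷ u v es e) (difference-zero (go u u∉) (go v v∉))
      where
      go : ∀ w → X w ≡ false → drop es e w ≡ + 0
      go w w∉ with e w
      ... | zero  = refl
      ... | suc _ = vanish [] (lower e w) av
                      (subst (0 <_) (sym (total-cong (mask-lower-out e w w∉))) lt)
    vanish ((u , v) ∷ fs) {es} e av lt =
      trans (coeff-∷ u v (fs ++ es) e) (difference-zero (go u) (go v))
      where
      go : ∀ w → drop (fs ++ es) e w ≡ + 0
      go w with e w in eq
      ... | zero  = refl
      ... | suc m with X w in w∈
      ...   | false = vanish fs (lower e w) av (ℕₚ.<-trans (ℕₚ.n<1+n _)
                        (subst (suc (length fs) <_) (sym (total-cong (mask-lower-out e w w∈))) lt))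
      ...   | true  = vanish fs (lower e w) av (ℕₚ.≤-pred (subst (suc (suc (length fs)) ≤_) (total-mask-lower w∈ eq) lt))

    -- Only fs involves the variables in X, so by degree reasons its factors contribute nothing else.
    product : ∀ fs {es} e → All Avoids es → total (mask e) ≡ length fs →
      coeff (fs ++ es) e ≡ coeff fs (mask e) * coeff es (unmask e)
    product [] {es} e av deg = trans (coeff-cong es λ k → same k (total≡0 (mask e) deg k))
      (sym (trans (cong (_* coeff es (unmask e)) (coeff-[]-zero (mask e) (total≡0 (mask e) deg)))
        (ℤₚ.*-identityˡ (coeff es (unmask e)))))
      where
      same : ∀ k → mask e k ≡ 0 → e k ≡ unmask e k
      same k eq with X k
      ... | true  = eq
      ... | false = refl
    product ((u , v) ∷ fs) {es} e av deg = begin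
      coeff ((u , v) ∷ fs ++ es) e
        ≡⟨ coeff-∷ u v (fs ++ es) e ⟩
      drop (fs ++ es) e u - drop (fs ++ es) e v
        ≡⟨ cong₂ _-_ (go u) (go v) ⟩
      drop fs (mask e) u * c - drop fs (mask e) v * c
        ≡⟨ l (drop fs (mask e) u) (drop fs (mask e) v) c ⟩
      (drop fs (mask e) u - drop fs (mask e) v) * c
        ≡⟨ cong (_* c) (coeff-∷ u v fs (mask e)) ⟨
      coeff ((u , v) ∷ fs) (mask e) * c ∎
      where
      open ≡-Reasoning
      c = coeff es (unmask e)
      l : ∀ a b c → a * c - b * c ≡ (a - b) * c
      l = solve-∀
      go : ∀ w → drop (fs ++ es) e w ≡ drop fs (mask e) w * c
      go w with X w in w∈
      go w | false with e w
      ... | zero  = refl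
      ... | suc _ = vanish fs (lower e w) av
        (subst (length fs <_) (sym (trans (total-cong (mask-lower-out e w w∈)) deg)) (ℕₚ.n<1+n _))
      go w | true with e w in eq
      ... | zero  = refl
      ... | suc _ = trans
        (product fs (lower e w) av (ℕₚ.suc-injective (trans (sym (total-mask-lower w∈ eq)) deg)))
        (cong₂ _*_ (coeff-cong fs (mask-lower-in e w w∈)) (coeff-cong es (unmask-lower-in e w w∈)))

  -- The gluing principle. Factors of `fs` may contain variables of `es`, but by homogeneity `β`
  -- already uses up all of them inside `X`; so the coefficient is a product of two nonzero
  -- integers.
  product-nonzero : ∀ (X : Fin n → Bool) {es fs} {α β : Exponent} → All (Masked.Avoids X) es →
    (∀ k → X k ≡ true → α k ≡ 0) → (∀ k → X k ≡ false → β k ≡ 0) →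
    coeff es α ≢ + 0 → coeff fs β ≢ + 0 → coeff (fs ++ es) (λ k → α k Nat.+ β k) ≢ + 0
  product-nonzero X {es} {fs} {α} {β} av α-out β-in α≢0 β≢0 eq =
    [ β≢0 , α≢0 ]′ (ℤₚ.i*j≡0⇒i≡0∨j≡0 (coeff fs β) (trans
      (sym (trans (product fs e av (trans (total-cong masked) (homogeneous fs β β≢0)))
        (cong₂ _*_ (coeff-cong fs masked) (coeff-cong es unmasked)))) eq))
    where
    open Masked X
    e : Exponent
    e k = α k Nat.+ β k
    masked : mask e ≐ β
    masked k with X k in k∈
    ... | true  = cong (Nat._+ β k) (α-out k k∈)
    ... | false = sym (β-in k k∈)
    unmasked : unmask e ≐ α
    unmasked k with X k in k∈
    ... | true  = sym (α-out k k∈)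
    ... | false = trans (cong (α k Nat.+_) (β-in k k∈)) (ℕₚ.+-identityʳ (α k))

  absent-zero : ∀ {es e} w → All (λ { (u , v) → u ≢ w × v ≢ w }) es → coeff es e ≢ + 0 → e w ≡ 0
  absent-zero {es} {e} w av ≢0 with e w in eq
  ... | zero  = refl
  ... | suc m = ⊥-elim (≢0 (Masked.vanish X [] e (All.map (λ (p , q) → out p , out q) av) positive))
    where
    X : Fin n → Bool
    X k = does (k Finₚ.≟ w)
    out : ∀ {k} → k ≢ w → X k ≡ false
    out {k} k≢w with k Finₚ.≟ w
    ... | yes p = ⊥-elim (k≢w p)
    ... | no _  = refl
    at-w : X w ≡ true
    at-w with w Finₚ.≟ w
    ... | yes _ = refl
    ... | no p  = ⊥-elim (p refl)
    positive : 0 < total (Masked.mask X e)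
    positive = subst (0 <_) (sym (Masked.total-mask-lower X at-w eq)) (s≤s z≤n)

  -- Since `es` does not contain `v`, exactly one edge of the star has to supply `v`. The end `u` it
  -- then fails to supply must come from `es`, so up to sign the coefficient is the sum of the
  -- coefficients of `raise γ u`.
  leak : ∀ {es γ v} us → γ v ≡ 0 → v ∉ us → All (λ { (a , b) → a ≢ v × b ≢ v }) es →
    All (λ u → coeff es (raise γ u) ≡ + 0) us →
    coeff (List.map (_, v) us ++ es) (raise (raiseAll γ us) v) ≡ + 0
  leak {es} {γ} {v} [] γv v∉ av [] with coeff es (raise γ v) ℤₚ.≟ + 0
  ... | yes eq = eq
  ... | no ≢0  = contradiction (trans (sym (raise-same γ v)) (absent-zero v av ≢0)) λ ()
  leak {es} {γ} {v} (u ∷ us) γv v∉ av (p ∷ ps) = trans (coeff-∷ u v (L ++ es) (raise (raise F u) v)) (difference-zero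
    (trans (drop-cong (L ++ es) (raise-comm F u v) u)
      (trans (drop-raise (L ++ es) (raise F v) u) (leak us γv (v∉ ∘ there) av ps)))
    (trans (drop-raise (L ++ es) (raise F u) v) (begin
      coeff (L ++ es) (raise F u)
        ≡⟨ coeff-cong (L ++ es) (λ k → sym (raiseAll-raise γ u us k)) ⟩
      coeff (L ++ es) (raiseAll (raise γ u) us)
        ≡⟨ cong (λ ws → coeff (L ++ es) (raiseAll (raise γ u) ws)) firsts ⟨
      coeff (L ++ es) (raiseAll (raise γ u) (List.map proj₁ L))
        ≡⟨ forced L (Allₚ.map⁺ (All.tabulate λ _ →
             trans (raise-other γ (v∉ ∘ here)) γv , subst (v ∉_) (sym firsts) (v∉ ∘ there))) ⟩
      coeff es (raise γ u)
        ≡⟨ p ⟩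
      + 0 ∎)))
    where
    open ≡-Reasoning
    L = List.map (_, v) us
    F = raiseAll γ us
    firsts : List.map proj₁ L ≡ us
    firsts = trans (sym (Listₚ.map-∘ us)) (Listₚ.map-id us)

-- Edge sets as relations, and the polynomials they determine.

module Enumerations {n : ℕ} where
  open Coefficients {n}

  Relation : Set₁
  Relation = Fin n → Fin n → Set

  Distinct : Edge → Edge → Set
  Distinct (u , v) (a , b) = ¬ (u ≡ a × v ≡ b) × ¬ (u ≡ b × v ≡ a)

  Distinct-sym : ∀ {x y} → Distinct x y → Distinct y x
  Distinct-sym (d , d′) = (λ (p , q) → d (sym p , sym q)) , (λ (p , q) → d′ (sym q , sym p))

  Distinct-flip : ∀ {u v y} → Distinct (v , u) y → Distinct (u , v) y
  Distinct-flip (d , d′) = (λ (p , q) → d′ (q , p)) , (λ (p , q) → d (q , p))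

  Distinct-flip′ : ∀ {x a b} → Distinct x (a , b) → Distinct x (b , a)
  Distinct-flip′ (d , d′) = d′ , d

  infix 4 _∈ᵤ_
  _∈ᵤ_ : Edge → List Edge → Set
  (u , v) ∈ᵤ es = (u , v) ∈ es ⊎ (v , u) ∈ es

  -- Every unordered pair is listed once in an arbitrary orientation. Two such lists of the same
  -- relation are proportional, so graphs can be cut and glued as relations without tracking order
  -- or signs.
  record Enum (A : Relation) (es : List Edge) : Set where
    field
      sound    : ∀ {u v} → (u , v) ∈ es → A u v
      complete : ∀ {u v} → A u v → (u , v) ∈ᵤ es
      simple   : AllPairs Distinct es

  private
    Pulled : Edge → List Edge → Set
    Pulled x fs = ∃ λ gs → x ∷ gs ∼ fs × AllPairs Distinct gs ×
      (∀ {y} → y ∈ gs → Distinct x y × y ∈ fs) × (∀ {y} → y ∈ fs → Distinct x y → y ∈ gs)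

    pull-later : ∀ {x y fs} → All (Distinct y) fs → Distinct x y → Pulled x fs → Pulled x (y ∷ fs)
    pull-later {x} {y} ds xy (gs , sim , simple , from , to) =
      y ∷ gs , ∼-trans (∼-swap x y gs) (∼-prep y sim) ,
      All.tabulate (λ z∈ → All.lookup ds (proj₂ (from z∈))) ∷ simple ,
      (λ { (here refl) → xy , here refl ; (there z∈) → proj₁ (from z∈) , there (proj₂ (from z∈)) }) ,
      λ { (here refl) _ → here refl ; (there z∈) d → there (to z∈ d) }

    pull : ∀ {x} fs → AllPairs Distinct fs → x ∈ᵤ fs → Pulled x fs
    pull {u , v} (_ ∷ fs) (ds ∷ simple) (inj₁ (here refl)) =
      fs , ∼-refl , simple , (λ y∈ → All.lookup ds y∈ , there y∈) ,
      λ { (here refl) (d , _) → ⊥-elim (d (refl , refl)) ; (there y∈) _ → y∈ }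
    pull {u , v} (_ ∷ fs) (ds ∷ simple) (inj₂ (here refl)) =
      fs , ∼-flip u v fs , simple ,
      (λ y∈ → let d , d′ = All.lookup ds y∈ in
        ((λ (p , q) → d′ (q , p)) , (λ (p , q) → d (q , p))) , there y∈) ,
      λ { (here refl) (_ , d) → ⊥-elim (d (refl , refl)) ; (there y∈) _ → y∈ }
    pull {u , v} (_ ∷ fs) (ds ∷ simple) (inj₁ (there x∈)) =
      pull-later ds (Distinct-sym (All.lookup ds x∈)) (pull fs simple (inj₁ x∈))
    pull {u , v} (_ ∷ fs) (ds ∷ simple) (inj₂ (there x∈)) =
      pull-later ds (Distinct-flip (Distinct-sym (All.lookup ds x∈))) (pull fs simple (inj₂ x∈))

  -- The head of one list is pulled to the front of the other, at the cost of swaps and perhaps a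
  -- flip, and the tails are compared.
  simple-∼ : ∀ {es fs} → AllPairs Distinct es → AllPairs Distinct fs →
    (∀ {x} → x ∈ es → x ∈ᵤ fs) → (∀ {x} → x ∈ fs → x ∈ᵤ es) → es ∼ fs
  simple-∼ {[]} {[]}     _ _ _ _ = ∼-refl
  simple-∼ {[]} {y ∷ fs} _ _ _ back with back (here refl)
  ... | inj₁ ()
  ... | inj₂ ()
  simple-∼ {x ∷ es} {fs} (ds ∷ es-simple) fs-simple to back with pull fs fs-simple (to (here refl))
  ... | gs , sim , gs-simple , from , into =
    ∼-trans (∼-prep x (simple-∼ es-simple gs-simple
      (λ y∈ → [ (λ p → inj₁ (into p (All.lookup ds y∈))) ,
                (λ p → inj₂ (into p (Distinct-flip′ (All.lookup ds y∈)))) ]′ (to (there y∈)))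
      λ y∈ → [ (λ { (here refl) → ⊥-elim (proj₁ (proj₁ (from y∈)) (refl , refl)) ; (there p) → inj₁ p }) ,
               (λ { (here refl) → ⊥-elim (proj₂ (proj₁ (from y∈)) (refl , refl)) ; (there p) → inj₂ p }) ]′
             (back (proj₂ (from y∈))))) sim

  Enum-∼ : ∀ {A es fs} → Enum A es → Enum A fs → es ∼ fs
  Enum-∼ E F = simple-∼ (Enum.simple E) (Enum.simple F)
    (λ x∈ → Enum.complete F (Enum.sound E x∈)) (λ x∈ → Enum.complete E (Enum.sound F x∈))

  Enum-resp : ∀ {A B es} → (∀ {u v} → A u v → B u v) → (∀ {u v} → B u v → A u v) → Enum A es → Enum B es
  Enum-resp to from E = record
    { sound = to ∘ Enum.sound E ; complete = Enum.complete E ∘ from ; simple = Enum.simple E }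

  _∪ᴿ_ : Relation → Relation → Relation
  (A ∪ᴿ B) u v = A u v ⊎ B u v

  Enum-++ : ∀ {A B es fs} → (∀ {u v} → A u v → ¬ B u v × ¬ B v u) →
    Enum A es → Enum B fs → Enum (A ∪ᴿ B) (es ++ fs)
  Enum-++ {es = es} apart E F = record
    { sound = λ x∈ → [ inj₁ ∘ Enum.sound E , inj₂ ∘ Enum.sound F ]′ (∈ₚ.∈-++⁻ es x∈)
    ; complete =
        [ (λ a → [ inj₁ ∘ ∈ₚ.∈-++⁺ˡ , inj₂ ∘ ∈ₚ.∈-++⁺ˡ ]′ (Enum.complete E a))
        , (λ b → [ inj₁ ∘ ∈ₚ.∈-++⁺ʳ es , inj₂ ∘ ∈ₚ.∈-++⁺ʳ es ]′ (Enum.complete F b)) ]′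
    ; simple = AllPairsₚ.++⁺ (Enum.simple E) (Enum.simple F)
        (All.tabulate λ x∈ → All.tabulate λ y∈ →
          (λ { (refl , refl) → proj₁ (apart (Enum.sound E x∈)) (Enum.sound F y∈) }) ,
          (λ { (refl , refl) → proj₂ (apart (Enum.sound E x∈)) (Enum.sound F y∈) })) }

  Pair : Fin n → Fin n → Relation
  Pair u v a b = (a ≡ u × b ≡ v) ⊎ (a ≡ v × b ≡ u)

  Star : List (Fin n) → Fin n → Relation
  Star us v a b = (a ∈ us × b ≡ v) ⊎ (b ∈ us × a ≡ v)

  star : List (Fin n) → Fin n → List Edge
  star us v = List.map (_, v) us

  Enum-star : ∀ {us v} → Unique us → v ∉ us → Enum (Star us v) (star us v)
  Enum-star {us} {v} unique v∉ = record
    { sound = λ x∈ → let u , u∈ , eq = ∈ₚ.∈-map⁻ (_, v) x∈ in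
        inj₁ (subst (_∈ us) (sym (cong proj₁ eq)) u∈ , cong proj₂ eq)
    ; complete = λ { (inj₁ (a∈ , refl)) → inj₁ (∈ₚ.∈-map⁺ (_, v) a∈)
                   ; (inj₂ (b∈ , refl)) → inj₂ (∈ₚ.∈-map⁺ (_, v) b∈) }
    ; simple = go unique v∉ }
    where
    go : ∀ {us} → Unique us → v ∉ us → AllPairs Distinct (star us v)
    go [] _ = []
    go {u ∷ us} (u∉ ∷ unique) v∉ =
      Allₚ.map⁺ (All.map (λ u≢ → (λ (p , _) → u≢ p) , (λ (p , _) → v∉ (here (sym p)))) u∉) ∷ go unique (v∉ ∘ there)

  star-firsts : ∀ us v → List.map proj₁ (star us v) ≡ us
  star-firsts us v = trans (sym (Listₚ.map-∘ us)) (Listₚ.map-id us)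

  Enum-[] : ∀ {A : Relation} → (∀ {u v} → ¬ A u v) → Enum A []
  Enum-[] none = record { sound = λ () ; complete = λ a → ⊥-elim (none a) ; simple = [] }

  Enum-avoids : ∀ {A : Relation} {es w} → Enum A es → (∀ {u v} → A u v → u ≢ w × v ≢ w) →
    All (λ { (u , v) → u ≢ w × v ≢ w }) es
  Enum-avoids E avoid = All.tabulate λ x∈ → avoid (Enum.sound E x∈)

  -- One enumeration speaks for all, by `Enum-∼`.
  NZ : Relation → Exponent → Set
  NZ A β = ∃ λ es → Enum A es × coeff es β ≢ + 0

  NZ-cong : ∀ {A β γ} → β ≐ γ → NZ A β → NZ A γ
  NZ-cong eq (es , E , ≢0) = es , E , λ z → ≢0 (trans (coeff-cong es eq) z)

  NZ-resp : ∀ {A B β} → (∀ {u v} → A u v → B u v) → (∀ {u v} → B u v → A u v) → NZ A β → NZ B β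
  NZ-resp to from (es , E , ≢0) = es , Enum-resp to from E , ≢0

  Apart : Relation → Relation → Set
  Apart A B = ∀ {u v} → A u v → ¬ B u v × ¬ B v u

  star-apart : ∀ {A us v} → (∀ {a b} → A a b → a ≢ v × b ≢ v) → Apart (Star us v) A
  star-apart avoid (inj₁ (_ , refl)) = (λ p → proj₂ (avoid p) refl) , (λ p → proj₁ (avoid p) refl)
  star-apart avoid (inj₂ (_ , refl)) = (λ p → proj₁ (avoid p) refl) , (λ p → proj₂ (avoid p) refl)

  coeff-star : ∀ {us v β} es → v ∉ us → β v ≡ 0 → coeff (star us v ++ es) (raiseAll β us) ≡ coeff es β
  coeff-star {us} {v} {β} es v∉ βv =
    trans (cong (coeff (star us v ++ es) ∘ raiseAll β) (sym (star-firsts us v)))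
      (forced (star us v) (Allₚ.map⁺ (All.tabulate λ _ → βv , subst (v ∉_) (sym (star-firsts us v)) v∉)))

  -- As `v` has exponent 0, each new edge has only one way to contribute, and no cancellation can
  -- occur.
  NZ-star : ∀ {A us v β} → Unique us → v ∉ us → β v ≡ 0 → Apart (Star us v) A →
    NZ A β → NZ (Star us v ∪ᴿ A) (raiseAll β us)
  NZ-star {us = us} {v} unique v∉ βv apart (es , E , ≢0) =
    star us v ++ es , Enum-++ apart (Enum-star unique v∉) E , λ eq → ≢0 (trans (sym (coeff-star es v∉ βv)) eq)

  NZ-edge : ∀ {A u v β} → u ≢ v → β v ≡ 0 → Apart (Star (u ∷ []) v) A →
    NZ A β → NZ (Star (u ∷ []) v ∪ᴿ A) (raise β u)
  NZ-edge u≢v βv = NZ-star ([] ∷ []) (λ { (here eq) → u≢v (sym eq) }) βv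

  -- Of the factors at v, the edge to y contributes v; when y is contributed instead, v must be taken
  -- from one of the edges to us, and the hypothesis makes the resulting terms vanish.
  NZ-leak : ∀ {A us v y es β} → Unique us → v ∉ us → β v ≡ 0 → y ≢ v → y ∉ us →
    (∀ {a b} → A a b → a ≢ v × b ≢ v) → Apart (Star (v ∷ []) y) (Star us v ∪ᴿ A) →
    Enum A es → coeff es β ≢ + 0 →
    (β y ≢ 0 → All (λ u → coeff es (raise (lower β y) u) ≡ + 0) us) →
    NZ (Star (v ∷ []) y ∪ᴿ (Star us v ∪ᴿ A)) (raise (raiseAll β us) v)
  NZ-leak {A} {us} {v} {y} {es} {β} unique v∉ βv y≢v y∉ avoid apart E ≢0 vanishing =
    star (v ∷ []) y ++ (star us v ++ es) ,
    Enum-++ apart (Enum-star ([] ∷ []) λ { (here eq) → y≢v eq })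
      (Enum-++ (star-apart avoid) (Enum-star unique v∉) E) ,
    λ eq → ≢0 (trans (sym value) eq)
    where
    L = star us v ++ es
    F = raiseAll β us
    γ = lower β y
    other : drop L (raise F v) y ≡ + 0
    other with β y Nat.≟ 0
    ... | yes βy≡0 = drop-zero L (trans (raise-other F y≢v) (trans (raiseAll-other β y∉) βy≡0))
    ... | no βy≢0  = trans (drop-cong L same y) (trans (drop-raise L (raise (raiseAll γ us) v) y)
        (leak us (trans (lower-other β (y≢v ∘ sym)) βv) v∉ (Enum-avoids E avoid) (vanishing βy≢0)))
      where
      F≐ : ∀ vs → raiseAll β vs ≐ raise (raiseAll γ vs) y
      F≐ []       k = raise-lower β y βy≢0 k
      F≐ (x ∷ vs) k = trans (raise-cong (F≐ vs) x k) (raise-comm (raiseAll γ vs) y x k)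
      same : raise F v ≐ raise (raise (raiseAll γ us) v) y
      same k = trans (raise-cong (F≐ us) v k) (raise-comm (raiseAll γ us) y v k)
    value : coeff ((v , y) ∷ L) (raise F v) ≡ coeff es β
    value = trans (coeff-∷ v y L (raise F v)) (trans
      (cong₂ Int._-_ (trans (drop-raise L F v) (coeff-star es v∉ βv)) other)
      (ℤₚ.+-identityʳ (coeff es β)))

  raiseAll-∈ : ∀ β {us w} → Unique us → w ∈ us → raiseAll β us w ≡ suc (β w)
  raiseAll-∈ β {u ∷ us} (u∉ ∷ unique) (here refl) = trans (raise-same (raiseAll β us) u)
    (cong suc (raiseAll-other β λ u∈ → All.lookup u∉ u∈ refl))
  raiseAll-∈ β {u ∷ us} (u∉ ∷ unique) (there w∈) =
    trans (raise-other (raiseAll β us) λ { refl → All.lookup u∉ w∈ refl }) (raiseAll-∈ β unique w∈)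

-- Subsets and lists cut out by decidable predicates.

module Comprehension {n : ℕ} where
  private variable P : Fin n → Set

  ⟪_⟫ : (∀ w → Dec (P w)) → Subset n
  ⟪ P? ⟫ = Vec.tabulate (does ∘ P?)

  ∈⟪⟫ : (P? : ∀ w → Dec (P w)) → ∀ {w} → P w → w ∈ˢ ⟪ P? ⟫
  ∈⟪⟫ P? {w} p = Vecₚ.lookup⇒[]= w _ (trans (Vecₚ.lookup∘tabulate (does ∘ P?) w) (dec-true (P? w) p))

  ⟪⟫∋ : (P? : ∀ w → Dec (P w)) → ∀ {w} → w ∈ˢ ⟪ P? ⟫ → P w
  ⟪⟫∋ P? {w} w∈ with P? w in eq
  ... | yes p = p
  ... | no _  = contradiction (trans (sym (Vecₚ.[]=⇒lookup w∈))
                  (trans (Vecₚ.lookup∘tabulate (does ∘ P?) w) (cong does eq))) λ ()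

  smaller : (P? : ∀ w → Dec (P w)) {U : Subset n} → (∀ {w} → P w → w ∈ˢ U) →
    ∀ {x} → x ∈ˢ U → ¬ P x → ∣ ⟪ P? ⟫ ∣ < ∣ U ∣
  smaller P? ⊆U x∈ ¬Px = Subsetₚ.p⊂q⇒∣p∣<∣q∣ ((⊆U ∘ ⟪⟫∋ P?) , _ , x∈ , ¬Px ∘ ⟪⟫∋ P?)

  select : (∀ w → Dec (P w)) → List (Fin n)
  select P? = List.filter P? (List.allFin n)

  select-unique : (P? : ∀ w → Dec (P w)) → Unique (select P?)
  select-unique P? = Uniqueₚ.filter⁺ P? (Uniqueₚ.allFin⁺ n)

  ∈select : (P? : ∀ w → Dec (P w)) → ∀ {w} → P w → w ∈ select P?
  ∈select P? p = ∈ₚ.∈-filter⁺ P? (∈ₚ.∈-allFin _) p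

  select∋ : (P? : ∀ w → Dec (P w)) → ∀ {w} → w ∈ select P? → P w
  select∋ P? w∈ = proj₂ (∈ₚ.∈-filter⁻ P? {xs = List.allFin n} w∈)

-- The Alon-Tarsi form of Thomassen's theorem.

module Precoloured {n} (G : PlaneGraph n) (o : Fin (PlaneGraph.d G)) where
  open PlaneGraph G using (tail; rev; Adj; connected)
  open Separation G o using (Adj-sym; Adj-irrefl; Walk; stop; Walk-map; Walk-step; Walk-trans; Walk-sym; Walkable)
  open Planarity G o
  open Coefficients {n}
  open Enumerations {n}
  open Comprehension {n}

  _∈ˢ?_ : ∀ w (U : Subset n) → Dec (w ∈ˢ U)
  _∈ˢ?_ = Subsetₚ._∈?_

  Adj? : ∀ u v → Dec (Adj u v)
  Adj? u v = Finₚ.any? λ x → (tail x Finₚ.≟ u) ×-dec (tail (rev x) Finₚ.≟ v)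

  Adj⇒≢ : ∀ {u v} → Adj u v → u ≢ v
  Adj⇒≢ a refl = Adj-irrefl a

  Nbr : Subset n → Fin n → Set
  Nbr R = AdjTo (_∈ˢ R)

  Nbr? : ∀ R w → Dec (Nbr R w)
  Nbr? R w = Finₚ.any? λ r → (r ∈ˢ? R) ×-dec Adj? w r

  remove add : Subset n → Fin n → Subset n
  remove U v = ⟪ (λ w → (w ∈ˢ? U) ×-dec ¬? (w Finₚ.≟ v)) ⟫
  add R v = ⟪ (λ w → (w ∈ˢ? R) ⊎-dec (w Finₚ.≟ v)) ⟫

  module _ {U : Subset n} {v : Fin n} where
    ∈remove : ∀ {w} → w ∈ˢ U → w ≢ v → w ∈ˢ remove U v
    ∈remove w∈ w≢ = ∈⟪⟫ (λ w → (w ∈ˢ? U) ×-dec ¬? (w Finₚ.≟ v)) (w∈ , w≢)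

    remove∋ : ∀ {w} → w ∈ˢ remove U v → w ∈ˢ U × w ≢ v
    remove∋ = ⟪⟫∋ (λ w → (w ∈ˢ? U) ×-dec ¬? (w Finₚ.≟ v))

    remove-smaller : v ∈ˢ U → ∣ remove U v ∣ < ∣ U ∣
    remove-smaller v∈ = smaller (λ w → (w ∈ˢ? U) ×-dec ¬? (w Finₚ.≟ v)) proj₁ v∈ λ (_ , ≢) → ≢ refl

    ∈add : ∀ {w} → w ∈ˢ U ⊎ w ≡ v → w ∈ˢ add U v
    ∈add = ∈⟪⟫ (λ w → (w ∈ˢ? U) ⊎-dec (w Finₚ.≟ v))

    add∋ : ∀ {w} → w ∈ˢ add U v → w ∈ˢ U ⊎ w ≡ v
    add∋ = ⟪⟫∋ (λ w → (w ∈ˢ? U) ⊎-dec (w Finₚ.≟ v))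

    Nbr-add : ∀ {w} → Nbr U w → Nbr (add U v) w
    Nbr-add (r , r∈ , a) = r , ∈add (inj₁ r∈) , a

    Nbr-new : ∀ {w} → Adj w v → Nbr (add U v) w
    Nbr-new a = v , ∈add (inj₂ refl) , a

  -- `R` stands for the outer face. By `border` a vertex of `U` may have neighbours outside both
  -- sets if it is next to `R` anyway; thus a part cut off by a chord is again a setting with the
  -- same `R`.
  record Setting (U R : Subset n) : Set where
    field
      disjoint : ∀ {w} → w ∈ˢ U → ¬ w ∈ˢ R
      walkable : Walkable (_∈ˢ R)
      base     : ∃ (_∈ˢ R)
      border   : ∀ {u w} → u ∈ˢ U → Adj u w → ¬ w ∈ˢ U → Nbr R u

  -- The new `R` is connected through a neighbour of `v` in the old one, and every vertex that loses
  -- `v` as an inner neighbour gains it as a neighbour in `R`.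
  Setting-step : ∀ {U R v} → Setting U R → v ∈ˢ U → Nbr R v → Setting (remove U v) (add R v)
  Setting-step {U} {R} {v} S v∈U (r , r∈R , v~r) = record
    { disjoint = λ w∈ w∈′ → let w∈U , w≢v = remove∋ w∈ in [ disjoint w∈U , w≢v ]′ (add∋ w∈′)
    ; walkable = λ p q → Walk-trans (to-r (add∋ p)) (Walk-sym (to-r (add∋ q)))
    ; base = v , ∈add (inj₂ refl)
    ; border = border′ }
    where
    open Setting S
    to-r : ∀ {u} → u ∈ˢ R ⊎ u ≡ v → Walk (_∈ˢ add R v) u r
    to-r (inj₁ u∈)   = Walk-map (∈add ∘ inj₁) (walkable u∈ r∈R)
    to-r (inj₂ refl) = Walk-step (∈add (inj₂ refl)) v~r (stop (∈add (inj₁ r∈R)))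
    border′ : ∀ {u w} → u ∈ˢ remove U v → Adj u w → ¬ w ∈ˢ remove U v → Nbr (add R v) u
    border′ {u} {w} u∈ a w∉ with w Finₚ.≟ v
    ... | yes refl = Nbr-new a
    ... | no w≢v   = Nbr-add (border (proj₁ (remove∋ u∈)) a λ w∈ → w∉ (∈remove w∈ w≢v))

  record Bounded (U R : Subset n) (β : Exponent) : Set where
    field
      support : ∀ {w} → ¬ w ∈ˢ U → β w ≡ 0
      ≤four   : ∀ w → β w ≤ 4
      ≤two    : ∀ {w} → Nbr R w → β w ≤ 2

  -- The vertices of `us` are next to `R` once `v` has moved there, so the smaller region bounds
  -- them by 2. One more unit gives 3 and leaves room for another.
  bounded-star : ∀ {U R v us β} → Bounded (remove U v) (add R v) β → Unique us →
    (∀ {w} → w ∈ us → (w ∈ˢ U × Adj w v) × ¬ Nbr R w) → Bounded U R (raiseAll β us)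
  bounded-star {U} {R} {v} {us} {β} B unique us-ok = record
    { support = λ w∉ → trans (raiseAll-other β (w∉ ∘ proj₁ ∘ proj₁ ∘ us-ok)) (support (w∉ ∘ proj₁ ∘ remove∋))
    ; ≤four = four
    ; ≤two = λ nb → ℕₚ.≤-trans (ℕₚ.≤-reflexive (raiseAll-other β λ w∈ → proj₂ (us-ok w∈) nb)) (≤two (Nbr-add nb)) }
    where
    open Bounded B
    four : ∀ w → raiseAll β us w ≤ 4
    four w with Any.any? (w Finₚ.≟_) us
    ... | yes w∈ = ℕₚ.≤-trans (ℕₚ.≤-reflexive (raiseAll-∈ β unique w∈))
                     (s≤s (ℕₚ.≤-trans (≤two (Nbr-new (proj₂ (proj₁ (us-ok w∈))))) (ℕₚ.n≤1+n 2)))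
    ... | no w∉  = ℕₚ.≤-trans (ℕₚ.≤-reflexive (raiseAll-other β w∉)) (≤four w)

  bounded-raise : ∀ {U R β t} → Bounded U R β → t ∈ˢ U → β t ≤ 3 → (Nbr R t → β t ≤ 1) → Bounded U R (raise β t)
  bounded-raise {U} {R} {β} {t} B t∈ ≤3 ≤1 = record
    { support = λ w∉ → trans (raise-other β λ { refl → w∉ t∈ }) (support w∉)
    ; ≤four = λ w → pointwise w 4 (s≤s ≤3) (≤four w)
    ; ≤two = λ {w} nb → two nb (w Finₚ.≟ t) }
    where
    open Bounded B
    pointwise : ∀ w b → suc (β t) ≤ b → β w ≤ b → raise β t w ≤ b
    pointwise w b p q with w Finₚ.≟ t
    ... | yes refl = p
    ... | no _     = q
    two : ∀ {w} → Nbr R w → Dec (w ≡ t) → raise β t w ≤ 2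
    two nb (yes refl) = ℕₚ.≤-trans (ℕₚ.≤-reflexive (raise-same β t)) (s≤s (≤1 nb))
    two nb (no w≢t)   = ℕₚ.≤-trans (ℕₚ.≤-reflexive (raise-other β w≢t)) (≤two nb)

  Induced : Subset n → Relation
  Induced U a b = Adj a b × a ∈ˢ U × b ∈ˢ U

  Minus : Subset n → Fin n → Fin n → Relation
  Minus U v₁ v₂ a b = Induced U a b × ¬ Pair v₁ v₂ a b

  Induced-sym : ∀ {U a b} → Induced U a b → Induced U b a
  Induced-sym (p , a∈ , b∈) = Adj-sym p , b∈ , a∈

  Minus-sym : ∀ {U v₁ v₂ a b} → Minus U v₁ v₂ a b → Minus U v₁ v₂ b a
  Minus-sym (p , ≢) = Induced-sym p , λ
    { (inj₁ (q , r)) → ≢ (inj₂ (r , q)) ; (inj₂ (q , r)) → ≢ (inj₁ (r , q)) }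

  -- Exponents of the colouring theorem of Thomassen in its Alon–Tarsi form: lists of size
  -- 5 inside and of size 3 at the neighbours of R; Claim₁ and Claim₂ precolour one resp. two vertices.
  Claim : Subset n → Subset n → Set
  Claim U R = ∃ λ β → Bounded U R β × NZ (Induced U) β

  Claim₁ : Subset n → Subset n → Fin n → Set
  Claim₁ U R v = ∃ λ β → Bounded U R β × β v ≡ 0 × NZ (Induced U) β

  Claim₂ : Subset n → Subset n → Fin n → Fin n → Set
  Claim₂ U R v₁ v₂ = ∃ λ β → Bounded U R β × β v₁ ≡ 0 × β v₂ ≡ 0 × NZ (Minus U v₁ v₂) β

  removed-zero : ∀ {U R v β} → Bounded (remove U v) R β → β v ≡ 0
  removed-zero B = Bounded.support B λ v∈ → proj₂ (remove∋ v∈) refl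

  removed-avoid : ∀ {U v a b} → Induced (remove U v) a b → a ≢ v × b ≢ v
  removed-avoid (_ , a∈ , b∈) = proj₂ (remove∋ a∈) , proj₂ (remove∋ b∈)

  claim-empty : ∀ {U R} → (∀ {w} → ¬ w ∈ˢ U) → Claim U R
  claim-empty empty = (λ _ → 0) ,
    record { support = λ _ → refl ; ≤four = λ _ → z≤n ; ≤two = λ _ → z≤n } ,
    [] , Enum-[] (λ (_ , a∈ , _) → empty a∈) ,
    λ eq → contradiction (trans (sym (coeff-[]-zero (λ (_ : Fin n) → 0) λ _ → refl)) eq) λ ()

  module _ {U R : Subset n} {v : Fin n} (v∈ : v ∈ˢ U) where

    -- Exponent 0 at `v` makes the other end pay for each edge there, and since no such end is next
    -- to `R` only the bound 4 is at stake.
    claim₁-interior : (∀ {w} → w ∈ˢ U → Adj w v → ¬ Nbr R w) → Claim (remove U v) (add R v) → Claim₁ U R v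
    claim₁-interior inner (β , B , nz) = raiseAll β us ,
      bounded-star B (select-unique us?) (λ w∈ → let u∈ , a = select∋ us? w∈ in (u∈ , a) , inner u∈ a) ,
      trans (raiseAll-other β v∉us) (removed-zero B) ,
      NZ-resp from to (NZ-star (select-unique us?) v∉us (removed-zero B) (star-apart removed-avoid) nz)
      where
      us? = λ w → (w ∈ˢ? U) ×-dec Adj? w v
      us = select us?
      v∉us : v ∉ us
      v∉us p = Adj-irrefl (proj₂ (select∋ us? p))
      from : ∀ {a b} → (Star us v ∪ᴿ Induced (remove U v)) a b → Induced U a b
      from (inj₁ (inj₁ (a∈ , refl))) = let p , q = select∋ us? a∈ in q , p , v∈
      from (inj₁ (inj₂ (b∈ , refl))) = let p , q = select∋ us? b∈ in Adj-sym q , v∈ , p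
      from (inj₂ (p , a∈ , b∈)) = p , proj₁ (remove∋ a∈) , proj₁ (remove∋ b∈)
      to : ∀ {a b} → Induced U a b → (Star us v ∪ᴿ Induced (remove U v)) a b
      to {a} {b} (p , a∈ , b∈) with a Finₚ.≟ v | b Finₚ.≟ v
      ... | yes refl | _        = inj₁ (inj₂ (∈select us? (b∈ , Adj-sym p) , refl))
      ... | no _     | yes refl = inj₁ (inj₁ (∈select us? (a∈ , p) , refl))
      ... | no a≢    | no b≢    = inj₂ (p , ∈remove a∈ a≢ , ∈remove b∈ b≢)

    -- The edge between the two precoloured vertices is the one missing factor; `w` pays for it and
    -- rises from 0 to 1.
    claim₁-edge : ∀ {w} → w ∈ˢ U → Adj v w → Claim₂ U R v w → Claim₁ U R v
    claim₁-edge {w} w∈ a (β , B , βv , βw , nz) = raise β w ,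
      bounded-raise B w∈ (ℕₚ.≤-trans (ℕₚ.≤-reflexive βw) z≤n) (λ _ → ℕₚ.≤-trans (ℕₚ.≤-reflexive βw) z≤n) ,
      trans (raise-other β (Adj⇒≢ a)) βv ,
      NZ-resp from to (NZ-edge (Adj⇒≢ a ∘ sym) βv apart nz)
      where
      apart : Apart (Star (w ∷ []) v) (Minus U v w)
      apart (inj₁ (here refl , refl)) = (λ p → proj₂ p (inj₂ (refl , refl))) , (λ p → proj₂ p (inj₁ (refl , refl)))
      apart (inj₂ (here refl , refl)) = (λ p → proj₂ p (inj₁ (refl , refl))) , (λ p → proj₂ p (inj₂ (refl , refl)))
      from : ∀ {a b} → (Star (w ∷ []) v ∪ᴿ Minus U v w) a b → Induced U a b
      from (inj₁ (inj₁ (here refl , refl))) = Adj-sym a , w∈ , v∈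
      from (inj₁ (inj₂ (here refl , refl))) = a , v∈ , w∈
      from (inj₂ (p , _)) = p
      to : ∀ {a b} → Induced U a b → (Star (w ∷ []) v ∪ᴿ Minus U v w) a b
      to {x} {y} p with (x Finₚ.≟ v) ×-dec (y Finₚ.≟ w) | (x Finₚ.≟ w) ×-dec (y Finₚ.≟ v)
      ... | yes (refl , refl) | _ = inj₁ (inj₂ (here refl , refl))
      ... | no _ | yes (refl , refl) = inj₁ (inj₁ (here refl , refl))
      ... | no ≢ | no ≢′ = inj₂ (p , [ ≢ , ≢′ ]′)

    -- The edge from `v` to `v₂` is absent from this polynomial, so `v₂` keeps exponent 0 while all
    -- other neighbours of `v` pay.
    claim₂-interior : ∀ {v₂} → v₂ ∈ˢ U → Nbr R v₂ → Adj v v₂ →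
      (∀ {w} → w ∈ˢ U → Adj w v → w ≢ v₂ → ¬ Nbr R w) →
      Claim₁ (remove U v) (add R v) v₂ → Claim₂ U R v v₂
    claim₂-interior {v₂} v₂∈ nb₂ v~v₂ inner (β , B , βv₂ , nz) = raiseAll β us ,
      bounded-star B (select-unique us?)
        (λ w∈ → let (u∈ , a) , ≢ = select∋ us? w∈ in (u∈ , a) , inner u∈ a ≢) ,
      trans (raiseAll-other β v∉us) (removed-zero B) ,
      trans (raiseAll-other β v₂∉us) βv₂ ,
      NZ-resp from to (NZ-star (select-unique us?) v∉us (removed-zero B) (star-apart removed-avoid) nz)
      where
      us? = λ w → ((w ∈ˢ? U) ×-dec Adj? w v) ×-dec ¬? (w Finₚ.≟ v₂)
      us = select us?
      v∉us : v ∉ us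
      v∉us p = Adj-irrefl (proj₂ (proj₁ (select∋ us? p)))
      v₂∉us : v₂ ∉ us
      v₂∉us p = proj₂ (select∋ us? p) refl
      from : ∀ {a b} → (Star us v ∪ᴿ Induced (remove U v)) a b → Minus U v v₂ a b
      from (inj₁ (inj₁ (a∈ , refl))) = let (p , q) , ≢ = select∋ us? a∈ in
        (q , p , v∈) , [ (λ (e , _) → Adj⇒≢ q e) , (λ (e , _) → ≢ e) ]′
      from (inj₁ (inj₂ (b∈ , refl))) = let (p , q) , ≢ = select∋ us? b∈ in
        (Adj-sym q , v∈ , p) , [ (λ (_ , e) → ≢ e) , (λ (_ , e) → Adj⇒≢ q e) ]′
      from (inj₂ (p , a∈ , b∈)) = (p , proj₁ (remove∋ a∈) , proj₁ (remove∋ b∈)) ,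
        [ (λ (e , _) → proj₂ (remove∋ a∈) e) , (λ (_ , e) → proj₂ (remove∋ b∈) e) ]′
      to : ∀ {a b} → Minus U v v₂ a b → (Star us v ∪ᴿ Induced (remove U v)) a b
      to {a} {b} ((p , a∈ , b∈) , ≢) with a Finₚ.≟ v | b Finₚ.≟ v
      ... | yes refl | _ =
        inj₁ (inj₂ (∈select us? ((b∈ , Adj-sym p) , λ { refl → ≢ (inj₁ (refl , refl)) }) , refl))
      ... | no _ | yes refl =
        inj₁ (inj₁ (∈select us? ((a∈ , p) , λ { refl → ≢ (inj₂ (refl , refl)) }) , refl))
      ... | no a≢ | no b≢ = inj₂ (p , ∈remove a∈ a≢ , ∈remove b∈ b≢)

  edge-apart : ∀ {u v} {B : Relation} → ¬ B u v → ¬ B v u → Apart (Star (u ∷ []) v) B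
  edge-apart ¬p ¬q (inj₁ (here refl , refl)) = ¬p , ¬q
  edge-apart ¬p ¬q (inj₂ (here refl , refl)) = ¬q , ¬p

  -- As `v₁` has to keep exponent 0, `k` pays for the edge between them. Being next to `R`, `k` can
  -- afford one more unit, which is available for one further neighbour next to `R`.
  module Removal {U R v₁ v₂ k} (v₁∈ : v₁ ∈ˢ U) (nb₁ : Nbr R v₁) (v₂∈ : v₂ ∈ˢ U) (nb₂ : Nbr R v₂)
    (k∈ : k ∈ˢ U) (k~v₁ : Adj k v₁) (k≢v₂ : k ≢ v₂)
    {β : Exponent} (B : Bounded (remove U k) (add R k) β) (βv₁ : β v₁ ≡ 0) (βv₂ : β v₂ ≡ 0)
    {es : List Edge} (E : Enum (Minus (remove U k) v₁ v₂) es) (β≢0 : coeff es β ≢ + 0) where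

    private
      A = Minus (remove U k) v₁ v₂

      us? = λ w → ((w ∈ˢ? U) ×-dec Adj? w k) ×-dec ¬? (Nbr? R w)
      us = select us?

      F = raiseAll β us

      nb∉us : ∀ {w} → Nbr R w → w ∉ us
      nb∉us nb w∈ = proj₂ (select∋ us? w∈) nb

      k∉us : k ∉ us
      k∉us p = Adj-irrefl (proj₂ (proj₁ (select∋ us? p)))

      k≢v₁ : k ≢ v₁
      k≢v₁ = Adj⇒≢ k~v₁

      avoid : ∀ {a b} → A a b → a ≢ k × b ≢ k
      avoid (p , _) = removed-avoid p

      bounded : Bounded U R F
      bounded = bounded-star B (select-unique us?) (select∋ us?)

      βk : β k ≡ 0
      βk = removed-zero B

      F-nb : ∀ {w} → Nbr R w → F w ≡ β w
      F-nb nb = raiseAll-other β (nb∉us nb)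

      Fk : F k ≡ 0
      Fk = trans (raiseAll-other β k∉us) βk

      Base : Relation
      Base = Star us k ∪ᴿ A

      base : NZ Base F
      base = NZ-star (select-unique us?) k∉us βk (star-apart avoid) (es , E , β≢0)

      ¬base : ∀ {w} → w ≢ k → w ∉ us → ¬ Base k w × ¬ Base w k
      ¬base w≢k w∉ =
        [ [ (λ (p , _) → k∉us p) , (λ (p , _) → w∉ p) ]′ , (λ p → proj₁ (avoid p) refl) ]′ ,
        [ [ (λ (p , _) → w∉ p) , (λ (p , _) → k∉us p) ]′ , (λ p → proj₂ (avoid p) refl) ]′

      at-k : ∀ {w} → w ∈ˢ U → Adj w k → Minus U v₁ v₂ w k
      at-k w∈ a = (a , w∈ , k∈) , [ (λ (_ , e) → k≢v₂ e) , (λ (_ , e) → k≢v₁ e) ]′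

      base-in : ∀ {a b} → Base a b → Minus U v₁ v₂ a b
      base-in (inj₁ (inj₁ (a∈ , refl))) = let (p , q) , _ = select∋ us? a∈ in at-k p q
      base-in (inj₁ (inj₂ (b∈ , refl))) = let (p , q) , _ = select∋ us? b∈ in Minus-sym (at-k p q)
      base-in (inj₂ ((p , a∈ , b∈) , ≢)) = (p , proj₁ (remove∋ a∈) , proj₁ (remove∋ b∈)) , ≢

      edge-in : ∀ {w a b} → w ∈ˢ U → Adj w k → Star (k ∷ []) w a b → Minus U v₁ v₂ a b
      edge-in w∈ a (inj₁ (here refl , refl)) = Minus-sym (at-k w∈ a)
      edge-in w∈ a (inj₂ (here refl , refl)) = at-k w∈ a

      away-in : ∀ {a b} → Minus U v₁ v₂ a b → a ≢ k → b ≢ k → Base a b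
      away-in ((p , a∈ , b∈) , ≢) a≢ b≢ = inj₂ ((p , ∈remove a∈ a≢ , ∈remove b∈ b≢) , ≢)

      cover : ∀ {C : Relation} → (∀ {a b} → C a b → C b a) → (∀ {w} → w ∈ˢ U → Adj w k → C k w) →
        (∀ {a b} → Base a b → C a b) → ∀ {a b} → Minus U v₁ v₂ a b → C a b
      cover sym-C at inc {a} {b} m@((p , a∈ , b∈) , _) with a Finₚ.≟ k | b Finₚ.≟ k
      ... | yes refl | _        = at b∈ (Adj-sym p)
      ... | no _     | yes refl = sym-C (at a∈ p)
      ... | no a≢    | no b≢    = inc (away-in m a≢ b≢)

      star-sym : ∀ {ws v a b} → Star ws v a b → Star ws v b a
      star-sym (inj₁ p) = inj₂ p
      star-sym (inj₂ p) = inj₁ p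

      base-sym : ∀ {a b} → Base a b → Base b a
      base-sym (inj₁ p) = inj₁ (star-sym p)
      base-sym (inj₂ p) = inj₂ (Minus-sym p)

      Result : Set
      Result = Claim₂ U R v₁ v₂

      -- The raise at `k` is for the edge to `v₁`, the one at `t` for the edge to `y`. Either `t` is
      -- `k`, which reaches 2, or `t` lies in `us` and reaches at most 2 + 1 + 1.
      finish : ∀ {t} → t ≡ k ⊎ t ∈ us → NZ (Minus U v₁ v₂) (raise (raise F t) k) → Result
      finish {t} t-ok nz = raise (raise F t) k , bound t-ok ,
        zero-at t-ok nb₁ k≢v₁ βv₁ , zero-at t-ok nb₂ k≢v₂ βv₂ , nz
        where
        zero-at : ∀ {w} → t ≡ k ⊎ t ∈ us → Nbr R w → k ≢ w → β w ≡ 0 → raise (raise F t) k w ≡ 0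
        zero-at ok nb k≢w βw = trans (raise-other (raise F t) (k≢w ∘ sym)) (trans (raise-other F
          λ { refl → [ (λ eq → k≢w (sym eq)) , nb∉us nb ]′ ok }) (trans (F-nb nb) βw))
        bound : t ≡ k ⊎ t ∈ us → Bounded U R (raise (raise F t) k)
        bound (inj₁ refl) = bounded-raise
          (bounded-raise bounded k∈ (ℕₚ.≤-trans (ℕₚ.≤-reflexive Fk) z≤n) λ _ → ℕₚ.≤-trans (ℕₚ.≤-reflexive Fk) z≤n)
          k∈ (ℕₚ.≤-trans (ℕₚ.≤-reflexive one) (s≤s z≤n)) λ _ → ℕₚ.≤-reflexive one
          where
          one : raise F k k ≡ 1
          one = trans (raise-same F k) (cong suc Fk)
        bound (inj₂ t∈) = bounded-raise
          (bounded-raise bounded (proj₁ (proj₁ (select∋ us? t∈)))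
            (ℕₚ.≤-trans (ℕₚ.≤-reflexive (raiseAll-∈ β (select-unique us?) t∈))
              (s≤s (Bounded.≤two B (Nbr-new (proj₂ (proj₁ (select∋ us? t∈)))))))
            λ nb → ⊥-elim (nb∉us nb t∈))
          k∈ (ℕₚ.≤-trans (ℕₚ.≤-reflexive nought) z≤n) λ _ → ℕₚ.≤-trans (ℕₚ.≤-reflexive nought) z≤n
          where
          nought : raise F t k ≡ 0
          nought = trans (raise-other F λ { refl → k∉us t∈ }) Fk

    no-other : (∀ {w} → w ∈ˢ U → Adj w k → w ≢ v₁ → ¬ Nbr R w) → Claim₂ U R v₁ v₂
    no-other inner = raise F k ,
      bounded-raise bounded k∈ (ℕₚ.≤-trans (ℕₚ.≤-reflexive Fk) z≤n) (λ _ → ℕₚ.≤-trans (ℕₚ.≤-reflexive Fk) z≤n) ,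
      trans (raise-other F (k≢v₁ ∘ sym)) (trans (F-nb nb₁) βv₁) ,
      trans (raise-other F (k≢v₂ ∘ sym)) (trans (F-nb nb₂) βv₂) ,
      NZ-resp [ edge-in v₁∈ (Adj-sym k~v₁) , base-in ]′
        (cover [ inj₁ ∘ star-sym , inj₂ ∘ base-sym ]′ at inj₂)
        (NZ-edge k≢v₁ (trans (F-nb nb₁) βv₁)
          (edge-apart (proj₁ (¬base (k≢v₁ ∘ sym) (nb∉us nb₁))) (proj₂ (¬base (k≢v₁ ∘ sym) (nb∉us nb₁)))) base)
      where
      at : ∀ {w} → w ∈ˢ U → Adj w k → (Star (k ∷ []) v₁ ∪ᴿ Base) k w
      at {w} w∈ a with w Finₚ.≟ v₁
      ... | yes refl = inj₁ (inj₁ (here refl , refl))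
      ... | no w≢    = inj₂ (inj₁ (inj₂ (∈select us? ((w∈ , a) , inner w∈ a w≢) , refl)))

    module _ {y} (y∈ : y ∈ˢ U) (y~k : Adj y k) (nby : Nbr R y) (y≢v₁ : y ≢ v₁)
      (inner : ∀ {w} → w ∈ˢ U → Adj w k → w ≢ v₁ → w ≢ y → ¬ Nbr R w) where

      private
        y≢k : y ≢ k
        y≢k = Adj⇒≢ y~k

        WithY : Relation
        WithY = Star (k ∷ []) y ∪ᴿ Base

        full-in : ∀ {a b} → (Star (k ∷ []) v₁ ∪ᴿ WithY) a b → Minus U v₁ v₂ a b
        full-in = [ edge-in v₁∈ (Adj-sym k~v₁) , [ edge-in y∈ y~k , base-in ]′ ]′

        in-full : ∀ {a b} → Minus U v₁ v₂ a b → (Star (k ∷ []) v₁ ∪ᴿ WithY) a b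
        in-full = cover [ inj₁ ∘ star-sym , inj₂ ∘ [ inj₁ ∘ star-sym , inj₂ ∘ base-sym ]′ ]′ at (inj₂ ∘ inj₂)
          where
          at : ∀ {w} → w ∈ˢ U → Adj w k → (Star (k ∷ []) v₁ ∪ᴿ WithY) k w
          at {w} w∈ a with w Finₚ.≟ v₁ | w Finₚ.≟ y
          ... | yes refl | _        = inj₁ (inj₁ (here refl , refl))
          ... | no _     | yes refl = inj₂ (inj₁ (inj₁ (here refl , refl)))
          ... | no w≢    | no w≢y   = inj₂ (inj₂ (inj₁ (inj₂ (∈select us? ((w∈ , a) , inner w∈ a w≢ w≢y) , refl))))

        apart-y : Apart (Star (k ∷ []) y) Base
        apart-y = edge-apart (proj₁ (¬base y≢k (nb∉us nby))) (proj₂ (¬base y≢k (nb∉us nby)))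

        apart-v₁ : Apart (Star (k ∷ []) v₁) WithY
        apart-v₁ = edge-apart {B = WithY}
          [ [ (λ (_ , e) → y≢v₁ (sym e)) , (λ { (here e , _) → k≢v₁ (sym e) }) ]′ ,
            proj₁ (¬base (k≢v₁ ∘ sym) (nb∉us nb₁)) ]′
          [ [ (λ { (here e , _) → k≢v₁ (sym e) }) , (λ (_ , e) → y≢v₁ (sym e)) ]′ ,
            proj₂ (¬base (k≢v₁ ∘ sym) (nb∉us nb₁)) ]′

        complete : ∀ {γ} → γ v₁ ≡ 0 → NZ WithY γ → NZ (Minus U v₁ v₂) (raise γ k)
        complete γv₁ nz = NZ-resp full-in in-full (NZ-edge k≢v₁ γv₁ apart-v₁ nz)

        transfer : Fin n → Exponent
        transfer = raise (lower β y)

        -- Here `y` pays for its edge to `k`. In the starting monomial `y` is lowered by one and `u`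
        -- raised by one; the payment restores `y`, and the extra unit ends up at `u`, which can
        -- afford it.
        via-star : ∀ {u} → u ∈ us → β y ≢ 0 → coeff es (transfer u) ≢ + 0 → Claim₂ U R v₁ v₂
        via-star {u} u∈ βy≢0 ≢0 = finish (inj₂ u∈) (NZ-cong final (complete Nv₁
          (NZ-resp (λ { (inj₁ p) → inj₁ (turn p) ; (inj₂ p) → inj₂ p })
                   (λ { (inj₁ p) → inj₁ (turn p) ; (inj₂ p) → inj₂ p })
            (NZ-edge y≢k (trans (raiseAll-other N k∉us) Nk)
              (edge-apart (proj₂ (¬base y≢k (nb∉us nby))) (proj₁ (¬base y≢k (nb∉us nby))))
              (NZ-star (select-unique us?) k∉us Nk (star-apart avoid) (es , E , ≢0))))))
          where
          γ = lower β y
          N = transfer u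
          turn : ∀ {u v a b} → Star (u ∷ []) v a b → Star (v ∷ []) u a b
          turn (inj₁ (here refl , refl)) = inj₂ (here refl , refl)
          turn (inj₂ (here refl , refl)) = inj₁ (here refl , refl)
          Nk : N k ≡ 0
          Nk = trans (raise-other γ λ { refl → k∉us u∈ }) (trans (lower-other β (y≢k ∘ sym)) βk)
          Nv₁ : raise (raiseAll N us) y v₁ ≡ 0
          Nv₁ = trans (raise-other (raiseAll N us) (y≢v₁ ∘ sym)) (trans (raiseAll-other N (nb∉us nb₁))
            (trans (raise-other γ λ { refl → nb∉us nb₁ u∈ }) (trans (lower-other β (y≢v₁ ∘ sym)) βv₁)))
          swap-in : raise (raiseAll N us) y ≐ raise F u
          swap-in w = trans (raise-cong (raiseAll-raise γ u us) y w)
            (trans (raise-comm (raiseAll γ us) u y w)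
              (raise-cong (λ x → trans (sym (raiseAll-raise γ y us x)) (raiseAll-cong (λ z → sym (raise-lower β y βy≢0 z)) us x)) u w))
            where
            raiseAll-cong : ∀ {e f} → e ≐ f → ∀ ws → raiseAll e ws ≐ raiseAll f ws
            raiseAll-cong eq []       = eq
            raiseAll-cong eq (x ∷ ws) = raise-cong (raiseAll-cong eq ws) x
          final : raise (raise (raiseAll N us) y) k ≐ raise (raise F u) k
          final = raise-cong swap-in k

        via-k : (β y ≢ 0 → All (λ u → coeff es (transfer u) ≡ + 0) us) → Claim₂ U R v₁ v₂
        via-k vanishing = finish (inj₁ refl) (complete
          (trans (raise-other F (k≢v₁ ∘ sym)) (trans (F-nb nb₁) βv₁))
          (NZ-leak (select-unique us?) k∉us βk y≢k (nb∉us nby) avoid apart-y E β≢0 vanishing))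

      -- Zhu's case distinction: either some monomial of the smaller graph lets y absorb its edge to k,
      -- or the coefficient obtained by letting k absorb it cannot cancel.
      one-other : Claim₂ U R v₁ v₂
      one-other with y Finₚ.≟ v₂
      -- At `v₂` the exponent is 0, so `k` pays for this edge and there is no competing term.
      ... | yes refl = finish (inj₁ refl) (complete
              (trans (raise-other F (k≢v₁ ∘ sym)) (trans (F-nb nb₁) βv₁))
              (NZ-edge k≢v₂ (trans (F-nb nb₂) βv₂) apart-y base))
      ... | no _ with β y Nat.≟ 0
      ...   | yes βy≡0 = via-k λ ≢0 → ⊥-elim (≢0 βy≡0)
      ...   | no βy≢0 with Any.any? (λ u → ¬? (coeff es (transfer u) ℤₚ.≟ + 0)) us
      ...     | yes some = let u , u∈ , ≢0 = find some in via-star u∈ βy≢0 ≢0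
      ...     | no none  = via-k λ _ → All.map (λ {u} ¬¬z → decidable-stable (coeff es (transfer u) ℤₚ.≟ + 0) ¬¬z)
                             (Allₚ.¬Any⇒All¬ us none)

  module Splitting {U R x b} (S : Setting U R) (x∈ : x ∈ˢ U) (nbx : Nbr R x) (b∈ : b ∈ˢ U) (nbb : Nbr R b)
    (x~b : Adj x b) where
    open Setting S

    module Part {p : Fin n → Set} (p? : ∀ w → Dec (p w)) where
      In : Fin n → Set
      In w = w ∈ˢ U × ((w ≡ x ⊎ w ≡ b) ⊎ p w)

      In? : ∀ w → Dec (In w)
      In? w = (w ∈ˢ? U) ×-dec (((w Finₚ.≟ x) ⊎-dec (w Finₚ.≟ b)) ⊎-dec p? w)

      part : Subset n
      part = ⟪ In? ⟫

      Closed : Set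
      Closed = ∀ {w w′} → w ∈ˢ U → w′ ∈ˢ U → Adj w w′ → ¬ (w ≡ x ⊎ w ≡ b) → ¬ (w′ ≡ x ⊎ w′ ≡ b) → p w → p w′

      -- Among the vertices of the part only the chord ends have neighbours in the rest of `U`, and
      -- they are next to `R`; so the same `R` serves the part.
      setting : Closed → Setting part R
      setting closed = record
        { disjoint = disjoint ∘ proj₁ ∘ ⟪⟫∋ In? ; walkable = walkable ; base = base ; border = border′ }
        where
        border′ : ∀ {u w} → u ∈ˢ part → Adj u w → ¬ w ∈ˢ part → Nbr R u
        border′ {u} {w} u∈ a w∉ with w ∈ˢ? U | ⟪⟫∋ In? u∈
        ... | no w∉U | u∈U , _ = border u∈U a w∉U
        ... | yes _  | _ , inj₁ (inj₁ refl) = nbx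
        ... | yes _  | _ , inj₁ (inj₂ refl) = nbb
        ... | yes w∈U | u∈U , inj₂ pu with (u Finₚ.≟ x) ⊎-dec (u Finₚ.≟ b)
        ...   | yes (inj₁ refl) = nbx
        ...   | yes (inj₂ refl) = nbb
        ...   | no u≢ = ⊥-elim (w∉ (∈⟪⟫ In? (w∈U ,
                  (case (w Finₚ.≟ x) ⊎-dec (w Finₚ.≟ b) of λ
                    { (yes eq) → inj₁ eq ; (no w≢) → inj₂ (closed u∈U w∈U a u≢ w≢ pu) }))))

    module _ {p q : Fin n → Set} (p? : ∀ w → Dec (p w)) (q? : ∀ w → Dec (q w))
      (either : ∀ w → p w ⊎ q w) (not-both : ∀ {w} → p w → ¬ q w)
      (p-closed : Part.Closed p?) (q-closed : Part.Closed q?) where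

      private
        module P = Part p?
        module Q = Part q?

      together : ∀ {w w′} → Induced U w w′ → (P.In w × P.In w′) ⊎ (Q.In w × Q.In w′)
      together {w} {w′} (a , w∈ , w′∈)
        with (w Finₚ.≟ x) ⊎-dec (w Finₚ.≟ b) | (w′ Finₚ.≟ x) ⊎-dec (w′ Finₚ.≟ b) | either w | either w′
      ... | yes e | _ | _ | inj₁ pw′ = inj₁ ((w∈ , inj₁ e) , (w′∈ , inj₂ pw′))
      ... | yes e | _ | _ | inj₂ qw′ = inj₂ ((w∈ , inj₁ e) , (w′∈ , inj₂ qw′))
      ... | no _  | yes e | inj₁ pw | _ = inj₁ ((w∈ , inj₂ pw) , (w′∈ , inj₁ e))
      ... | no _  | yes e | inj₂ qw | _ = inj₂ ((w∈ , inj₂ qw) , (w′∈ , inj₁ e))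
      ... | no w≢ | no w′≢ | inj₁ pw | _ = inj₁ ((w∈ , inj₂ pw) , (w′∈ , inj₂ (p-closed w∈ w′∈ a w≢ w′≢ pw)))
      ... | no w≢ | no w′≢ | inj₂ qw | _ = inj₂ ((w∈ , inj₂ qw) , (w′∈ , inj₂ (q-closed w∈ w′∈ a w≢ w′≢ qw)))

      -- The edge of the chord lies in both parts and is left to the first. The second claim is
      -- about the polynomial without that edge and has exponent 0 at the chord ends, so `γ` uses
      -- only variables private to the second part.
      combine : ∀ {v₁ v₂} → P.In v₁ → P.In v₂ →
        Claim₂ P.part R v₁ v₂ → Claim₂ Q.part R x b → Claim₂ U R v₁ v₂
      combine {v₁} {v₂} v₁∈ v₂∈ (β , B , βv₁ , βv₂ , es , E , β≢0) (γ , C , γx , γb , fs , F , γ≢0) =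
        (λ w → β w Nat.+ γ w) , bounded , both-zero v₁∈ βv₁ , both-zero v₂∈ βv₂ ,
        fs ++ es , Enum-resp from to (Enum-++ apart F E) ,
        product-nonzero X {es} {fs} {β} {γ} (All.tabulate λ e∈ → avoids (Enum.sound E e∈)) β-out γ-in β≢0 γ≢0
        where
        X? : ∀ w → Dec (Q.In w × ¬ (w ≡ x ⊎ w ≡ b))
        X? w = Q.In? w ×-dec ¬? ((w Finₚ.≟ x) ⊎-dec (w Finₚ.≟ b))
        X : Fin n → Bool
        X w = does (X? w)
        in-both : ∀ {w} → P.In w → Q.In w → w ≡ x ⊎ w ≡ b
        in-both (_ , inj₁ e) _ = e
        in-both _ (_ , inj₁ e) = e
        in-both (_ , inj₂ pw) (_ , inj₂ qw) = ⊥-elim (not-both pw qw)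
        P-off : ∀ {w} → P.In w → X w ≡ false
        P-off {w} p = dec-false (X? w) λ (q , ≢) → ≢ (in-both p q)
        avoids : ∀ {u v} → Minus P.part v₁ v₂ u v → X u ≡ false × X v ≡ false
        avoids ((_ , u∈ , v∈) , _) = P-off (⟪⟫∋ P.In? u∈) , P-off (⟪⟫∋ P.In? v∈)
        β-out : ∀ w → X w ≡ true → β w ≡ 0
        β-out w eq = Bounded.support B λ w∈ →
          contradiction (trans (sym eq) (P-off (⟪⟫∋ P.In? w∈))) λ ()
        γ-zero : ∀ {w} → ¬ (Q.In w × ¬ (w ≡ x ⊎ w ≡ b)) → γ w ≡ 0
        γ-zero {w} ∉X with (w Finₚ.≟ x) ⊎-dec (w Finₚ.≟ b)
        ... | yes (inj₁ refl) = γx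
        ... | yes (inj₂ refl) = γb
        ... | no ≢ = Bounded.support C λ w∈ → ∉X (⟪⟫∋ Q.In? w∈ , ≢)
        γ-in : ∀ w → X w ≡ false → γ w ≡ 0
        γ-in w eq = γ-zero λ p → contradiction (trans (sym eq) (dec-true (X? w) p)) λ ()
        sum-is : ∀ w → (β w Nat.+ γ w ≡ β w) ⊎ (β w Nat.+ γ w ≡ γ w)
        sum-is w with X? w
        ... | yes p = inj₂ (cong (Nat._+ γ w) (β-out w (dec-true (X? w) p)))
        ... | no ¬p = inj₁ (trans (cong (β w Nat.+_) (γ-zero ¬p)) (ℕₚ.+-identityʳ (β w)))
        below : ∀ {m} w → β w ≤ m → γ w ≤ m → β w Nat.+ γ w ≤ m
        below w p q = [ (λ e → ℕₚ.≤-trans (ℕₚ.≤-reflexive e) p) , (λ e → ℕₚ.≤-trans (ℕₚ.≤-reflexive e) q) ]′ (sum-is w)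
        bounded : Bounded U R (λ w → β w Nat.+ γ w)
        bounded = record
          { support = λ w∉ → cong₂ Nat._+_ (Bounded.support B (w∉ ∘ proj₁ ∘ ⟪⟫∋ P.In?))
                                           (Bounded.support C (w∉ ∘ proj₁ ∘ ⟪⟫∋ Q.In?))
          ; ≤four = λ w → below w (Bounded.≤four B w) (Bounded.≤four C w)
          ; ≤two = λ {w} nb → below w (Bounded.≤two B nb) (Bounded.≤two C nb) }
        both-zero : ∀ {w} → P.In w → β w ≡ 0 → β w Nat.+ γ w ≡ 0
        both-zero w∈ βw = cong₂ Nat._+_ βw (γ-zero λ (q , ≢) → ≢ (in-both w∈ q))
        pair-xb : ∀ {u v} → Induced P.part u v → Induced Q.part u v → Pair x b u v
        pair-xb (a , pu , pv) (_ , qu , qv)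
          with in-both (⟪⟫∋ P.In? pu) (⟪⟫∋ Q.In? qu) | in-both (⟪⟫∋ P.In? pv) (⟪⟫∋ Q.In? qv)
        ... | inj₁ refl | inj₁ refl = ⊥-elim (Adj-irrefl a)
        ... | inj₁ refl | inj₂ refl = inj₁ (refl , refl)
        ... | inj₂ refl | inj₁ refl = inj₂ (refl , refl)
        ... | inj₂ refl | inj₂ refl = ⊥-elim (Adj-irrefl a)
        apart : Apart (Minus Q.part x b) (Minus P.part v₁ v₂)
        apart (q , ≢) = (λ (p , _) → ≢ (pair-xb p q)) , (λ (p , _) → ≢ (pair-xb (Induced-sym p) q))
        from : ∀ {u v} → (Minus Q.part x b ∪ᴿ Minus P.part v₁ v₂) u v → Minus U v₁ v₂ u v
        from (inj₂ ((a , u∈ , v∈) , ≢)) = (a , proj₁ (⟪⟫∋ P.In? u∈) , proj₁ (⟪⟫∋ P.In? v∈)) , ≢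
        from (inj₁ (q@(a , u∈ , v∈) , ≢)) = (a , proj₁ (⟪⟫∋ Q.In? u∈) , proj₁ (⟪⟫∋ Q.In? v∈)) ,
          [ (λ { (refl , refl) → ≢ (pair-xb (a , ∈⟪⟫ P.In? v₁∈ , ∈⟪⟫ P.In? v₂∈) q) }) ,
            (λ { (refl , refl) → ≢ (pair-xb (a , ∈⟪⟫ P.In? v₂∈ , ∈⟪⟫ P.In? v₁∈) q) }) ]′
        to : ∀ {u v} → Minus U v₁ v₂ u v → (Minus Q.part x b ∪ᴿ Minus P.part v₁ v₂) u v
        to {u} {v} (i@(a , _ , _) , ≢) with together i
        ... | inj₁ (pu , pv) = inj₂ ((a , ∈⟪⟫ P.In? pu , ∈⟪⟫ P.In? pv) , ≢)
        ... | inj₂ (qu@(u∈ , _) , qv@(v∈ , _))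
              with ((u Finₚ.≟ x) ×-dec (v Finₚ.≟ b)) ⊎-dec ((u Finₚ.≟ b) ×-dec (v Finₚ.≟ x))
        ...   | no ≢xb = inj₁ ((a , ∈⟪⟫ Q.In? qu , ∈⟪⟫ Q.In? qv) , ≢xb)
        ...   | yes (inj₁ (eu , ev)) =
                  inj₂ ((a , ∈⟪⟫ P.In? (u∈ , inj₁ (inj₁ eu)) , ∈⟪⟫ P.In? (v∈ , inj₁ (inj₂ ev))) , ≢)
        ...   | yes (inj₂ (eu , ev)) =
                  inj₂ ((a , ∈⟪⟫ P.In? (u∈ , inj₁ (inj₂ eu)) , ∈⟪⟫ P.In? (v∈ , inj₁ (inj₁ ev))) , ≢)

  -- If no vertex of `U` is next to `R`, then `U` is closed under adjacency; `G` being connected, a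
  -- nonempty `U` would swallow the base vertex of `R`.
  claim-by : ∀ {U R} → Setting U R → (∀ {v} → v ∈ˢ U → Nbr R v → Claim₁ U R v) → Claim U R
  claim-by {U} {R} S from with Finₚ.any? (λ w → (w ∈ˢ? U) ×-dec Nbr? R w)
  ... | yes (v , v∈ , nb) = let β , B , _ , nz = from v∈ nb in β , B , nz
  ... | no none = claim-empty λ w∈ → Setting.disjoint S
          (closed (connected _ (proj₁ (Setting.base S))) w∈) (proj₂ (Setting.base S))
    where
    closed : ∀ {u v} → Reach tail rev u v → u ∈ˢ U → v ∈ˢ U
    closed here u∈ = u∈
    closed (step x refl r) u∈ with tail (rev x) ∈ˢ? U
    ... | yes w∈ = closed r w∈
    ... | no w∉  = ⊥-elim (none (_ , u∈ , Setting.border S u∈ (x , refl , refl) w∉))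

  claim₁-by : ∀ {U R v} → v ∈ˢ U → (∀ {w} → w ∈ˢ U → Nbr R w → Adj v w → Claim₂ U R v w) →
    Claim (remove U v) (add R v) → Claim₁ U R v
  claim₁-by {U} {R} {v} v∈ precoloured smaller
    with Finₚ.any? (λ w → ((w ∈ˢ? U) ×-dec Adj? w v) ×-dec Nbr? R w)
  ... | yes (w , (w∈ , a) , nbw) = claim₁-edge v∈ w∈ (Adj-sym a) (precoloured w∈ nbw (Adj-sym a))
  ... | no none = claim₁-interior v∈ (λ w∈ a nbw → none (_ , (w∈ , a) , nbw)) smaller

  mutual
    -- On one and the same set the calls go from `claim` to `claim₁` to `claim₂`; every call that
    -- repeats a claim or goes back in this order is on a smaller set and lowers `m`.
    claim : ∀ m {U R} → Setting U R → ∣ U ∣ < m → Claim U R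
    claim m S U<m = claim-by S λ v∈ nb → claim₁ m S v∈ nb U<m

    claim₁ : ∀ m {U R v} → Setting U R → v ∈ˢ U → Nbr R v → ∣ U ∣ < m → Claim₁ U R v
    claim₁ (suc m) S v∈ nb U<m = claim₁-by v∈
      (λ w∈ nbw a → claim₂ (suc m) S v∈ nb w∈ nbw a U<m)
      (claim m (Setting-step S v∈ nb) (ℕₚ.≤-trans (remove-smaller v∈) (ℕₚ.≤-pred U<m)))

    -- If `v₂` is the only neighbour of `v₁` in `U` next to `R`, then `v₁` is removed. Otherwise
    -- take another such neighbour `k`. With at most one more neighbour next to `R` besides `v₁`,
    -- `k` can be removed; with two, `k` has three neighbours next to `R`, and the middle one is the
    -- other end of a separating chord.
    claim₂ : ∀ m {U R v₁ v₂} → Setting U R → v₁ ∈ˢ U → Nbr R v₁ → v₂ ∈ˢ U → Nbr R v₂ → Adj v₁ v₂ →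
      ∣ U ∣ < m → Claim₂ U R v₁ v₂
    claim₂ (suc m) {U} {R} {v₁} {v₂} S v₁∈ nb₁ v₂∈ nb₂ v₁~v₂ (s≤s U≤m)
      with Finₚ.any? (λ k → (((k ∈ˢ? U) ×-dec Adj? k v₁) ×-dec Nbr? R k) ×-dec ¬? (k Finₚ.≟ v₂))
    ... | no none = claim₂-interior v₁∈ v₂∈ nb₂ v₁~v₂
            (λ w∈ a w≢ nbw → none (_ , ((w∈ , a) , nbw) , w≢))
            (claim₁ m (Setting-step S v₁∈ nb₁) (∈remove v₂∈ (Adj⇒≢ v₁~v₂ ∘ sym)) (Nbr-add nb₂)
              (ℕₚ.≤-trans (remove-smaller v₁∈) U≤m))
    ... | yes (k , ((k∈ , k~v₁) , nbk) , k≢v₂) = by-others (select others?) refl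
      where
      others? = λ w → (((w ∈ˢ? U) ×-dec Adj? w k) ×-dec Nbr? R w) ×-dec ¬? (w Finₚ.≟ v₁)

      recurse : Claim₂ (remove U k) (add R k) v₁ v₂
      recurse = claim₂ m (Setting-step S k∈ nbk) (∈remove v₁∈ (Adj⇒≢ k~v₁ ∘ sym)) (Nbr-add nb₁)
        (∈remove v₂∈ (k≢v₂ ∘ sym)) (Nbr-add nb₂) v₁~v₂ (ℕₚ.≤-trans (remove-smaller k∈) U≤m)

      Candidate : Fin n → Set
      Candidate w = (w ∈ˢ U × Adj k w) × Nbr R w

      -- The part containing the edge of `v₁` and `v₂` keeps it as its precoloured pair; in the
      -- other part the chord takes that role. One part misses `right`, the other `left`, so both
      -- are smaller than `U`.
      chord : ChordSplit (Setting.walkable S) (Setting.disjoint S k∈) nbk Candidate → Claim₂ U R v₁ v₂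
      chord C = [ (λ (p₁ , p₂) → combine P? Q? either (λ p q → q p) P-closed Q-closed p₁ p₂
                     (claim₂ m (P.setting P-closed) (∈⟪⟫ P.In? p₁) nb₁ (∈⟪⟫ P.In? p₂) nb₂ v₁~v₂ P<m) (Q-chord)) ,
                  (λ (q₁ , q₂) → combine Q? P? (λ w → [ inj₂ , inj₁ ]′ (either w)) (λ q p → q p) Q-closed P-closed q₁ q₂
                     (claim₂ m (Q.setting Q-closed) (∈⟪⟫ Q.In? q₁) nb₁ (∈⟪⟫ Q.In? q₂) nb₂ v₁~v₂ Q<m) (P-chord)) ]′
                (together P? Q? either (λ p q → q p) P-closed Q-closed (v₁~v₂ , v₁∈ , v₂∈))
        where
        open ChordSplit C
        mid∈ = proj₁ (proj₁ P-mid)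
        k~mid = proj₂ (proj₁ P-mid)
        open Splitting S k∈ nbk mid∈ (proj₂ P-mid) k~mid
        P? : ∀ w → Dec (colour w ≡ colour left)
        P? w = colour w ℤₚ.≟ colour left
        Q? : ∀ w → Dec (¬ colour w ≡ colour left)
        Q? w = ¬? (P? w)
        module P = Part P?
        module Q = Part Q?
        either : ∀ w → colour w ≡ colour left ⊎ ¬ colour w ≡ colour left
        either w with P? w
        ... | yes p = inj₁ p
        ... | no q  = inj₂ q
        same : ∀ {w w′} → w ∈ˢ U → w′ ∈ˢ U → Adj w w′ → ¬ (w ≡ k ⊎ w ≡ mid) → ¬ (w′ ≡ k ⊎ w′ ≡ mid) →
          colour w ≡ colour w′
        same w∈ w′∈ a w≢ w′≢ = joined a (Setting.disjoint S w∈) (Setting.disjoint S w′∈)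
          (w≢ ∘ inj₁) (w′≢ ∘ inj₁) (w≢ ∘ inj₂) (w′≢ ∘ inj₂)
        P-closed : P.Closed
        P-closed w∈ w′∈ a w≢ w′≢ p = trans (sym (same w∈ w′∈ a w≢ w′≢)) p
        Q-closed : Q.Closed
        Q-closed w∈ w′∈ a w≢ w′≢ q p = q (trans (same w∈ w′∈ a w≢ w′≢) p)
        off : ∀ {w} → Candidate w → mid ≢ w → ¬ (w ≡ k ⊎ w ≡ mid)
        off ((_ , a) , _) mid≢ = [ (λ e → Adj⇒≢ a (sym e)) , (λ e → mid≢ (sym e)) ]′
        P<m : ∣ P.part ∣ < m
        P<m = ℕₚ.≤-trans (smaller P.In? proj₁ (proj₁ (proj₁ P-right)) λ (_ , p) →
          [ off P-right mid≢right , apart ∘ sym ]′ p) U≤m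
        Q<m : ∣ Q.part ∣ < m
        Q<m = ℕₚ.≤-trans (smaller Q.In? proj₁ (proj₁ (proj₁ P-left)) λ (_ , p) →
          [ off P-left mid≢left , (λ ≢ → ≢ refl) ]′ p) U≤m
        P-chord : Claim₂ P.part R k mid
        P-chord = claim₂ m (P.setting P-closed) (∈⟪⟫ P.In? (k∈ , inj₁ (inj₁ refl))) nbk
          (∈⟪⟫ P.In? (mid∈ , inj₁ (inj₂ refl))) (proj₂ P-mid) k~mid P<m
        Q-chord : Claim₂ Q.part R k mid
        Q-chord = claim₂ m (Q.setting Q-closed) (∈⟪⟫ Q.In? (k∈ , inj₁ (inj₁ refl))) nbk
          (∈⟪⟫ Q.In? (mid∈ , inj₁ (inj₂ refl))) (proj₂ P-mid) k~mid Q<m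

      by-others : ∀ ys → select others? ≡ ys → Claim₂ U R v₁ v₂
      by-others [] eq = let β , B , β₁ , β₂ , es , E , ≢0 = recurse in
        Removal.no-other v₁∈ nb₁ v₂∈ nb₂ k∈ k~v₁ k≢v₂ B β₁ β₂ E ≢0
          λ w∈ a w≢ nbw → case subst (_ ∈_) eq (∈select others? (((w∈ , a) , nbw) , w≢)) of λ ()
      by-others (y ∷ []) eq = let β , B , β₁ , β₂ , es , E , ≢0 = recurse
                                  ((y∈ , a) , nby) , y≢ = select∋ others? (subst (y ∈_) (sym eq) (here refl)) in
        Removal.one-other v₁∈ nb₁ v₂∈ nb₂ k∈ k~v₁ k≢v₂ B β₁ β₂ E ≢0 y∈ a nby y≢
          λ w∈ a w≢ w≢y nbw → case subst (_ ∈_) eq (∈select others? (((w∈ , a) , nbw) , w≢)) of λ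
            { (here refl) → w≢y refl }
      by-others (y ∷ z ∷ ys) eq =
        let ((y∈ , ya) , nby) , y≢ = select∋ others? (subst (y ∈_) (sym eq) (here refl))
            ((z∈ , za) , nbz) , z≢ = select∋ others? (subst (z ∈_) (sym eq) (there (here refl)))
            disjoint = λ {w} (w∈ : w ∈ˢ U) → Setting.disjoint S w∈
        in chord (chord-split (Setting.walkable S) (disjoint k∈) nbk Candidate k~v₁ (Adj-sym ya) (Adj-sym za)
             (disjoint v₁∈) (disjoint y∈) (disjoint z∈) nb₁ nby nbz
             ((v₁∈ , k~v₁) , nb₁) ((y∈ , Adj-sym ya) , nby) ((z∈ , Adj-sym za) , nbz)
             (y≢ ∘ sym) (y≢z eq) (z≢ ∘ sym))
        where
        y≢z : select others? ≡ y ∷ z ∷ ys → y ≢ z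
        y≢z eq with subst Unique eq (select-unique others?)
        ... | (≢ ∷ _) ∷ _ = ≢

-- Regions inside a closed curve: reduction steps and components.

module Regions {n} (G : PlaneGraph n) (o : Fin (PlaneGraph.d G)) where
  open PlaneGraph G using (Adj)
  open Separation G o using (Adj-sym; Walk-map; Walkable)
  open Planarity G o
  open Coefficients {n}
  open Enumerations {n}
  open Comprehension {n}
  open Precoloured G o

  Meeting : Subset n → Relation
  Meeting U a b = Adj a b × (a ∈ˢ U ⊎ b ∈ˢ U)

  record Goal (U : Subset n) : Set where
    constructor goal
    field
      exponent : Exponent
      support  : ∀ {w} → ¬ w ∈ˢ U → exponent w ≡ 0
      ≤four    : ∀ w → exponent w ≤ 4
      nonzero  : NZ (Meeting U) exponent

  -- `Ks` has to contain the outside neighbours of `U` but may contain more, so it can be a whole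
  -- cycle even where `U` does not touch it.
  record Region (U : Subset n) (Ks : List (Fin n)) : Set where
    field
      free   : ∀ {k} → k ∈ Ks → ¬ k ∈ˢ U
      around : ∀ {w x} → w ∈ˢ U → Adj w x → ¬ x ∈ˢ U → x ∈ Ks

  count : Fin n → List (Fin n) → ℕ
  count w ks = length (List.filter (Adj? w) ks)

  module Low {U Ks} (region : Region U Ks) (unique : Unique Ks)
    (few : ∀ {w} → w ∈ˢ U → count w Ks ≤ 2) where
    open Region region

    nbrs : Fin n → List (Fin n)
    nbrs k = select (λ w → (w ∈ˢ? U) ×-dec Adj? w k)

    attach : Exponent → List (Fin n) → Exponent
    attach β []       = β
    attach β (k ∷ ks) = raiseAll (attach β ks) (nbrs k)

    attach-in : ∀ β ks {w} → w ∈ˢ U → attach β ks w ≡ count w ks Nat.+ β w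
    attach-in β [] w∈ = refl
    attach-in β (k ∷ ks) {w} w∈ with Adj? w k
    ... | yes a = trans (raiseAll-∈ (attach β ks) (select-unique (λ w → (w ∈ˢ? U) ×-dec Adj? w k))
                    (∈select (λ w → (w ∈ˢ? U) ×-dec Adj? w k) (w∈ , a))) (cong suc (attach-in β ks w∈))
    ... | no ¬a = trans (raiseAll-other (attach β ks) λ p →
                    ¬a (proj₂ (select∋ (λ w → (w ∈ˢ? U) ×-dec Adj? w k) p))) (attach-in β ks w∈)

    attach-out : ∀ β ks {w} → ¬ w ∈ˢ U → attach β ks w ≡ β w
    attach-out β [] w∉ = refl
    attach-out β (k ∷ ks) w∉ = trans (raiseAll-other (attach β ks) λ p →
      w∉ (proj₁ (select∋ (λ w → (w ∈ˢ? U) ×-dec Adj? w k) p))) (attach-out β ks w∉)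

    Upto : List (Fin n) → Relation
    Upto ks a b = Adj a b × ((a ∈ˢ U × (b ∈ˢ U ⊎ b ∈ ks)) ⊎ (b ∈ˢ U × (a ∈ˢ U ⊎ a ∈ ks)))

    attach-NZ : ∀ β ks → Unique ks → (∀ {k} → k ∈ ks → k ∈ Ks) → (∀ {w} → ¬ w ∈ˢ U → β w ≡ 0) →
      NZ (Induced U) β → NZ (Upto ks) (attach β ks)
    attach-NZ β [] _ _ _ nz = NZ-resp
      (λ (a , p , q) → a , inj₁ (p , inj₁ q))
      (λ { (a , inj₁ (p , inj₁ q)) → a , p , q ; (a , inj₂ (q , inj₁ p)) → a , p , q }) nz
    attach-NZ β (k ∷ ks) (k∉ ∷ u) sub off nz = NZ-resp from to
      (NZ-star (select-unique k?) k∉nbrs (trans (attach-out β ks k∉U) (off k∉U))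
        (star-apart avoid) (attach-NZ β ks u (sub ∘ there) off nz))
      where
      k? = λ w → (w ∈ˢ? U) ×-dec Adj? w k
      k∉U : ¬ k ∈ˢ U
      k∉U = free (sub (here refl))
      k∉ks : k ∉ ks
      k∉ks p = All.lookup k∉ p refl
      k∉nbrs : k ∉ nbrs k
      k∉nbrs p = k∉U (proj₁ (select∋ k? p))
      avoid : ∀ {a b} → Upto ks a b → a ≢ k × b ≢ k
      avoid (_ , inj₁ (p , q)) = (λ { refl → k∉U p }) , λ { refl → [ k∉U , k∉ks ]′ q }
      avoid (_ , inj₂ (p , q)) = (λ { refl → [ k∉U , k∉ks ]′ q }) , λ { refl → k∉U p }
      from : ∀ {a b} → (Star (nbrs k) k ∪ᴿ Upto ks) a b → Upto (k ∷ ks) a b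
      from (inj₁ (inj₁ (p , refl))) = let q , r = select∋ k? p in r , inj₁ (q , inj₂ (here refl))
      from (inj₁ (inj₂ (p , refl))) = let q , r = select∋ k? p in Adj-sym r , inj₂ (q , inj₂ (here refl))
      from (inj₂ (a , inj₁ (p , inj₁ q))) = a , inj₁ (p , inj₁ q)
      from (inj₂ (a , inj₁ (p , inj₂ q))) = a , inj₁ (p , inj₂ (there q))
      from (inj₂ (a , inj₂ (p , inj₁ q))) = a , inj₂ (p , inj₁ q)
      from (inj₂ (a , inj₂ (p , inj₂ q))) = a , inj₂ (p , inj₂ (there q))
      to : ∀ {a b} → Upto (k ∷ ks) a b → (Star (nbrs k) k ∪ᴿ Upto ks) a b
      to (a , inj₁ (p , inj₁ q))             = inj₂ (a , inj₁ (p , inj₁ q))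
      to (a , inj₁ (p , inj₂ (here refl)))   = inj₁ (inj₁ (∈select k? (p , a) , refl))
      to (a , inj₁ (p , inj₂ (there q)))     = inj₂ (a , inj₁ (p , inj₂ q))
      to (a , inj₂ (p , inj₁ q))             = inj₂ (a , inj₂ (p , inj₁ q))
      to (a , inj₂ (p , inj₂ (here refl)))   = inj₁ (inj₂ (∈select k? (p , Adj-sym a) , refl))
      to (a , inj₂ (p , inj₂ (there q)))     = inj₂ (a , inj₂ (p , inj₂ q))

    Ks? : ∀ w → Dec (w ∈ Ks)
    Ks? w = Any.any? (w Finₚ.≟_) Ks

    -- Each edge to `Ks` is paid for by its inner end. Next to `Ks` this adds at most 2 to a bound
    -- of 2; elsewhere it adds nothing to a bound of 4.
    low-goal : Walkable (_∈ Ks) → ∃ (_∈ Ks) → Goal U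
    low-goal walkable (k₀ , k₀∈) = goal (attach β Ks) off bound
        (NZ-resp from to (attach-NZ β Ks unique (λ p → p) support nz))
      where
      R = ⟪ Ks? ⟫
      setting : Setting U R
      setting = record
        { disjoint = λ w∈ w∈R → free (⟪⟫∋ Ks? w∈R) w∈
        ; walkable = λ p q → Walk-map (∈⟪⟫ Ks?) (walkable (⟪⟫∋ Ks? p) (⟪⟫∋ Ks? q))
        ; base = k₀ , ∈⟪⟫ Ks? k₀∈
        ; border = λ {u} {w} u∈ a w∉ → w , ∈⟪⟫ Ks? (around u∈ a w∉) , a }
      found = claim (suc ∣ U ∣) setting ℕₚ.≤-refl
      β = proj₁ found
      nz = proj₂ (proj₂ found)
      open Bounded (proj₁ (proj₂ found)) using (support; ≤four; ≤two)
      off : ∀ {w} → ¬ w ∈ˢ U → attach β Ks w ≡ 0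
      off w∉ = trans (attach-out β Ks w∉) (support w∉)
      none : ∀ {w} → ¬ Nbr R w → count w Ks ≡ 0
      none {w} ¬nb = cong length (Listₚ.filter-none (Adj? w) (All.tabulate λ k∈ a → ¬nb (_ , ∈⟪⟫ Ks? k∈ , a)))
      bound : ∀ w → attach β Ks w ≤ 4
      bound w with w ∈ˢ? U | Nbr? R w
      ... | no w∉  | _      = ℕₚ.≤-trans (ℕₚ.≤-reflexive (off w∉)) z≤n
      ... | yes w∈ | yes nb = ℕₚ.≤-trans (ℕₚ.≤-reflexive (attach-in β Ks w∈)) (ℕₚ.+-mono-≤ (few w∈) (≤two nb))
      ... | yes w∈ | no ¬nb = ℕₚ.≤-trans (ℕₚ.≤-reflexive (trans (attach-in β Ks w∈)
                                (cong (Nat._+ β w) (none ¬nb)))) (≤four w)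
      from : ∀ {a b} → Upto Ks a b → Meeting U a b
      from (a , inj₁ (p , _)) = a , inj₁ p
      from (a , inj₂ (p , _)) = a , inj₂ p
      far : ∀ {a b} → a ∈ˢ U → Adj a b → b ∈ˢ U ⊎ b ∈ Ks
      far {a} {b} a∈ e with b ∈ˢ? U
      ... | yes b∈ = inj₁ b∈
      ... | no b∉  = inj₂ (around a∈ e b∉)
      to : ∀ {a b} → Meeting U a b → Upto Ks a b
      to (a , inj₁ p) = a , inj₁ (p , far p a)
      to (a , inj₂ p) = a , inj₂ (p , far p (Adj-sym a))

  module Step {U Ks u} (region : Region U Ks) (unique : Unique Ks) (u∈ : u ∈ˢ U) where
    open Region region

    With : List (Fin n) → Relation
    With ks a b = Meeting (remove U u) a b ⊎ ((a ≡ u × b ∈ ks) ⊎ (b ≡ u × a ∈ ks))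

    times : Exponent → List (Fin n) → Exponent
    times β []       = β
    times β (k ∷ ks) = raise (times β ks) u

    times-other : ∀ β ks {w} → w ≢ u → times β ks w ≡ β w
    times-other β []       w≢ = refl
    times-other β (k ∷ ks) w≢ = trans (raise-other (times β ks) w≢) (times-other β ks w≢)

    times-u : ∀ β ks → times β ks u ≡ length ks Nat.+ β u
    times-u β []       = refl
    times-u β (k ∷ ks) = trans (raise-same (times β ks) u) (cong suc (times-u β ks))

    times-NZ : ∀ β ks → Unique ks → (∀ {k} → k ∈ ks → ¬ k ∈ˢ U) → (∀ {w} → ¬ w ∈ˢ U → β w ≡ 0) →
      NZ (Meeting (remove U u)) β → NZ (With ks) (times β ks)
    times-NZ β [] _ _ _ nz = NZ-resp inj₁
      (λ { (inj₁ p) → p ; (inj₂ (inj₁ (_ , ()))) ; (inj₂ (inj₂ (_ , ()))) }) nz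
    times-NZ β (k ∷ ks) (k∉ ∷ unq) out off nz = NZ-resp from to
      (NZ-edge (λ { refl → k∉U u∈ }) (trans (times-other β ks (λ { refl → k∉U u∈ })) (off k∉U))
        (edge-apart {B = With ks} ¬uk ¬ku) (times-NZ β ks unq (out ∘ there) off nz))
      where
      k∉U : ¬ k ∈ˢ U
      k∉U = out (here refl)
      k∉ks : k ∉ ks
      k∉ks p = All.lookup k∉ p refl
      u∉ks : u ∉ ks
      u∉ks p = out (there p) u∈
      ¬uk : ¬ With ks u k
      ¬uk (inj₁ (_ , inj₁ p)) = proj₂ (remove∋ p) refl
      ¬uk (inj₁ (_ , inj₂ p)) = k∉U (proj₁ (remove∋ p))
      ¬uk (inj₂ (inj₁ (_ , p))) = k∉ks p
      ¬uk (inj₂ (inj₂ (_ , p))) = u∉ks p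
      ¬ku : ¬ With ks k u
      ¬ku (inj₁ (_ , inj₂ p)) = proj₂ (remove∋ p) refl
      ¬ku (inj₁ (_ , inj₁ p)) = k∉U (proj₁ (remove∋ p))
      ¬ku (inj₂ (inj₁ (_ , p))) = u∉ks p
      ¬ku (inj₂ (inj₂ (_ , p))) = k∉ks p
      from : ∀ {a b} → (Star (u ∷ []) k ∪ᴿ With ks) a b → With (k ∷ ks) a b
      from (inj₁ (inj₁ (here refl , refl))) = inj₂ (inj₁ (refl , here refl))
      from (inj₁ (inj₂ (here refl , refl))) = inj₂ (inj₂ (refl , here refl))
      from (inj₂ (inj₁ p)) = inj₁ p
      from (inj₂ (inj₂ (inj₁ (p , q)))) = inj₂ (inj₁ (p , there q))
      from (inj₂ (inj₂ (inj₂ (p , q)))) = inj₂ (inj₂ (p , there q))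
      to : ∀ {a b} → With (k ∷ ks) a b → (Star (u ∷ []) k ∪ᴿ With ks) a b
      to (inj₁ p) = inj₂ (inj₁ p)
      to (inj₂ (inj₁ (refl , here refl))) = inj₁ (inj₁ (here refl , refl))
      to (inj₂ (inj₁ (p , there q))) = inj₂ (inj₂ (inj₁ (p , q)))
      to (inj₂ (inj₂ (refl , here refl))) = inj₁ (inj₂ (here refl , refl))
      to (inj₂ (inj₂ (p , there q))) = inj₂ (inj₂ (inj₂ (p , q)))

    -- The monomial for the smaller region has exponent 0 at `u`, so the rest of `U` pays for its
    -- edges to `u`, and `u` pays only for its neighbours in `Ks`.
    step-goal : count u Ks ≤ 4 → Goal (remove U u) → Goal U
    step-goal ≤4 (goal β support ≤four nz) = goal (times β ks)
        (λ w∉ → trans (times-other β ks λ { refl → w∉ u∈ }) (off w∉)) bound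
        (NZ-resp from to (times-NZ β ks (Uniqueₚ.filter⁺ (Adj? u) unique) (free ∘ proj₁ ∘ in-ks) off nz))
      where
      ks = List.filter (Adj? u) Ks
      in-ks : ∀ {k} → k ∈ ks → k ∈ Ks × Adj u k
      in-ks = ∈ₚ.∈-filter⁻ (Adj? u) {xs = Ks}
      off : ∀ {w} → ¬ w ∈ˢ U → β w ≡ 0
      off w∉ = support (w∉ ∘ proj₁ ∘ remove∋)
      bound : ∀ w → times β ks w ≤ 4
      bound w with w Finₚ.≟ u
      ... | yes refl = ℕₚ.≤-trans (ℕₚ.≤-reflexive (trans (times-u β ks)
              (trans (cong (length ks Nat.+_) (support λ p → proj₂ (remove∋ p) refl)) (ℕₚ.+-identityʳ _)))) ≤4
      ... | no w≢ = ℕₚ.≤-trans (ℕₚ.≤-reflexive (times-other β ks w≢)) (≤four w)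
      from : ∀ {a b} → With ks a b → Meeting U a b
      from (inj₁ (a , p)) = a , [ inj₁ ∘ proj₁ ∘ remove∋ , inj₂ ∘ proj₁ ∘ remove∋ ]′ p
      from (inj₂ (inj₁ (refl , p))) = proj₂ (in-ks p) , inj₁ u∈
      from (inj₂ (inj₂ (refl , p))) = Adj-sym (proj₂ (in-ks p)) , inj₂ u∈
      at-u : ∀ {b} → Adj u b → b ∈ˢ remove U u ⊎ b ∈ ks
      at-u {b} a with b ∈ˢ? U
      ... | yes b∈ = inj₁ (∈remove b∈ (Adj⇒≢ a ∘ sym))
      ... | no b∉  = inj₂ (∈ₚ.∈-filter⁺ (Adj? u) (around u∈ a b∉) a)
      to : ∀ {a b} → Meeting U a b → With ks a b
      to {a} {b} (e , p) with a Finₚ.≟ u | b Finₚ.≟ u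
      ... | yes refl | _ = [ (λ q → inj₁ (e , inj₂ q)) , (λ q → inj₂ (inj₁ (refl , q))) ]′ (at-u e)
      ... | no _ | yes refl = [ (λ q → inj₁ (e , inj₁ q)) , (λ q → inj₂ (inj₂ (refl , q))) ]′ (at-u (Adj-sym e))
      ... | no a≢ | no b≢ = inj₁ (e , [ (λ q → inj₁ (∈remove q a≢)) , (λ q → inj₂ (∈remove q b≢)) ]′ p)

  -- The two polynomials may share the variables outside `V`, but there both exponents are 0; the
  -- variables in `V₂` are private to the second.
  join : ∀ {V V₁ V₂} → (∀ {w} → w ∈ˢ V → w ∈ˢ V₁ ⊎ w ∈ˢ V₂) → (∀ {w} → w ∈ˢ V₁ ⊎ w ∈ˢ V₂ → w ∈ˢ V) →
    (∀ {w} → w ∈ˢ V₁ → ¬ w ∈ˢ V₂) → (∀ {w x} → w ∈ˢ V₁ → x ∈ˢ V₂ → ¬ Adj w x) →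
    Goal V₁ → Goal V₂ → Goal V
  join {V} {V₁} {V₂} split sub disjoint no-edge (goal β β-off β≤ (es , E , β≢0)) (goal γ γ-off γ≤ (fs , F , γ≢0)) =
    goal (λ w → β w Nat.+ γ w)
      (λ w∉ → cong₂ Nat._+_ (β-off (w∉ ∘ sub ∘ inj₁)) (γ-off (w∉ ∘ sub ∘ inj₂)))
      bound
      (fs ++ es , Enum-resp from to (Enum-++ apart F E) ,
        product-nonzero X {es} {fs} {β} {γ} (All.tabulate λ e∈ → avoids (Enum.sound E e∈))
          (λ w eq → β-off λ w∈ → disjoint w∈ (X-true eq))
          (λ w eq → γ-off λ w∈ → contradiction (trans (sym eq) (dec-true (w ∈ˢ? V₂) w∈)) λ ()) β≢0 γ≢0)
    where
    X : Fin n → Bool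
    X w = does (w ∈ˢ? V₂)
    X-true : ∀ {w} → X w ≡ true → w ∈ˢ V₂
    X-true {w} eq with w ∈ˢ? V₂
    ... | yes p = p
    bound : ∀ w → β w Nat.+ γ w ≤ 4
    bound w with w ∈ˢ? V₂
    ... | yes w∈ = ℕₚ.≤-trans (ℕₚ.≤-reflexive (cong (Nat._+ γ w) (β-off λ p → disjoint p w∈))) (γ≤ w)
    ... | no w∉  = ℕₚ.≤-trans (ℕₚ.≤-reflexive (trans (cong (β w Nat.+_) (γ-off w∉)) (ℕₚ.+-identityʳ _))) (β≤ w)
    clash : ∀ {a b} → Meeting V₁ a b → ¬ (a ∈ˢ V₂ ⊎ b ∈ˢ V₂)
    clash (_ , inj₁ p) (inj₁ q) = disjoint p q
    clash (e , inj₁ p) (inj₂ q) = no-edge p q e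
    clash (e , inj₂ p) (inj₁ q) = no-edge p q (Adj-sym e)
    clash (_ , inj₂ p) (inj₂ q) = disjoint p q
    avoids : ∀ {a b} → Meeting V₁ a b → X a ≡ false × X b ≡ false
    avoids {a} {b} m = dec-false (a ∈ˢ? V₂) (clash m ∘ inj₁) , dec-false (b ∈ˢ? V₂) (clash m ∘ inj₂)
    apart : Apart (Meeting V₂) (Meeting V₁)
    apart (_ , q) = (λ m → clash m q) , (λ m → clash m ([ inj₂ , inj₁ ]′ q))
    from : ∀ {a b} → (Meeting V₂ ∪ᴿ Meeting V₁) a b → Meeting V a b
    from (inj₁ (e , p)) = e , [ inj₁ ∘ sub ∘ inj₂ , inj₂ ∘ sub ∘ inj₂ ]′ p
    from (inj₂ (e , p)) = e , [ inj₁ ∘ sub ∘ inj₁ , inj₂ ∘ sub ∘ inj₁ ]′ p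
    to : ∀ {a b} → Meeting V a b → (Meeting V₂ ∪ᴿ Meeting V₁) a b
    to (e , inj₁ p) = [ (λ q → inj₂ (e , inj₁ q)) , (λ q → inj₁ (e , inj₁ q)) ]′ (split p)
    to (e , inj₂ p) = [ (λ q → inj₂ (e , inj₂ q)) , (λ q → inj₁ (e , inj₂ q)) ]′ (split p)

  module Parts (V₀ : Subset n) where
    ClosedIn : Subset n → Set
    ClosedIn V = (∀ {w} → w ∈ˢ V → w ∈ˢ V₀) × (∀ {w x} → w ∈ˢ V → x ∈ˢ V₀ → Adj w x → x ∈ˢ V)

    Splits : Subset n → Subset n → Set
    Splits V T = (∃ λ w → w ∈ˢ V × w ∈ˢ T) × (∃ λ w → w ∈ˢ V × ¬ w ∈ˢ T) ×
      (∀ w x → (w ∈ˢ V × x ∈ˢ V) × Adj w x → w ∈ˢ T → x ∈ˢ T)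

    splits? : ∀ V T → Dec (Splits V T)
    splits? V T =
      Finₚ.any? (λ w → (w ∈ˢ? V) ×-dec (w ∈ˢ? T)) ×-dec
      (Finₚ.any? (λ w → (w ∈ˢ? V) ×-dec ¬? (w ∈ˢ? T)) ×-dec
      Finₚ.all? (λ w → Finₚ.all? λ x →
        ((((w ∈ˢ? V) ×-dec (x ∈ˢ? V)) ×-dec Adj? w x) →-dec ((w ∈ˢ? T) →-dec (x ∈ˢ? T)))))

    -- A function constant along edges but not on `V` would have a level set that splits `V`.
    unsplit-linked : ∀ {V} → (∀ T → ¬ Splits V T) → Linked (_∈ˢ V)
    unsplit-linked {V} unsplit f const {w} {w′} w∈ w′∈ with f w′ ℤₚ.≟ f w
    ... | yes eq = sym eq
    ... | no ≢   = ⊥-elim (unsplit ⟪ T? ⟫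
            ((w , w∈ , ∈⟪⟫ T? refl) , (w′ , w′∈ , ≢ ∘ ⟪⟫∋ T?) ,
             λ x y ((x∈ , y∈) , a) x∈T → ∈⟪⟫ T? (trans (sym (const x∈ y∈ a)) (⟪⟫∋ T? x∈T))))
      where
      T? : ∀ x → Dec (f x ≡ f w)
      T? x = f x ℤₚ.≟ f w

    -- Components are never computed: any splitting set, found by search over all subsets, cuts `V`
    -- in two until no cut is left.
    parts : ∀ m V → ∣ V ∣ < m → ClosedIn V → (∀ V → ClosedIn V → Linked (_∈ˢ V) → Goal V) → Goal V
    parts (suc m) V (s≤s V≤m) closed@(V⊆ , V-closed) handle with Subsetₚ.anySubset? (splits? V)
    ... | no none = handle V closed (unsplit-linked λ T s → none (T , s))
    ... | yes (T , (w , w∈ , w∈T) , (w′ , w′∈ , w′∉T) , stable) =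
      join {V} {⟪ in? ⟫} {⟪ out? ⟫}
        (λ {x} x∈ → case x ∈ˢ? T of λ { (yes p) → inj₁ (∈⟪⟫ in? (x∈ , p)) ; (no p) → inj₂ (∈⟪⟫ out? (x∈ , p)) })
        [ proj₁ ∘ ⟪⟫∋ in? , proj₁ ∘ ⟪⟫∋ out? ]′
        (λ p q → proj₂ (⟪⟫∋ out? q) (proj₂ (⟪⟫∋ in? p)))
        (λ p q a → let p₁ , p₂ = ⟪⟫∋ in? p ; q₁ , q₂ = ⟪⟫∋ out? q in q₂ (stable _ _ ((p₁ , q₁) , a) p₂))
        (parts m ⟪ in? ⟫ (ℕₚ.≤-trans (smaller in? proj₁ w′∈ λ (_ , p) → w′∉T p) V≤m)
          ((V⊆ ∘ proj₁ ∘ ⟪⟫∋ in?) , λ p x∈ a → let p₁ , p₂ = ⟪⟫∋ in? p ; x∈V = V-closed p₁ x∈ a in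
            ∈⟪⟫ in? (x∈V , stable _ _ ((p₁ , x∈V) , a) p₂)) handle)
        (parts m ⟪ out? ⟫ (ℕₚ.≤-trans (smaller out? proj₁ w∈ λ (_ , p) → p w∈T) V≤m)
          ((V⊆ ∘ proj₁ ∘ ⟪⟫∋ out?) , λ p x∈ a → let p₁ , p₂ = ⟪⟫∋ out? p ; x∈V = V-closed p₁ x∈ a in
            ∈⟪⟫ out? (x∈V , λ x∈T → p₂ (stable _ _ ((x∈V , p₁) , Adj-sym a) x∈T))) handle)
      where
      in? : ∀ x → Dec (x ∈ˢ V × x ∈ˢ T)
      in? x = (x ∈ˢ? V) ×-dec (x ∈ˢ? T)
      out? : ∀ x → Dec (x ∈ˢ V × ¬ x ∈ˢ T)
      out? x = (x ∈ˢ? V) ×-dec ¬? (x ∈ˢ? T)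

    by-parts : (∀ V → ClosedIn V → Linked (_∈ˢ V) → Goal V) → Goal V₀
    by-parts = parts (suc ∣ V₀ ∣) V₀ ℕₚ.≤-refl ((λ p → p) , λ _ x∈ _ → x∈)

-- Regions bounded by cycles of length three, four and five.

module ShortCycles {n} (G : PlaneGraph n) (o : Fin (PlaneGraph.d G)) where
  open PlaneGraph G using (Adj)
  open Separation G o using (Adj-sym; Walk; stop; Walk-map; Walk-step; Walk-trans; Walk-sym; Walkable)
  open Planarity G o
  open Comprehension {n}
  open Precoloured G o
  open Regions G o
  open Region
  open Parts using (ClosedIn; by-parts)

  pattern #0 = here refl
  pattern #1 = there #0
  pattern #2 = there #1
  pattern #3 = there #2
  pattern #4 = there #3
  pattern #5 = there #4

  chain-walkable : ∀ {ks} → Chain.Linked Adj ks → Walkable (_∈ ks)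
  chain-walkable {k ∷ ks} chain p q = Walk-trans (to-first chain p) (Walk-sym (to-first chain q))
    where
    to-first : ∀ {x xs k} → Chain.Linked Adj (x ∷ xs) → k ∈ x ∷ xs → Walk (_∈ x ∷ xs) k x
    to-first _       (here refl) = stop (here refl)
    to-first (a ∷ l) (there k∈)  =
      Walk-trans (Walk-map there (to-first l k∈)) (Walk-step (there (here refl)) (Adj-sym a) (stop (here refl)))

  Triple : Fin n → List (Fin n) → Set
  Triple w ks = ∃ λ x → ∃₂ λ y z → (x ∷ y ∷ z ∷ []) ⊆ ks × Adj w x × Adj w y × Adj w z

  triple : ∀ w ks → 3 ≤ count w ks → Triple w ks
  triple w ks 3≤ with List.filter (Adj? w) ks | Sublistₚ.filter-⊆ (Adj? w) ks | Allₚ.all-filter (Adj? w) ks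
  ... | x ∷ y ∷ z ∷ rest | sub | ax ∷ ay ∷ az ∷ _ =
    x , y , z , Sublist.⊆-trans (refl ∷ refl ∷ refl ∷ Sublist.minimum rest) sub , ax , ay , az
  triple w ks (s≤s (s≤s ())) | _ ∷ _ ∷ [] | _ | _
  triple w ks (s≤s ()) | _ ∷ [] | _ | _
  triple w ks () | [] | _ | _

  few-or-triple : ∀ U ks → (∀ {w} → w ∈ˢ U → count w ks ≤ 2) ⊎ (∃ λ u → u ∈ˢ U × Triple u ks)
  few-or-triple U ks with Finₚ.any? (λ u → (u ∈ˢ? U) ×-dec (3 Nat.≤? count u ks))
  ... | yes (u , u∈ , 3≤) = inj₂ (u , u∈ , triple u ks 3≤)
  ... | no none = inj₁ λ w∈ → ℕₚ.≤-pred (ℕₚ.≰⇒> λ 3≤ → none (_ , w∈ , 3≤))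

  Region-rotate : ∀ {U k ks} → Region U (k ∷ ks) → Region U (ks ++ k ∷ [])
  Region-rotate {ks = ks} r = record
    { free = λ p → [ free r ∘ there , (λ { (here refl) → free r (here refl) }) ]′ (∈ₚ.∈-++⁻ ks p)
    ; around = λ w∈ a x∉ → case around r w∈ a x∉ of λ
        { (here refl) → ∈ₚ.∈-++⁺ʳ ks (here refl) ; (there p) → ∈ₚ.∈-++⁺ˡ p } }

  module _ {U Ks u V} (region : Region U Ks) (u∈ : u ∈ˢ U) (closed : ClosedIn (remove U u) V) where

    part-of : ∀ {w} → w ∈ˢ V → w ∈ˢ U
    part-of = proj₁ ∘ remove∋ ∘ proj₁ closed

    part-smaller : ∣ V ∣ < ∣ U ∣
    part-smaller = ℕₚ.≤-<-trans (Subsetₚ.p⊆q⇒∣p∣≤∣q∣ (proj₁ closed)) (remove-smaller u∈)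

    outside : ∀ {k} → k ∈ u ∷ Ks → ¬ k ∈ˢ V
    outside (here refl) p = proj₂ (remove∋ (proj₁ closed p)) refl
    outside (there k∈)  p = free region k∈ (part-of p)

    -- Once `u` is on the boundary, a component is governed only by those boundary vertices that it
    -- touches; excluding some of them by planarity is what shortens the list to a cycle again.
    narrow : ∀ {Ls} → All (_∈ u ∷ Ks) Ls → All (λ x → Nbr V x → x ∈ Ls) (u ∷ Ks) → Region V Ls
    narrow {Ls} sub touched = record
      { free = λ p → outside (All.lookup sub p)
      ; around = λ w∈ a x∉ → All.lookup touched (around′ w∈ a x∉) (_ , w∈ , Adj-sym a) }
      where
      around′ : ∀ {w x} → w ∈ˢ V → Adj w x → ¬ x ∈ˢ V → x ∈ u ∷ Ks
      around′ {w} {x} w∈ a x∉ with x Finₚ.≟ u | x ∈ˢ? U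
      ... | yes refl | _      = here refl
      ... | no x≢    | yes x∈ = ⊥-elim (x∉ (proj₂ closed w∈ (∈remove x∈ x≢) a))
      ... | no _     | no x∉U = there (around region (part-of w∈) a x∉U)

    module _ (linked : Linked (_∈ˢ V)) where

      -- K₃,₃ with hubs v, {p , q} and V.
      blocked : ∀ {v p q x y z} → p ≡ q ⊎ Adj p q →
        v ∈ u ∷ Ks → p ∈ u ∷ Ks → q ∈ u ∷ Ks → x ∈ u ∷ Ks → y ∈ u ∷ Ks → z ∈ u ∷ Ks →
        v ≢ p × v ≢ q → Adj v x → Adj v y → Adj v z → x ≢ y → y ≢ z → x ≢ z →
        x ≢ p × x ≢ q → y ≢ p × y ≢ q → z ≢ p × z ≢ q →
        Adj x p ⊎ Adj x q → Adj y p ⊎ Adj y q → Adj z p ⊎ Adj z q →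
        Nbr V x → Nbr V y → ¬ Nbr V z
      blocked {v} {p} {q} pq v∉ p∉ q∉ x∉ y∉ z∉ v≢ vx vy vz x≢y y≢z x≢z x≢ y≢ z≢ xR yR zR xV yV zV =
        no-K₃₃ {R = R} walkable linked (off v≢)
          (λ w∈ → avoid w∈ v∉ , [ avoid w∈ p∉ , avoid w∈ q∉ ]′)
          vx vy vz x≢y y≢z x≢z (off x≢) (off y≢) (off z≢) (to-R xR) (to-R yR) (to-R zR)
          (outside x∉) (outside y∉) (outside z∉) xV yV zV
        where
        R : Fin n → Set
        R w = w ≡ p ⊎ w ≡ q
        off : ∀ {w} → w ≢ p × w ≢ q → ¬ R w
        off (≢p , ≢q) = [ ≢p , ≢q ]′
        avoid : ∀ {w k} → w ∈ˢ V → k ∈ u ∷ Ks → w ≢ k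
        avoid w∈ k∈ refl = outside k∈ w∈
        to-R : ∀ {w} → Adj w p ⊎ Adj w q → AdjTo R w
        to-R = [ (λ a → p , inj₁ refl , a) , (λ a → q , inj₂ refl , a) ]′
        walkable : Walkable R
        walkable (inj₁ refl) (inj₁ refl) = stop (inj₁ refl)
        walkable (inj₂ refl) (inj₂ refl) = stop (inj₂ refl)
        walkable (inj₁ refl) (inj₂ refl) =
          [ (λ { refl → stop (inj₂ refl) }) , (λ a → Walk-step (inj₁ refl) a (stop (inj₂ refl))) ]′ pq
        walkable (inj₂ refl) (inj₁ refl) =
          [ (λ { refl → stop (inj₁ refl) }) , (λ a → Walk-step (inj₂ refl) (Adj-sym a) (stop (inj₁ refl))) ]′ pq

  -- Chords are permitted, because a cycle rerouted through a removed vertex often has some.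
  record Cycle₄ (a b c e : Fin n) : Set where
    field
      ab : Adj a b
      bc : Adj b c
      ce : Adj c e
      ea : Adj e a
      a≢c : a ≢ c
      b≢e : b ≢ e

    unique : Unique (a ∷ b ∷ c ∷ e ∷ [])
    unique = (Adj⇒≢ ab ∷ a≢c ∷ Adj⇒≢ ea ∘ sym ∷ []) ∷ (Adj⇒≢ bc ∷ b≢e ∷ []) ∷ (Adj⇒≢ ce ∷ []) ∷ [] ∷ []

  Four : Subset n → Fin n → Fin n → Fin n → Fin n → Set
  Four U a b c e = Cycle₄ a b c e × Region U (a ∷ b ∷ c ∷ e ∷ [])

  four-rotate : ∀ {U a b c e} → Four U a b c e → Four U b c e a
  four-rotate (C , r) =
    record { ab = bc ; bc = ce ; ce = ea ; ea = ab ; a≢c = b≢e ; b≢e = a≢c ∘ sym } , Region-rotate r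
    where open Cycle₄ C

  too-long : ∀ {A : Set} {xs ys : List (Fin n)} → xs ⊆ ys → length ys < length xs → A
  too-long sub lt = ⊥-elim (ℕₚ.≤⇒≯ (Sublistₚ.length-mono-≤ sub) lt)

  triple₄ : ∀ {P : Fin n → Set} {a b c e x y z} → (x ∷ y ∷ z ∷ []) ⊆ (a ∷ b ∷ c ∷ e ∷ []) →
    P x → P y → P z →
    (P a × P b × P c) ⊎ (P b × P c × P e) ⊎ (P c × P e × P a) ⊎ (P e × P a × P b)
  triple₄ (refl ∷ refl ∷ refl ∷ _)      p q r = inj₁ (p , q , r)
  triple₄ (_ ∷ʳ refl ∷ refl ∷ refl ∷ _) p q r = inj₂ (inj₁ (p , q , r))
  triple₄ (refl ∷ _ ∷ʳ refl ∷ refl ∷ _) p q r = inj₂ (inj₂ (inj₁ (q , r , p)))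
  triple₄ (refl ∷ refl ∷ _ ∷ʳ refl ∷ _) p q r = inj₂ (inj₂ (inj₂ (r , p , q)))

  triple₄ (_ ∷ʳ _ ∷ʳ s)                 p q r = too-long s ℕₚ.≤-refl
  triple₄ (_ ∷ʳ refl ∷ _ ∷ʳ s)          p q r = too-long s ℕₚ.≤-refl
  triple₄ (refl ∷ _ ∷ʳ _ ∷ʳ s)          p q r = too-long s ℕₚ.≤-refl

  -- Both `a` and `c` are adjacent to each of `u`, `b`, `e`. A component touching all three would
  -- complete a K₃,₃; so it misses one, and the other two close a four-cycle with `a` and `c`.
  four-at : ∀ {U a b c e u} → Four U a b c e → u ∈ˢ U → Adj u a → Adj u b → Adj u c →
    (∀ {V a b c e} → Four V a b c e → ∣ V ∣ < ∣ U ∣ → Goal V) → Goal U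
  four-at {U} {a} {b} {c} {e} {u} (C , region) u∈ ua ub uc recurse =
    Step.step-goal region unique u∈ (Listₚ.length-filter (Adj? u) (a ∷ b ∷ c ∷ e ∷ []))
      (by-parts (remove U u) handle)
    where
    open Cycle₄ C
    u≢ : ∀ {k} → k ∈ a ∷ b ∷ c ∷ e ∷ [] → u ≢ k
    u≢ k∈ refl = free region k∈ u∈
    handle : ∀ V → ClosedIn (remove U u) V → Linked (_∈ˢ V) → Goal V
    handle V closed linked with Nbr? V u | Nbr? V b | Nbr? V e
    ... | no ¬u | _ | _ = recurse
            (C , narrow region u∈ closed (#1 ∷ #2 ∷ #3 ∷ #4 ∷ [])
              ((λ nb → ⊥-elim (¬u nb)) ∷ (λ _ → #0) ∷ (λ _ → #1) ∷ (λ _ → #2) ∷ (λ _ → #3) ∷ []))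
            (part-smaller region u∈ closed)
    ... | yes _ | no ¬b | _ = recurse
            (record { ab = Adj-sym ua ; bc = uc ; ce = ce ; ea = ea ; a≢c = a≢c ; b≢e = u≢ #3 } ,
             narrow region u∈ closed (#1 ∷ #0 ∷ #3 ∷ #4 ∷ [])
              ((λ _ → #1) ∷ (λ _ → #0) ∷ (λ nb → ⊥-elim (¬b nb)) ∷ (λ _ → #2) ∷ (λ _ → #3) ∷ []))
            (part-smaller region u∈ closed)
    ... | yes _ | yes _ | no ¬e = recurse
            (record { ab = ab ; bc = bc ; ce = Adj-sym uc ; ea = ua ; a≢c = a≢c ; b≢e = u≢ #1 ∘ sym } ,
             narrow region u∈ closed (#1 ∷ #2 ∷ #3 ∷ #0 ∷ [])
              ((λ _ → #3) ∷ (λ _ → #0) ∷ (λ _ → #1) ∷ (λ _ → #2) ∷ (λ nb → ⊥-elim (¬e nb)) ∷ []))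
            (part-smaller region u∈ closed)
    ... | yes nu | yes nb | yes ne = ⊥-elim (blocked region u∈ closed linked {a} {c} {c} {u} {b} {e} (inj₁ refl)
            #1 #3 #3 #0 #2 #4 (a≢c , a≢c) (Adj-sym ua) ab (Adj-sym ea) (u≢ #1) b≢e (u≢ #3)
            (u≢ #2 , u≢ #2) (Adj⇒≢ bc , Adj⇒≢ bc) (Adj⇒≢ ce ∘ sym , Adj⇒≢ ce ∘ sym)
            (inj₁ uc) (inj₁ bc) (inj₁ (Adj-sym ce)) nu nb ne)

  four-goal : ∀ m {U a b c e} → Four U a b c e → ∣ U ∣ < m → Goal U
  four-goal (suc m) {U} {a} {b} {c} {e} F (s≤s U≤m) with few-or-triple U (a ∷ b ∷ c ∷ e ∷ [])
  ... | inj₁ few = Low.low-goal (proj₂ F) unique few (chain-walkable (ab ∷ bc ∷ ce ∷ [-])) (a , #0)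
    where open Cycle₄ (proj₁ F)
  ... | inj₂ (u , u∈ , x , y , z , sub , ux , uy , uz) with triple₄ {Adj u} sub ux uy uz
  ...   | inj₁ (p , q , r) =
            four-at F u∈ p q r λ F′ lt → four-goal m F′ (ℕₚ.≤-trans lt U≤m)
  ...   | inj₂ (inj₁ (p , q , r)) =
            four-at (four-rotate F) u∈ p q r λ F′ lt → four-goal m F′ (ℕₚ.≤-trans lt U≤m)
  ...   | inj₂ (inj₂ (inj₁ (p , q , r))) =
            four-at (four-rotate (four-rotate F)) u∈ p q r λ F′ lt → four-goal m F′ (ℕₚ.≤-trans lt U≤m)
  ...   | inj₂ (inj₂ (inj₂ (p , q , r))) =
            four-at (four-rotate (four-rotate (four-rotate F))) u∈ p q r
              λ F′ lt → four-goal m F′ (ℕₚ.≤-trans lt U≤m)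

  four : ∀ {U a b c e} → Four U a b c e → Goal U
  four {U} F = four-goal (suc ∣ U ∣) F ℕₚ.≤-refl

  -- Only a vertex joined to the whole triangle needs to be moved. Together with the triangle it
  -- forms a four-cycle, with chords, that bounds everything left; no separation is called for.
  three : ∀ {U a b c} → Adj a b → Adj b c → Adj c a → Region U (a ∷ b ∷ c ∷ []) → Goal U
  three {U} {a} {b} {c} ab bc ca region with few-or-triple U (a ∷ b ∷ c ∷ [])
  ... | inj₁ few = Low.low-goal region unique few (chain-walkable (ab ∷ bc ∷ [-])) (a , #0)
    where
    unique : Unique (a ∷ b ∷ c ∷ [])
    unique = (Adj⇒≢ ab ∷ Adj⇒≢ ca ∘ sym ∷ []) ∷ (Adj⇒≢ bc ∷ []) ∷ [] ∷ []
  ... | inj₂ (u , u∈ , _ , _ , _ , (_ ∷ʳ s) , _) = too-long s ℕₚ.≤-refl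
  ... | inj₂ (u , u∈ , _ , _ , _ , (refl ∷ _ ∷ʳ s) , _) = too-long s ℕₚ.≤-refl
  ... | inj₂ (u , u∈ , _ , _ , _ , (refl ∷ refl ∷ refl ∷ _) , ua , ub , uc) =
    Step.step-goal region unique u∈
      (ℕₚ.≤-trans (Listₚ.length-filter (Adj? u) (a ∷ b ∷ c ∷ [])) (ℕₚ.n≤1+n 3))
      (four {remove U u} {a} {b} {c} {u}
        (record { ab = ab ; bc = bc ; ce = Adj-sym uc ; ea = ua ; a≢c = Adj⇒≢ ca ∘ sym ; b≢e = Adj⇒≢ ub ∘ sym } ,
         narrow {V = remove U u} region u∈ ((λ p → p) , λ _ x∈ _ → x∈) (#1 ∷ #2 ∷ #3 ∷ #0 ∷ [])
           ((λ _ → #3) ∷ (λ _ → #0) ∷ (λ _ → #1) ∷ (λ _ → #2) ∷ [])))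
    where
    unique : Unique (a ∷ b ∷ c ∷ [])
    unique = (Adj⇒≢ ab ∷ Adj⇒≢ ca ∘ sym ∷ []) ∷ (Adj⇒≢ bc ∷ []) ∷ [] ∷ []

  record Cycle₅ (a b c e f : Fin n) : Set where
    field
      ab : Adj a b
      bc : Adj b c
      ce : Adj c e
      ef : Adj e f
      fa : Adj f a
      a≢c : a ≢ c
      a≢e : a ≢ e
      b≢e : b ≢ e
      b≢f : b ≢ f
      c≢f : c ≢ f

    unique : Unique (a ∷ b ∷ c ∷ e ∷ f ∷ [])
    unique = (Adj⇒≢ ab ∷ a≢c ∷ a≢e ∷ Adj⇒≢ fa ∘ sym ∷ []) ∷ (Adj⇒≢ bc ∷ b≢e ∷ b≢f ∷ []) ∷
      (Adj⇒≢ ce ∷ c≢f ∷ []) ∷ (Adj⇒≢ ef ∷ []) ∷ [] ∷ []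

  -- A centre would have to pay for five boundary edges when moved to the boundary, hence
  -- `centreless`. It has to be re-established for every new five-cycle, whereas the four-cycle
  -- statement carries no such condition.
  record Five (U : Subset n) (a b c e f : Fin n) : Set where
    field
      cycle  : Cycle₅ a b c e f
      region : Region U (a ∷ b ∷ c ∷ e ∷ f ∷ [])
      centreless : ∀ {w} → w ∈ˢ U → Adj w a → Adj w b → Adj w c → Adj w e → ¬ Adj w f

  five-rotate : ∀ {U a b c e f} → Five U a b c e f → Five U b c e f a
  five-rotate F = record
    { cycle = record { ab = bc ; bc = ce ; ce = ef ; ef = fa ; fa = ab
                     ; a≢c = b≢e ; a≢e = b≢f ; b≢e = c≢f ; b≢f = a≢c ∘ sym ; c≢f = a≢e ∘ sym }
    ; region = Region-rotate region
    ; centreless = λ w∈ wb wc we wf wa → centreless w∈ wa wb wc we wf }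
    where
    open Five F
    open Cycle₅ cycle

  module _ {U a b c e f u} (F : Five U a b c e f) (u∈ : u ∈ˢ U)
    (recurse : ∀ {V a b c e f} → Five V a b c e f → ∣ V ∣ < ∣ U ∣ → Goal V) where
    open Five F
    open Cycle₅ cycle

    private
      u≢ : ∀ {k} → k ∈ a ∷ b ∷ c ∷ e ∷ f ∷ [] → u ≢ k
      u≢ k∈ refl = free region k∈ u∈

      at-most-four : count u (a ∷ b ∷ c ∷ e ∷ f ∷ []) ≤ 4
      at-most-four = ℕₚ.≤-pred (Listₚ.filter-notAll (Adj? u) (a ∷ b ∷ c ∷ e ∷ f ∷ [])
        (Allₚ.¬All⇒Any¬ (Adj? u) _ λ { (p ∷ q ∷ r ∷ s ∷ t ∷ []) → centreless u∈ p q r s t }))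

      by-components : (∀ V → ClosedIn (remove U u) V → Linked (_∈ˢ V) → Goal V) → Goal U
      by-components handle =
        Step.step-goal region unique u∈ at-most-four (by-parts (remove U u) handle)

      module Component {V} (closed : ClosedIn (remove U u) V) (linked : Linked (_∈ˢ V)) where
        shrink : ∀ {Ls} → All (_∈ u ∷ a ∷ b ∷ c ∷ e ∷ f ∷ []) Ls →
          All (λ x → Nbr V x → x ∈ Ls) (u ∷ a ∷ b ∷ c ∷ e ∷ f ∷ []) → Region V Ls
        shrink = narrow region u∈ closed

        small : ∣ V ∣ < ∣ U ∣
        small = part-smaller region u∈ closed

        avoiding-u : ¬ Nbr V u → Goal V
        avoiding-u ¬u = recurse (record
          { cycle = cycle
          ; region = shrink (#1 ∷ #2 ∷ #3 ∷ #4 ∷ #5 ∷ [])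
              ((λ nb → ⊥-elim (¬u nb)) ∷ (λ _ → #0) ∷ (λ _ → #1) ∷ (λ _ → #2) ∷ (λ _ → #3) ∷ (λ _ → #4) ∷ [])
          ; centreless = centreless ∘ part-of region u∈ closed }) small

        K₃₃ = λ {v} {p} {q} {x} {y} {z} → blocked region u∈ closed linked {v} {p} {q} {x} {y} {z}

        abc-u : Adj u a → Adj u c → (Nbr V e → ⊥) → (Nbr V f → ⊥) → Goal V
        abc-u ua uc ¬e ¬f = four {V} {a} {b} {c} {u}
          (record { ab = ab ; bc = bc ; ce = Adj-sym uc ; ea = ua ; a≢c = a≢c ; b≢e = u≢ #1 ∘ sym } ,
           shrink (#1 ∷ #2 ∷ #3 ∷ #0 ∷ [])
             ((λ _ → #3) ∷ (λ _ → #0) ∷ (λ _ → #1) ∷ (λ _ → #2) ∷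
              (λ nb → ⊥-elim (¬e nb)) ∷ (λ nb → ⊥-elim (¬f nb)) ∷ []))

        efa-u : Adj u e → Adj u a → (Nbr V b → ⊥) → (Nbr V c → ⊥) → Goal V
        efa-u ue ua ¬b ¬c = four {V} {e} {f} {a} {u}
          (record { ab = ef ; bc = fa ; ce = Adj-sym ua ; ea = ue ; a≢c = a≢e ∘ sym ; b≢e = u≢ #4 ∘ sym } ,
           shrink (#4 ∷ #5 ∷ #1 ∷ #0 ∷ [])
             ((λ _ → #3) ∷ (λ _ → #2) ∷ (λ nb → ⊥-elim (¬b nb)) ∷ (λ nb → ⊥-elim (¬c nb)) ∷
              (λ _ → #0) ∷ (λ _ → #1) ∷ []))

        bce-u : Adj u b → Adj u e → (Nbr V f → ⊥) → (Nbr V a → ⊥) → Goal V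
        bce-u ub ue ¬f ¬a = four {V} {b} {c} {e} {u}
          (record { ab = bc ; bc = ce ; ce = Adj-sym ue ; ea = ub ; a≢c = b≢e ; b≢e = u≢ #2 ∘ sym } ,
           shrink (#2 ∷ #3 ∷ #4 ∷ #0 ∷ [])
             ((λ _ → #3) ∷ (λ nb → ⊥-elim (¬a nb)) ∷ (λ _ → #0) ∷ (λ _ → #1) ∷ (λ _ → #2) ∷
              (λ nb → ⊥-elim (¬f nb)) ∷ []))

        -- In all four clashes one hub of the K₃,₃ is a single vertex, one is an edge of the cycle
        -- contracted to a point, and the third is the component. Here they are `c`, the edge
        -- between `a` and `f`, and `V`.
        ube-clash : Adj u a → Adj u c → Nbr V u → Nbr V b → ¬ Nbr V e
        ube-clash ua uc = K₃₃ {c} {a} {f} {u} {b} {e} (inj₂ (Adj-sym fa)) #3 #1 #5 #0 #2 #4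
          (a≢c ∘ sym , c≢f) (Adj-sym uc) (Adj-sym bc) ce (u≢ #1) b≢e (u≢ #3)
          (u≢ #0 , u≢ #4) (Adj⇒≢ ab ∘ sym , b≢f) (a≢e ∘ sym , Adj⇒≢ ef)
          (inj₁ ua) (inj₁ (Adj-sym ab)) (inj₂ ef)

        ubf-clash : Adj u a → Adj u c → Nbr V u → Nbr V b → ¬ Nbr V f
        ubf-clash ua uc = K₃₃ {a} {c} {e} {u} {b} {f} (inj₂ ce) #1 #3 #4 #0 #2 #5
          (a≢c , a≢e) (Adj-sym ua) ab (Adj-sym fa) (u≢ #1) b≢f (u≢ #4)
          (u≢ #2 , u≢ #3) (Adj⇒≢ bc , b≢e) (c≢f ∘ sym , Adj⇒≢ ef ∘ sym)
          (inj₁ uc) (inj₁ bc) (inj₂ (Adj-sym ef))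

        ufc-clash : Adj u a → Adj u e → Nbr V u → Nbr V f → ¬ Nbr V c
        ufc-clash ua ue = K₃₃ {e} {a} {b} {u} {f} {c} (inj₂ ab) #4 #1 #2 #0 #5 #3
          (a≢e ∘ sym , b≢e ∘ sym) (Adj-sym ue) ef (Adj-sym ce) (u≢ #4) (c≢f ∘ sym) (u≢ #2)
          (u≢ #0 , u≢ #1) (Adj⇒≢ fa , b≢f ∘ sym) (a≢c ∘ sym , Adj⇒≢ bc ∘ sym)
          (inj₁ ua) (inj₁ fa) (inj₂ (Adj-sym bc))

        uac-clash : Adj u b → Adj u e → Nbr V u → Nbr V a → ¬ Nbr V c
        uac-clash ub ue = K₃₃ {b} {e} {f} {u} {a} {c} (inj₂ ef) #2 #4 #5 #0 #1 #3
          (b≢e , b≢f) (Adj-sym ub) (Adj-sym ab) bc (u≢ #0) a≢c (u≢ #2)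
          (u≢ #3 , u≢ #4) (a≢e , Adj⇒≢ fa ∘ sym) (Adj⇒≢ ce , c≢f)
          (inj₁ ue) (inj₂ (Adj-sym fa)) (inj₁ ce)

    -- With four neighbours every component touching `u` is confined to a four-cycle through `u`, so
    -- no new five-cycle arises and no condition on centres has to be checked.
    at-abce : Adj u a → Adj u b → Adj u c → Adj u e → Goal U
    at-abce ua ub uc ue = by-components handle
      where
      handle : ∀ V → ClosedIn (remove U u) V → Linked (_∈ˢ V) → Goal V
      handle V closed linked with Nbr? V u | Nbr? V f | Nbr? V e | Nbr? V a
      ... | no ¬u | _ | _ | _ = Component.avoiding-u closed linked ¬u
      ... | yes nu | yes nf | _ | _ =
              efa-u ue ua (λ nb → ubf-clash ua uc nu nb nf) (ufc-clash ua ue nu nf)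
              where open Component closed linked
      ... | yes nu | no ¬f | no ¬e | _ = Component.abc-u closed linked ua uc ¬e ¬f
      ... | yes nu | no ¬f | yes ne | no ¬a = Component.bce-u closed linked ub ue ¬f ¬a
      ... | yes nu | no ¬f | yes ne | yes na =
              efa-u ue ua (λ nb → ube-clash ua uc nu nb ne) (uac-clash ub ue nu na)
              where open Component closed linked

    -- A component touching `u` and `b` can touch neither `e` nor `f`. One missing `b` sees the
    -- five-cycle with `u` in place of `b`, a centre of which would have the four old neighbours
    -- `c`, `e`, `f`, `a`.
    at-abc : (∀ {w} → w ∈ˢ U → Adj w c → Adj w e → Adj w f → ¬ Adj w a) →
      Adj u a → Adj u b → Adj u c → Goal U
    at-abc ¬cefa ua ub uc = by-components handle
      where
      handle : ∀ V → ClosedIn (remove U u) V → Linked (_∈ˢ V) → Goal V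
      handle V closed linked with Nbr? V u | Nbr? V b
      ... | no ¬u | _ = Component.avoiding-u closed linked ¬u
      ... | yes nu | yes nb = abc-u ua uc (ube-clash ua uc nu nb) (ubf-clash ua uc nu nb)
              where open Component closed linked
      ... | yes nu | no ¬b = recurse {V} {a} {u} {c} {e} {f} (record
              { cycle = record { ab = Adj-sym ua ; bc = uc ; ce = ce ; ef = ef ; fa = fa
                               ; a≢c = a≢c ; a≢e = a≢e ; b≢e = u≢ #3 ; b≢f = u≢ #4 ; c≢f = c≢f }
              ; region = shrink (#1 ∷ #0 ∷ #3 ∷ #4 ∷ #5 ∷ [])
                  ((λ _ → #1) ∷ (λ _ → #0) ∷ (λ nb → ⊥-elim (¬b nb)) ∷ (λ _ → #2) ∷ (λ _ → #3) ∷ (λ _ → #4) ∷ [])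
              ; centreless = λ w∈ wa _ wc we wf → ¬cefa (part-of region u∈ closed w∈) wc we wf wa }) small
              where open Component closed linked

    -- Besides `u`, a component cannot touch both `f` and `c`. Dropping either one leaves a
    -- five-cycle through `u` and the four other old vertices, and the hypotheses exclude a centre
    -- in each case.
    at-abe : (∀ {w} → w ∈ˢ U → Adj w a → Adj w b → Adj w c → ¬ Adj w e) →
      (∀ {w} → w ∈ˢ U → Adj w e → Adj w f → Adj w a → ¬ Adj w b) →
      Adj u a → Adj u b → Adj u e → Goal U
    at-abe ¬abce ¬efab ua ub ue = by-components handle
      where
      handle : ∀ V → ClosedIn (remove U u) V → Linked (_∈ˢ V) → Goal V
      handle V closed linked with Nbr? V u | Nbr? V f | Nbr? V c
      ... | no ¬u | _ | _ = Component.avoiding-u closed linked ¬u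
      ... | yes nu | no ¬f | _ = recurse {V} {a} {b} {c} {e} {u} (record
              { cycle = record { ab = ab ; bc = bc ; ce = ce ; ef = Adj-sym ue ; fa = ua
                               ; a≢c = a≢c ; a≢e = a≢e ; b≢e = b≢e ; b≢f = u≢ #1 ∘ sym ; c≢f = u≢ #2 ∘ sym }
              ; region = shrink (#1 ∷ #2 ∷ #3 ∷ #4 ∷ #0 ∷ [])
                  ((λ _ → #4) ∷ (λ _ → #0) ∷ (λ _ → #1) ∷ (λ _ → #2) ∷ (λ _ → #3) ∷ (λ nb → ⊥-elim (¬f nb)) ∷ [])
              ; centreless = λ w∈ wa wb wc we _ → ¬abce (part-of region u∈ closed w∈) wa wb wc we }) small
              where open Component closed linked
      ... | yes nu | yes nf | no ¬c = recurse {V} {b} {a} {f} {e} {u} (record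
              { cycle = record { ab = Adj-sym ab ; bc = Adj-sym fa ; ce = Adj-sym ef ; ef = Adj-sym ue ; fa = ub
                               ; a≢c = b≢f ; a≢e = b≢e ; b≢e = a≢e ; b≢f = u≢ #0 ∘ sym ; c≢f = u≢ #4 ∘ sym }
              ; region = shrink (#2 ∷ #1 ∷ #5 ∷ #4 ∷ #0 ∷ [])
                  ((λ _ → #4) ∷ (λ _ → #1) ∷ (λ _ → #0) ∷ (λ nb → ⊥-elim (¬c nb)) ∷ (λ _ → #3) ∷ (λ _ → #2) ∷ [])
              ; centreless = λ w∈ wb wa wf we _ → ¬efab (part-of region u∈ closed w∈) we wf wa wb }) small
              where open Component closed linked
      ... | yes nu | yes nf | yes nc = ⊥-elim (Component.ufc-clash closed linked ua ue nu nf nc)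

  Quad : Fin n → Fin n → Fin n → Fin n → Fin n → Set
  Quad w a b c e = Adj w a × Adj w b × Adj w c × Adj w e

  quad? : ∀ w a b c e → Dec (Quad w a b c e)
  quad? w a b c e = Adj? w a ×-dec (Adj? w b ×-dec (Adj? w c ×-dec Adj? w e))

  -- Up to rotation a triple in a five-cycle is either three consecutive vertices or an edge with
  -- the vertex opposite to it; the two summands list the five rotations of each.
  triple₅ : ∀ {P : Fin n → Set} {a b c e f x y z} → (x ∷ y ∷ z ∷ []) ⊆ (a ∷ b ∷ c ∷ e ∷ f ∷ []) →
    P x → P y → P z →
    ((P a × P b × P c) ⊎ (P b × P c × P e) ⊎ (P c × P e × P f) ⊎ (P e × P f × P a) ⊎ (P f × P a × P b)) ⊎
    ((P a × P b × P e) ⊎ (P b × P c × P f) ⊎ (P c × P e × P a) ⊎ (P e × P f × P b) ⊎ (P f × P a × P c))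
  triple₅ (refl ∷ refl ∷ refl ∷ _)           p q r = inj₁ (inj₁ (p , q , r))
  triple₅ (_ ∷ʳ refl ∷ refl ∷ refl ∷ _)      p q r = inj₁ (inj₂ (inj₁ (p , q , r)))
  triple₅ (_ ∷ʳ _ ∷ʳ refl ∷ refl ∷ refl ∷ _) p q r = inj₁ (inj₂ (inj₂ (inj₁ (p , q , r))))
  triple₅ (refl ∷ _ ∷ʳ _ ∷ʳ refl ∷ refl ∷ _) p q r = inj₁ (inj₂ (inj₂ (inj₂ (inj₁ (q , r , p)))))
  triple₅ (refl ∷ refl ∷ _ ∷ʳ _ ∷ʳ refl ∷ _) p q r = inj₁ (inj₂ (inj₂ (inj₂ (inj₂ (r , p , q)))))
  triple₅ (refl ∷ refl ∷ _ ∷ʳ refl ∷ _)      p q r = inj₂ (inj₁ (p , q , r))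
  triple₅ (_ ∷ʳ refl ∷ refl ∷ _ ∷ʳ refl ∷ _) p q r = inj₂ (inj₂ (inj₁ (p , q , r)))
  triple₅ (refl ∷ _ ∷ʳ refl ∷ refl ∷ _)      p q r = inj₂ (inj₂ (inj₂ (inj₁ (q , r , p))))
  triple₅ (_ ∷ʳ refl ∷ _ ∷ʳ refl ∷ refl ∷ _) p q r = inj₂ (inj₂ (inj₂ (inj₂ (inj₁ (q , r , p)))))
  triple₅ (refl ∷ _ ∷ʳ refl ∷ _ ∷ʳ refl ∷ _) p q r = inj₂ (inj₂ (inj₂ (inj₂ (inj₂ (r , p , q)))))
  triple₅ (_ ∷ʳ _ ∷ʳ _ ∷ʳ s)                 p q r = too-long s ℕₚ.≤-refl
  triple₅ (_ ∷ʳ _ ∷ʳ refl ∷ _ ∷ʳ s)          p q r = too-long s ℕₚ.≤-refl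
  triple₅ (_ ∷ʳ refl ∷ _ ∷ʳ _ ∷ʳ s)          p q r = too-long s ℕₚ.≤-refl
  triple₅ (refl ∷ _ ∷ʳ _ ∷ʳ _ ∷ʳ s)          p q r = too-long s ℕₚ.≤-refl

  -- The search for four consecutive neighbours comes first, since its failure supplies the
  -- exclusions that keep the later five-cycles centreless.
  five-goal : ∀ m {U a b c e f} → Five U a b c e f → ∣ U ∣ < m → Goal U
  five-goal (suc m) {U} {a} {b} {c} {e} {f} F (s≤s U≤m) = decide
    (Finₚ.any? λ u → (u ∈ˢ? U) ×-dec (quad? u a b c e ⊎-dec (quad? u b c e f ⊎-dec
      (quad? u c e f a ⊎-dec (quad? u e f a b ⊎-dec quad? u f a b c)))))
    (few-or-triple U (a ∷ b ∷ c ∷ e ∷ f ∷ []))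
    where
    open Five F
    open Cycle₅ cycle
    F₁ = five-rotate F
    F₂ = five-rotate F₁
    F₃ = five-rotate F₂
    F₄ = five-rotate F₃
    recurse : ∀ {V a b c e f} → Five V a b c e f → ∣ V ∣ < ∣ U ∣ → Goal V
    recurse F′ lt = five-goal m F′ (ℕₚ.≤-trans lt U≤m)
    decide : Dec (∃ λ u → u ∈ˢ U × (Quad u a b c e ⊎ Quad u b c e f ⊎ Quad u c e f a ⊎ Quad u e f a b ⊎ Quad u f a b c)) →
      (∀ {w} → w ∈ˢ U → count w (a ∷ b ∷ c ∷ e ∷ f ∷ []) ≤ 2) ⊎
        (∃ λ u → u ∈ˢ U × Triple u (a ∷ b ∷ c ∷ e ∷ f ∷ [])) → Goal U
    decide (yes (u , u∈ , inj₁ (p , q , r , s))) _ = at-abce F u∈ recurse p q r s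
    decide (yes (u , u∈ , inj₂ (inj₁ (p , q , r , s)))) _ = at-abce F₁ u∈ recurse p q r s
    decide (yes (u , u∈ , inj₂ (inj₂ (inj₁ (p , q , r , s))))) _ = at-abce F₂ u∈ recurse p q r s
    decide (yes (u , u∈ , inj₂ (inj₂ (inj₂ (inj₁ (p , q , r , s)))))) _ = at-abce F₃ u∈ recurse p q r s
    decide (yes (u , u∈ , inj₂ (inj₂ (inj₂ (inj₂ (p , q , r , s)))))) _ = at-abce F₄ u∈ recurse p q r s
    decide (no _) (inj₁ few) = Low.low-goal region unique few (chain-walkable (ab ∷ bc ∷ ce ∷ ef ∷ [-])) (a , #0)
    decide (no none) (inj₂ (u , u∈ , x , y , z , sub , ux , uy , uz)) = by-triple (triple₅ {Adj u} sub ux uy uz)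
      where
      ¬abce : ∀ {w} → w ∈ˢ U → Adj w a → Adj w b → Adj w c → ¬ Adj w e
      ¬abce w∈ p q r s = none (_ , w∈ , inj₁ (p , q , r , s))
      ¬bcef : ∀ {w} → w ∈ˢ U → Adj w b → Adj w c → Adj w e → ¬ Adj w f
      ¬bcef w∈ p q r s = none (_ , w∈ , inj₂ (inj₁ (p , q , r , s)))
      ¬cefa : ∀ {w} → w ∈ˢ U → Adj w c → Adj w e → Adj w f → ¬ Adj w a
      ¬cefa w∈ p q r s = none (_ , w∈ , inj₂ (inj₂ (inj₁ (p , q , r , s))))
      ¬efab : ∀ {w} → w ∈ˢ U → Adj w e → Adj w f → Adj w a → ¬ Adj w b
      ¬efab w∈ p q r s = none (_ , w∈ , inj₂ (inj₂ (inj₂ (inj₁ (p , q , r , s)))))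
      ¬fabc : ∀ {w} → w ∈ˢ U → Adj w f → Adj w a → Adj w b → ¬ Adj w c
      ¬fabc w∈ p q r s = none (_ , w∈ , inj₂ (inj₂ (inj₂ (inj₂ (p , q , r , s)))))
      by-triple : _ → Goal U
      by-triple (inj₁ (inj₁ (p , q , r)))                      = at-abc F u∈ recurse ¬cefa p q r
      by-triple (inj₁ (inj₂ (inj₁ (p , q , r))))               = at-abc F₁ u∈ recurse ¬efab p q r
      by-triple (inj₁ (inj₂ (inj₂ (inj₁ (p , q , r)))))        = at-abc F₂ u∈ recurse ¬fabc p q r
      by-triple (inj₁ (inj₂ (inj₂ (inj₂ (inj₁ (p , q , r)))))) = at-abc F₃ u∈ recurse ¬abce p q r
      by-triple (inj₁ (inj₂ (inj₂ (inj₂ (inj₂ (p , q , r)))))) = at-abc F₄ u∈ recurse ¬bcef p q r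
      by-triple (inj₂ (inj₁ (p , q , r)))                      = at-abe F u∈ recurse ¬abce ¬efab p q r
      by-triple (inj₂ (inj₂ (inj₁ (p , q , r))))               = at-abe F₁ u∈ recurse ¬bcef ¬fabc p q r
      by-triple (inj₂ (inj₂ (inj₂ (inj₁ (p , q , r)))))        = at-abe F₂ u∈ recurse ¬cefa ¬abce p q r
      by-triple (inj₂ (inj₂ (inj₂ (inj₂ (inj₁ (p , q , r)))))) = at-abe F₃ u∈ recurse ¬efab ¬bcef p q r
      by-triple (inj₂ (inj₂ (inj₂ (inj₂ (inj₂ (p , q , r)))))) = at-abe F₄ u∈ recurse ¬fabc ¬cefa p q r

  five : ∀ {U a b c e f} → Five U a b c e f → Goal U
  five {U} F = five-goal (suc ∣ U ∣) F ℕₚ.≤-refl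

-- The outer cycle and the extension of its monomials.

module OuterCycle {n} (G : PlaneGraph n) (len : ℕ) (o : Fin (PlaneGraph.d G))
  (near : IsNearTriangulation G len o) (chordless : Chordless G len o) where
  open PlaneGraph G
  open IsNearTriangulation near
  open Potential G o using (forward; forward-or-rev; forward-ordered)
  open Coefficients {n}
  open Enumerations {n}
  open Comprehension {n}
  open Precoloured G o
  open Regions G o

  vertex : Fin len → Fin n
  vertex = cyc G len o

  next : Fin len → Fin n
  next = cycNext G len o

  side-edge : ∀ j → Adj (tail (iter φ j o)) (tail (iter φ (suc j) o))
  side-edge j = iter φ j o , refl , sym (rot-tail (rev (iter φ j o)))

  closing-edge : ∀ {j} → suc j ≡ len → Adj (tail (iter φ j o)) (tail o)
  closing-edge {j} eq = subst (λ x → Adj (tail (iter φ j o)) (tail x))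
    (trans (cong (λ k → iter φ k o) eq) outer-close) (side-edge j)

  vertex-distinct : ∀ {j k} → j < len → k < len → j ≢ k → tail (iter φ j o) ≢ tail (iter φ k o)
  vertex-distinct j< k< j≢k eq = j≢k (outer-cycle _ _ j< k< eq)

  on-cycle? : ∀ w → Dec (∃ λ k → vertex k ≡ w)
  on-cycle? w = Finₚ.any? λ k → vertex k Finₚ.≟ w

  inner? : ∀ w → Dec (¬ ∃ λ k → vertex k ≡ w)
  inner? w = ¬? (on-cycle? w)

  inner : Subset n
  inner = ⟪ inner? ⟫

  vertex∉inner : ∀ k → ¬ vertex k ∈ˢ inner
  vertex∉inner k p = ⟪⟫∋ inner? p (k , refl)

  outer-vertex : ∀ {w} → ¬ w ∈ˢ inner → ∃ λ k → vertex k ≡ w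
  outer-vertex {w} w∉ = decidable-stable (on-cycle? w) λ none → w∉ (∈⟪⟫ inner? none)

  -- The cyclic successor without modular arithmetic; the second case closes the cycle.
  Position : Fin len → Fin len → Set
  Position k l = (toℕ k ≡ suc (toℕ l)) ⊎ (toℕ k ≡ 0 × suc (toℕ l) ≡ len)

  successor-position : ∀ {k l} → vertex k ≡ next l → Position k l
  successor-position {k} {l} eq with ℕₚ.m≤n⇒m<n∨m≡n (Finₚ.toℕ<n l)
  ... | inj₁ lt = inj₁ (outer-cycle _ _ (Finₚ.toℕ<n k) lt eq)
  ... | inj₂ e  = inj₂ (outer-cycle _ _ (Finₚ.toℕ<n k) (ℕₚ.≤-trans (s≤s z≤n) len≥3)
                    (trans eq (cong tail (trans (cong (λ j → iter φ j o) e) outer-close))) , e)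

  next-outer : ∀ l → ∃ λ k → vertex k ≡ next l
  next-outer l with ℕₚ.m≤n⇒m<n∨m≡n (Finₚ.toℕ<n l)
  ... | inj₁ lt = Fin.fromℕ< lt , cong (λ j → tail (iter φ j o)) (Finₚ.toℕ-fromℕ< lt)
  ... | inj₂ e  = Fin.fromℕ< 0<len , trans (cong (λ j → tail (iter φ j o)) (Finₚ.toℕ-fromℕ< 0<len))
                    (sym (cong tail (trans (cong (λ j → iter φ j o) e) outer-close)))
    where
    0<len : 0 < len
    0<len = ℕₚ.≤-trans (s≤s z≤n) len≥3

  not-mutual : ∀ {k l} → Position k l → ¬ Position l k
  not-mutual (inj₁ p) (inj₁ q) = ℕₚ.<-irrefl (trans p (cong suc q)) (ℕₚ.m<n⇒m<1+n (ℕₚ.n<1+n _))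
  not-mutual (inj₁ p) (inj₂ (q , e)) = ℕₚ.<⇒≢ len≥3 (trans (cong suc (sym (trans p (cong suc q)))) e)
  not-mutual (inj₂ (p , e)) (inj₁ q) = ℕₚ.<⇒≢ len≥3 (trans (cong suc (sym (trans q (cong suc p)))) e)
  not-mutual (inj₂ (p , e)) (inj₂ (q , e′)) =
    ℕₚ.<⇒≢ (ℕₚ.≤-trans (s≤s (s≤s z≤n)) len≥3) (trans (cong suc (sym q)) e)

  map-allPairs : ∀ {A : Set} {xs : List A} (f : A → Edge) → Unique xs →
    (∀ {x y} → x ∈ xs → y ∈ xs → x ≢ y → Distinct (f x) (f y)) → AllPairs Distinct (List.map f xs)
  map-allPairs f [] _ = []
  map-allPairs f (x∉ ∷ unique) distinct =
    Allₚ.map⁺ (All.tabulate λ y∈ → distinct (here refl) (there y∈) (All.lookup x∉ y∈)) ∷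
    map-allPairs f unique λ p q → distinct (there p) (there q)

  OnCycle : Relation
  OnCycle a b = Adj a b × (¬ a ∈ˢ inner × ¬ b ∈ˢ inner)

  -- Chordlessness makes the list complete, and length at least three prevents an edge from being
  -- listed a second time in reverse.
  cycle-Enum : Enum OnCycle (cycleEdges G len o)
  cycle-Enum = record { sound = sound ; complete = complete ; simple = simple }
    where
    f : Fin len → Edge
    f k = vertex k , next k
    sound : ∀ {u v} → (u , v) ∈ cycleEdges G len o → OnCycle u v
    sound e∈ with ∈ₚ.∈-map⁻ f e∈
    ... | k , _ , refl = side-edge (toℕ k) , vertex∉inner k ,
      let l , eq = next-outer k in subst (λ w → ¬ w ∈ˢ inner) eq (vertex∉inner l)
    complete : ∀ {u v} → OnCycle u v → (u , v) ∈ᵤ cycleEdges G len o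
    complete (a , u∉ , v∉) with outer-vertex u∉ | outer-vertex v∉
    ... | k , refl | l , refl with chordless k l a
    ...   | inj₁ eq = inj₁ (subst (λ w → (vertex k , w) ∈ cycleEdges G len o) eq (∈ₚ.∈-map⁺ f (∈ₚ.∈-allFin k)))
    ...   | inj₂ eq = inj₂ (subst (λ w → (vertex l , w) ∈ cycleEdges G len o) eq (∈ₚ.∈-map⁺ f (∈ₚ.∈-allFin l)))
    simple : AllPairs Distinct (cycleEdges G len o)
    simple = map-allPairs f (Uniqueₚ.allFin⁺ len) λ {k} {l} _ _ k≢l →
      (λ (p , _) → k≢l (Finₚ.toℕ-injective (outer-cycle _ _ (Finₚ.toℕ<n k) (Finₚ.toℕ<n l) p))) ,
      λ (p , q) → not-mutual (successor-position {k} {l} p) (successor-position {l} {k} (sym q))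

  edges-Enum : Enum Adj edges
  edges-Enum = record { sound = sound ; complete = complete ; simple = simple }
    where
    f : Fin d → Edge
    f x = tail x , tail (rev x)
    sound : ∀ {u v} → (u , v) ∈ edges → Adj u v
    sound e∈ with ∈ₚ.∈-map⁻ f e∈
    ... | x , _ , refl = x , refl , refl
    complete : ∀ {u v} → Adj u v → (u , v) ∈ᵤ edges
    complete (x , refl , refl) with forward-or-rev x
    ... | inj₁ x∈ = inj₁ (∈ₚ.∈-map⁺ f x∈)
    ... | inj₂ x∈ = inj₂ (subst (λ y → (tail (rev x) , tail y) ∈ edges) (rev-invol x) (∈ₚ.∈-map⁺ f x∈))
    simple : AllPairs Distinct edges
    simple = map-allPairs f (Uniqueₚ.filter⁺ _ (Uniqueₚ.allFin⁺ d)) λ {x} {y} x∈ y∈ x≢y →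
      (λ (p , q) → x≢y (no-multi x y p q)) ,
      λ (p , q) → let x≡ = no-multi x (rev y) p (trans q (sym (cong tail (rev-invol y)))) in
        ℕₚ.<-asym (forward-ordered y∈) (subst (λ z → toℕ (rev y) < toℕ z) (rev-invol y)
          (subst (λ z → toℕ z < toℕ (rev z)) x≡ (forward-ordered x∈)))

  inner-region : Region inner (List.map vertex (List.allFin len))
  inner-region = record { free = free ; around = around }
    where
    free : ∀ {k} → k ∈ List.map vertex (List.allFin len) → ¬ k ∈ˢ inner
    free k∈ with ∈ₚ.∈-map⁻ vertex k∈
    ... | k , _ , refl = vertex∉inner k
    around : ∀ {w x} → w ∈ˢ inner → Adj w x → ¬ x ∈ˢ inner → x ∈ List.map vertex (List.allFin len)
    around _ _ x∉ with outer-vertex x∉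
    ... | k , refl = ∈ₚ.∈-map⁺ vertex (∈ₚ.∈-allFin k)

  -- Inner variables do not occur in the cycle edges, so `α` vanishes on `inner` while `β` vanishes
  -- off it. Their sum thus has the exponents of `α` on the cycle and those of `β` inside, and the
  -- gluing principle applies with the inner vertices as private variables.
  extend : Goal inner → ∀ α → coeff (cycleEdges G len o) α ≢ + 0 →
    Σ (Fin n → ℕ) λ e →
      (∀ k → e (vertex k) ≡ α (vertex k)) ×
      (∀ w → Interior G len o w → e w ≤ 4) ×
      coeff edges e ≢ + 0
  extend (goal β β-off β≤4 (fs , F , β≢0)) α α≢0 = (λ w → α w Nat.+ β w) ,
    (λ k → trans (cong (α (vertex k) Nat.+_) (β-off (vertex∉inner k))) (ℕₚ.+-identityʳ _)) ,
    (λ w interior → ℕₚ.≤-trans (ℕₚ.≤-reflexive (cong (Nat._+ β w)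
      (α-inner (∈⟪⟫ inner? λ (k , eq) → interior k eq)))) (β≤4 w)) ,
    ∼-nonzero (Enum-∼ edges-Enum (Enum-resp from to (Enum-++ apart F cycle-Enum)))
      (product-nonzero X {cycleEdges G len o} {fs} {α} {β}
        (All.tabulate λ e∈ → let _ , u∉ , v∉ = Enum.sound cycle-Enum e∈ in
          dec-false (_ ∈ˢ? inner) u∉ , dec-false (_ ∈ˢ? inner) v∉)
        (λ w eq → α-inner (X-true eq))
        (λ w eq → β-off λ w∈ → contradiction (trans (sym eq) (dec-true (w ∈ˢ? inner) w∈)) λ ())
        α≢0 β≢0)
    where
    X : Fin n → Bool
    X w = does (w ∈ˢ? inner)
    X-true : ∀ {w} → X w ≡ true → w ∈ˢ inner
    X-true {w} eq with w ∈ˢ? inner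
    ... | yes p = p
    α-inner : ∀ {w} → w ∈ˢ inner → α w ≡ 0
    α-inner {w} w∈ = absent-zero w (Enum-avoids cycle-Enum λ (_ , u∉ , v∉) →
      (λ { refl → u∉ w∈ }) , (λ { refl → v∉ w∈ })) α≢0
    apart : Apart (Meeting inner) OnCycle
    apart (_ , p) = (λ (_ , u∉ , v∉) → [ u∉ , v∉ ]′ p) , (λ (_ , v∉ , u∉) → [ u∉ , v∉ ]′ p)
    from : ∀ {u v} → (Meeting inner ∪ᴿ OnCycle) u v → Adj u v
    from = [ proj₁ , proj₁ ]′
    to : ∀ {u v} → Adj u v → (Meeting inner ∪ᴿ OnCycle) u v
    to {u} {v} a with u ∈ˢ? inner | v ∈ˢ? inner
    ... | yes u∈ | _      = inj₁ (a , inj₁ u∈)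
    ... | no _   | yes v∈ = inj₁ (a , inj₂ v∈)
    ... | no u∉  | no v∉  = inj₂ (a , u∉ , v∉)

-- The three lengths of the outer cycle.

module _ {n} (G : PlaneGraph n) (o : Fin (PlaneGraph.d G)) where
  open PlaneGraph G using (Adj)
  open Regions G o using (Goal)
  open ShortCycles G o

  triangle-goal : (near : IsNearTriangulation G 3 o) (chordless : Chordless G 3 o) →
    Goal (OuterCycle.inner G 3 o near chordless)
  triangle-goal near chordless = three (side-edge 0) (side-edge 1) (closing-edge refl) inner-region
    where open OuterCycle G 3 o near chordless

  square-goal : (near : IsNearTriangulation G 4 o) (chordless : Chordless G 4 o) →
    Goal (OuterCycle.inner G 4 o near chordless)
  square-goal near chordless = four (record
    { ab = side-edge 0 ; bc = side-edge 1 ; ce = side-edge 2 ; ea = closing-edge refl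
    ; a≢c = differ 0 2 _ _ λ () ; b≢e = differ 1 3 _ _ λ () } , inner-region)
    where
    open OuterCycle G 4 o near chordless
    differ = λ j k (j< : T (suc j Nat.≤ᵇ 4)) (k< : T (suc k Nat.≤ᵇ 4)) →
      vertex-distinct {j} {k} (ℕₚ.≤ᵇ⇒≤ _ _ j<) (ℕₚ.≤ᵇ⇒≤ _ _ k<)

  pentagon-goal : (near : IsNearTriangulation G 5 o) (chordless : Chordless G 5 o) →
    (∀ w → Interior G 5 o w → ¬ (∀ k → Adj w (cyc G 5 o k))) →
    Goal (OuterCycle.inner G 5 o near chordless)
  pentagon-goal near chordless no-centre = five record
    { cycle = record
        { ab = side-edge 0 ; bc = side-edge 1 ; ce = side-edge 2 ; ef = side-edge 3 ; fa = closing-edge refl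
        ; a≢c = differ 0 2 _ _ λ () ; a≢e = differ 0 3 _ _ λ () ; b≢e = differ 1 3 _ _ λ ()
        ; b≢f = differ 1 4 _ _ λ () ; c≢f = differ 2 4 _ _ λ () }
    ; region = inner-region
    ; centreless = λ {w} w∈ p q r s t → no-centre w (λ k eq → ⟪⟫∋ inner? w∈ (k , eq)) λ
        { zero → p ; (suc zero) → q ; (suc (suc zero)) → r ; (suc (suc (suc zero))) → s
        ; (suc (suc (suc (suc zero)))) → t } }
    where
    open OuterCycle G 5 o near chordless
    open Comprehension {n} using (⟪⟫∋)
    differ = λ j k (j< : T (suc j Nat.≤ᵇ 5)) (k< : T (suc k Nat.≤ᵇ 5)) →
      vertex-distinct {j} {k} (ℕₚ.≤ᵇ⇒≤ _ _ j<) (ℕₚ.≤ᵇ⇒≤ _ _ k<)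

theorem3p1 : ∀ {n} (G : PlaneGraph n) (i : ℕ) (o : Fin (PlaneGraph.d G)) →
    IsNearTriangulation G i o →
    Chordless G i o →
    (i ≡ 3 ⊎ i ≡ 4 ⊎ i ≡ 5) →
    (i ≡ 5 → ∀ w → Interior G i o w → ¬ (∀ k → PlaneGraph.Adj G w (cyc G i o k))) →
    ∀ (α : Fin n → ℕ) → coeff (cycleEdges G i o) α ≢ + 0 →
    Σ (Fin n → ℕ) λ e →
    (∀ k → e (cyc G i o k) ≡ α (cyc G i o k)) ×
    (∀ w → Interior G i o w → e w ≤ 4) ×
    coeff (PlaneGraph.edges G) e ≢ + 0
theorem3p1 G _ o near chordless (inj₁ refl) _ =
  OuterCycle.extend G 3 o near chordless (triangle-goal G o near chordless)
theorem3p1 G _ o near chordless (inj₂ (inj₁ refl)) _ =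
  OuterCycle.extend G 4 o near chordless (square-goal G o near chordless)
theorem3p1 G _ o near chordless (inj₂ (inj₂ refl)) no-centre =
  OuterCycle.extend G 5 o near chordless (pentagon-goal G o near chordless (no-centre refl))
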